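{- Let $t \le 400$ and let $\lambda_1,\ldots,\lambda_t$ be positive integers. Then the domination polynomial of the spider graph $S(\lambda_1,\ldots,\lambda_t)$ is unimodal.
   Context: For a finite simple graph $G$ on $n$ vertices, a set $U \subseteq V(G)$ is dominating if every vertex of $G$ is in $U$ or adjacent to a vertex of $U$. Let $d_i(G)$ be the number of dominating sets of $G$ of size $i$; the domination polynomial is $D(G,x)=\sum_{i=1}^n d_i(G)x^i$. A polynomial is unimodal if its sequence of coefficients (ordered by increasing power of $x$) is non-decreasing and then non-increasing. The spider graph $S(\lambda_1,\ldots,\lambda_t)$ is formed by taking $t$ vertex-disjoint paths on $\lambda_1,\ldots,\lambda_t$ vertices respectively, together with an additional central vertex joined by an edge to one endpoint of each path; each such path is a leg of length $\lambda_i$. -}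

module Defs where

open import Data.Nat using (ℕ; zero; suc; _+_; _∸_; _≤_; _<_; _≡ᵇ_; _≤ᵇ_; _<ᵇ_)
open import Data.Bool using (Bool; true; false; _∧_; _∨_; not; T?; _≟_)
open import Data.Fin using (Fin; toℕ)
open import Data.Vec using (Vec; []; _∷_; lookup; count; toList)
open import Data.List using (List; []; _∷_; map; _++_; length; filter; upTo; foldr)
open import Data.Bool.ListAction using (any; all)
open import Data.Nat.ListAction using (sum)
open import Data.Vec using () renaming (allFin to allFinV)
open import Relation.Binary.PropositionalEquality using (_≡_)
open import Data.Product using (Σ; _×_; ∃-syntax)

-- A graph on vertex set Fin n is given by its (boolean) adjacency
-- relation.  The spider graph below is simple by construction (its
-- adjacency is symmetric and irreflexive).
Graph : ℕ → Set
Graph n = Fin n → Fin n → Bool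

VSubset : ℕ → Set
VSubset n = Vec Bool n

allSubsets : (n : ℕ) → List (VSubset n)
allSubsets zero    = [] ∷ []
allSubsets (suc n) = map (false ∷_) (allSubsets n) ++ map (true ∷_) (allSubsets n)

size : ∀ {n} → VSubset n → ℕ
size = count (λ b → b ≟ true)

vertices : (n : ℕ) → List (Fin n)
vertices n = toList (allFinV n)

isDominating : ∀ {n} → Graph n → VSubset n → Bool
isDominating {n} G U =
  all (λ v → lookup U v ∨ any (λ u → lookup U u ∧ G v u) (vertices n)) (vertices n)

domCount : ∀ {n} → Graph n → ℕ → ℕ
domCount {n} G i =
  length (filter (λ U → T? (isDominating G U ∧ (size U ≡ᵇ i))) (allSubsets n))

-- Coefficient list of D(G,x) = Σ_{i=1}^n d_i(G) x^i, ordered by increasing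
-- power: [d_1(G), ..., d_n(G)].
domCoeffs : ∀ {n} → Graph n → List ℕ
domCoeffs {n} G = map (λ i → domCount G (suc i)) (upTo n)

nth : List ℕ → ℕ → ℕ
nth []       _       = 0
nth (x ∷ xs) zero    = x
nth (x ∷ xs) (suc i) = nth xs i

Unimodal : List ℕ → Set
Unimodal as = ∃[ k ]
  ( (∀ i → suc i ≤ k → nth as i ≤ nth as (suc i))
  × (∀ i → k ≤ i → suc i < length as → nth as (suc i) ≤ nth as i) )

-- Spider graph S(λ_1,...,λ_t).
-- Vertex labels: 0 is the centre; leg j (with λ_j vertices) occupies
-- labels o_j, o_j+1, ..., o_j+λ_j-1 where o_j = 1 + λ_1 + ... + λ_{j-1};
-- o_j is the endpoint joined to the centre, consecutive labels in a leg
-- are joined (the path).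

-- directed edge test on labels (each undirected edge listed once),
-- for legs given as a list, first leg starting at label o
spiderEdgeℕ : List ℕ → ℕ → ℕ → ℕ → Bool
spiderEdgeℕ []       o u v = false
spiderEdgeℕ (l ∷ ls) o u v =
  centreEdge ∨ pathEdge ∨ spiderEdgeℕ ls (o + l) u v
  where
    inLeg : ℕ → Bool
    inLeg x = (o ≤ᵇ x) ∧ (x <ᵇ o + l)
    centreEdge : Bool
    centreEdge = (0 <ᵇ l) ∧ (u ≡ᵇ 0) ∧ (v ≡ᵇ o)
    pathEdge : Bool
    pathEdge = inLeg u ∧ inLeg v ∧ (v ≡ᵇ suc u)

spiderSize : List ℕ → ℕ
spiderSize ls = suc (sum ls)

spider : (ls : List ℕ) → Graph (spiderSize ls)
spider ls u v = spiderEdgeℕ ls 1 (toℕ u) (toℕ v) ∨ spiderEdgeℕ ls 1 (toℕ v) (toℕ u)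

-- Let A, D, E be the generating functions, by size, of the subsets of a leg that dominate it when the centre is chosen,
-- when it is not, and when neither it nor the endpoint next to it is. With F, G, H their products over all legs, the
-- domination polynomial is x F + g, g = G − H.
--
-- Inequalities between coefficients of F and g are statements that an alternating series in two variables, built from
-- F(x), g(x), F(y), g(y), has non-negative coefficients above the diagonal. These series form a cone closed under
-- multiplication by x + y and x y, and the products of the polynomials of a leg in x with those of the same leg in y
-- expand with coefficients in ℕ[x + y, x y]; so the inequalities propagate from the spider without legs to all spiders.
-- Besides log-concavity of F and g this yields, for the weights (c₀, c₁, c₂) = (1, 1, 0) and (2, 1, 3),
--   c₀ (Fᵢ² − Fᵢ₋₁Fᵢ₊₁) + c₁ (gᵢFᵢ − Fᵢ₋₁gᵢ₊₁) + c₂ (gᵢ₊₁Fᵢ₋₁ − Fᵢ₋₂gᵢ₊₂) ≥ 0.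
-- Together they show that past the mode of F every descent of x F + g is followed by another one, provided that
-- 2Fᵢ − 4Fᵢ₋₁ + 3Fᵢ₋₂ ≥ 0. The latter is inherited by supersets of legs and holds for a single leg with at least
-- 18 vertices; it leaves finitely many spiders (674 of them), whose unimodality is verified by evaluation.
module Submission where

-- Since g is a difference of two products, no inequality for it passes to a larger spider by
-- itself. Attaching a leg decomposes into eight elementary operations, and these multiply F(x)
-- F(y), G(x) F(y) and F(x) G(y) by different factors. One inequality therefore has to be
-- strengthened to families with free exponents, on which the operations merely raise an exponent.
-- The cost appears at the spider without legs, where infinitely many explicit series must lie in
-- the cone: there `h` acts on the differences y^k - x^k by a tridiagonal matrix, and integer
-- vectors of length three bound the critical ones. The weights come from the end of the argument.
-- Let F(i-1) + g(i) ≥ F(i) + g(i+1) be a descent. Multiplied by g(i) F(i-1), the next descent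
-- follows from the weights (1, 1, 0) while g grows by a factor between 1 and 3/2. For faster growth
-- the multiplier is 2 F(i-1); the gain 2 g(i+1) - 3 g(i) then pays, provided that g(i+2) occurs
-- with the factor 3 F(i-2) - 2 F(i-1). This leads to (2, 1, 3), and past the mode that factor is
-- non-negative by a condition on F alone.

-- The ring of formal power series over a commutative ring.

module FormalPowerSeries where
  open import Algebra.Bundles using (CommutativeRing)
  open import Level using (0ℓ)

  module PowerSeries (R : CommutativeRing 0ℓ 0ℓ) where
    open import Data.Nat.Base using (ℕ; zero; suc)
    open import Data.Product.Base using (_,_)
    open CommutativeRing R
      renaming (Carrier to K; _≈_ to _≈ᴿ_; _+_ to _+ᴿ_; _*_ to _*ᴿ_; -_ to -ᴿ_; 0# to 0ᴿ; 1# to 1ᴿ)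
    open import Algebra.Properties.CommutativeSemigroup +-commutativeSemigroup using (interchange)
    open import Relation.Binary.Reasoning.Setoid setoid

    Series : Set
    Series = ℕ → K

    infix 4 _≋_
    _≋_ : Series → Series → Set
    f ≋ g = ∀ n → f n ≈ᴿ g n

    infixl 6 _⊕_
    infixl 7 _⊛_
    -- The Cauchy product is unrolled along its first factor, f g = f₀ g + x (f′ g) with f′ the
    -- shifted series, so every ring law becomes an induction on the index.
    _⊕_ _⊛_ : Series → Series → Series
    (f ⊕ g) n = f n +ᴿ g n
    (f ⊛ g) zero    = f 0 *ᴿ g 0
    (f ⊛ g) (suc n) = f 0 *ᴿ g (suc n) +ᴿ ((λ k → f (suc k)) ⊛ g) n

    ⊖_ : Series → Series
    (⊖ f) n = -ᴿ f n

    C : K → Series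
    C c zero    = c
    C c (suc _) = 0ᴿ

    X : Series
    X zero          = 0ᴿ
    X (suc zero)    = 1ᴿ
    X (suc (suc _)) = 0ᴿ

    ⊛-cong : ∀ {f f′ g g′} → f ≋ f′ → g ≋ g′ → f ⊛ g ≋ f′ ⊛ g′
    ⊛-cong p q zero    = *-cong (p 0) (q 0)
    ⊛-cong p q (suc n) = +-cong (*-cong (p 0) (q (suc n))) (⊛-cong (λ k → p (suc k)) q n)

    ⊛-distribʳ : ∀ h f g → (f ⊕ g) ⊛ h ≋ (f ⊛ h) ⊕ (g ⊛ h)
    ⊛-distribʳ h f g zero    = distribʳ _ _ _
    ⊛-distribʳ h f g (suc n) = trans (+-cong (distribʳ _ _ _) (⊛-distribʳ h _ _ n)) (interchange _ _ _ _)

    0-⊛ : ∀ {f} → (∀ n → f n ≈ᴿ 0ᴿ) → ∀ g n → (f ⊛ g) n ≈ᴿ 0ᴿ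
    0-⊛ p g zero    = trans (*-congʳ (p 0)) (zeroˡ _)
    0-⊛ p g (suc n) = trans (+-cong (trans (*-congʳ (p 0)) (zeroˡ _)) (0-⊛ (λ k → p (suc k)) g n)) (+-identityˡ _)

    C-⊛ : ∀ c g n → (C c ⊛ g) n ≈ᴿ c *ᴿ g n
    C-⊛ c g zero    = refl
    C-⊛ c g (suc n) = trans (+-congˡ (0-⊛ (λ _ → refl) g n)) (+-identityʳ _)

    X-⊛-zero : ∀ g → (X ⊛ g) 0 ≈ᴿ 0ᴿ
    X-⊛-zero g = zeroˡ _

    X-⊛-suc : ∀ g n → (X ⊛ g) (suc n) ≈ᴿ g n
    X-⊛-suc g n = begin
      0ᴿ *ᴿ g (suc n) +ᴿ ((λ k → X (suc k)) ⊛ g) n  ≈⟨ +-cong (zeroˡ _) (⊛-cong (λ { zero → refl ; (suc _) → refl }) (λ _ → refl) n) ⟩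
      0ᴿ +ᴿ (C 1ᴿ ⊛ g) n                          ≈⟨ +-identityˡ _ ⟩
      (C 1ᴿ ⊛ g) n                               ≈⟨ C-⊛ 1ᴿ g n ⟩
      1ᴿ *ᴿ g n                                   ≈⟨ *-identityˡ _ ⟩
      g n                                        ∎

    scale-⊛ : ∀ c f g n → ((λ k → c *ᴿ f k) ⊛ g) n ≈ᴿ c *ᴿ (f ⊛ g) n
    scale-⊛ c f g zero    = *-assoc _ _ _
    scale-⊛ c f g (suc n) = trans (+-cong (*-assoc _ _ _) (scale-⊛ c _ g n)) (sym (distribˡ _ _ _))

    -- The mirror image of the defining recursion, splitting off the last summand instead of the
    -- first. Commutativity is the agreement of the two.
    ⊛-last : ∀ f g n → (f ⊛ g) (suc n) ≈ᴿ (f ⊛ (λ k → g (suc k))) n +ᴿ f (suc n) *ᴿ g 0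
    ⊛-last f g zero    = refl
    ⊛-last f g (suc n) = trans (+-congˡ (⊛-last (λ k → f (suc k)) g n)) (sym (+-assoc _ _ _))

    ⊛-comm : ∀ f g → f ⊛ g ≋ g ⊛ f
    ⊛-comm f g zero    = *-comm _ _
    ⊛-comm f g (suc n) = begin
      f 0 *ᴿ g (suc n) +ᴿ ((λ k → f (suc k)) ⊛ g) n  ≈⟨ +-cong (*-comm _ _) (⊛-comm _ g n) ⟩
      g (suc n) *ᴿ f 0 +ᴿ (g ⊛ (λ k → f (suc k))) n  ≈⟨ +-comm _ _ ⟩
      (g ⊛ (λ k → f (suc k))) n +ᴿ g (suc n) *ᴿ f 0  ≈⟨ sym (⊛-last g f n) ⟩
      (g ⊛ f) (suc n)                              ∎

    ⊛-assoc : ∀ f g h → (f ⊛ g) ⊛ h ≋ f ⊛ (g ⊛ h)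
    ⊛-assoc f g h zero    = *-assoc _ _ _
    ⊛-assoc f g h (suc n) = begin
      (f 0 *ᴿ g 0) *ᴿ h (suc n) +ᴿ (((λ k → f 0 *ᴿ g (suc k)) ⊕ (f′ ⊛ g)) ⊛ h) n
        ≈⟨ +-cong (*-assoc _ _ _) (⊛-distribʳ h (λ k → f 0 *ᴿ g (suc k)) (f′ ⊛ g) n) ⟩
      f 0 *ᴿ (g 0 *ᴿ h (suc n)) +ᴿ (((λ k → f 0 *ᴿ g (suc k)) ⊛ h) n +ᴿ ((f′ ⊛ g) ⊛ h) n)
        ≈⟨ +-congˡ (+-cong (scale-⊛ (f 0) (λ k → g (suc k)) h n) (⊛-assoc f′ g h n)) ⟩
      f 0 *ᴿ (g 0 *ᴿ h (suc n)) +ᴿ (f 0 *ᴿ ((λ k → g (suc k)) ⊛ h) n +ᴿ (f′ ⊛ (g ⊛ h)) n)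
        ≈⟨ sym (+-assoc _ _ _) ⟩
      (f 0 *ᴿ (g 0 *ᴿ h (suc n)) +ᴿ f 0 *ᴿ ((λ k → g (suc k)) ⊛ h) n) +ᴿ (f′ ⊛ (g ⊛ h)) n
        ≈⟨ +-congʳ (sym (distribˡ _ _ _)) ⟩
      f 0 *ᴿ (g ⊛ h) (suc n) +ᴿ (f′ ⊛ (g ⊛ h)) n ∎
      where
      f′ : Series
      f′ k = f (suc k)

    seriesRing : CommutativeRing 0ℓ 0ℓ
    seriesRing = record
      { Carrier = Series ; _≈_ = _≋_ ; _+_ = _⊕_ ; _*_ = _⊛_ ; -_ = ⊖_ ; 0# = λ _ → 0ᴿ ; 1# = C 1ᴿ
      ; isCommutativeRing = record
        { isRing = record
          { +-isAbelianGroup = record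
            { isGroup = record
              { isMonoid = record
                { isSemigroup = record
                  { isMagma = record
                    { isEquivalence = record
                      { refl = λ _ → refl ; sym = λ p n → sym (p n) ; trans = λ p q n → trans (p n) (q n) }
                    ; ∙-cong = λ p q n → +-cong (p n) (q n) }
                  ; assoc = λ f g h n → +-assoc _ _ _ }
                ; identity = (λ f n → +-identityˡ _) , (λ f n → +-identityʳ _) }
              ; inverse = (λ f n → -‿inverseˡ _) , (λ f n → -‿inverseʳ _)
              ; ⁻¹-cong = λ p n → -‿cong (p n) }
            ; comm = λ f g n → +-comm _ _ }
          ; *-cong = ⊛-cong
          ; *-assoc = ⊛-assoc
          ; *-identity = 1-⊛ , (λ f n → trans (⊛-comm f (C 1ᴿ) n) (1-⊛ f n))
          ; distrib = (λ f g h n → trans (⊛-comm f (g ⊕ h) n) (trans (⊛-distribʳ f g h n)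
                        (+-cong (⊛-comm g f n) (⊛-comm h f n)))) , ⊛-distribʳ }
        ; *-comm = ⊛-comm } }
      where
      1-⊛ : ∀ f → C 1ᴿ ⊛ f ≋ f
      1-⊛ f n = trans (C-⊛ 1ᴿ f n) (*-identityˡ _)

    open import Algebra.Properties.Ring ring using (-0#≈0#)
    open import Algebra.Solver.Ring.AlmostCommutativeRing
      using (fromCommutativeRing; _-Raw-AlmostCommutative⟶_)
    open import Algebra.Bundles using (RawRing)
    open _-Raw-AlmostCommutative⟶_

    C-+ : ∀ a b → C (a +ᴿ b) ≋ C a ⊕ C b
    C-+ a b zero    = refl
    C-+ a b (suc n) = sym (+-identityˡ _)

    C-* : ∀ a b → C (a *ᴿ b) ≋ C a ⊛ C b
    C-* a b zero    = refl
    C-* a b (suc n) = sym (trans (C-⊛ a (C b) (suc n)) (zeroʳ a))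

    C-cong : ∀ {a b} → a ≈ᴿ b → C a ≋ C b
    C-cong p zero    = p
    C-cong p (suc n) = refl

    C-neg : ∀ a → C (-ᴿ a) ≋ ⊖ C a
    C-neg a zero    = refl
    C-neg a (suc n) = sym -0#≈0#

    -- Applied twice, this sends the integers to the constants of ℤ⟦x⟧⟦y⟧.
    extend : ∀ {Z : RawRing 0ℓ 0ℓ} → Z -Raw-AlmostCommutative⟶ fromCommutativeRing R →
             Z -Raw-AlmostCommutative⟶ fromCommutativeRing seriesRing
    extend m = record
      { ⟦_⟧    = λ z → C (⟦ m ⟧ z)
      ; +-homo = λ a b n → trans (C-cong (+-homo m a b) n) (C-+ _ _ n)
      ; *-homo = λ a b n → trans (C-cong (*-homo m a b) n) (C-* _ _ n)
      ; -‿homo = λ a n → trans (C-cong (-‿homo m a) n) (C-neg _ n)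
      ; 0-homo = λ { zero → 0-homo m ; (suc n) → refl }
      ; 1-homo = C-cong (1-homo m) }

-- Polynomial identities with integer coefficients in commutative rings.

module IntegerSolver where
  open import Algebra.Bundles using (CommutativeRing; RawRing)
  open import Level using (0ℓ)
  open import Algebra.Solver.Ring.AlmostCommutativeRing
    using (fromCommutativeRing; _-Raw-AlmostCommutative⟶_; -raw-almostCommutative⟶)
  open import Data.Integer.Properties using (+-*-commutativeRing)

  ℤ-raw : RawRing 0ℓ 0ℓ
  ℤ-raw = CommutativeRing.rawRing +-*-commutativeRing

  module IntSolver (R : CommutativeRing 0ℓ 0ℓ) (ι : ℤ-raw -Raw-AlmostCommutative⟶ fromCommutativeRing R) where
    open import Data.Integer.Properties using (_≟_)
    open import Data.Maybe.Base using (Maybe; just; nothing)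
    open import Relation.Nullary.Decidable using (yes; no)
    open import Relation.Binary.PropositionalEquality using (refl)
    open _-Raw-AlmostCommutative⟶_ ι using (⟦_⟧)

    weak : ∀ a b → Maybe (CommutativeRing._≈_ R ⟦ a ⟧ ⟦ b ⟧)
    weak a b with a ≟ b
    ... | yes refl = just (CommutativeRing.refl R)
    ... | no _     = nothing

    open import Algebra.Solver.Ring ℤ-raw (fromCommutativeRing R) ι weak public
      using (solve; _:=_; _:+_; _:*_; _:-_; :-_; con; Polynomial)

-- Rings with a cone, and products of consecutive terms of the leg recurrence in x and in y.

module ConeRings where
  open import Algebra.Bundles using (CommutativeRing)
  open import Level using (0ℓ)
  open import Algebra.Solver.Ring.AlmostCommutativeRing
    using (fromCommutativeRing; _-Raw-AlmostCommutative⟶_)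
  open IntegerSolver
  open import Data.Integer.Base using (+_)
  open import Data.Nat.Base using (ℕ; zero; suc)

  module Powers (R : CommutativeRing 0ℓ 0ℓ) (ι : ℤ-raw -Raw-AlmostCommutative⟶ fromCommutativeRing R) where
    open CommutativeRing R
    one : Carrier
    one = _-Raw-AlmostCommutative⟶_.⟦_⟧ ι (+ 1)

    -- The unit is the image of 1 ∈ ℤ, so that the ring solver recognises it as a constant.
    pow : Carrier → ℕ → Carrier
    pow z zero    = one
    pow z (suc n) = z * pow z n

  -- Only the closure properties of the cone of alternating series are kept, so that all expansions
  -- below are identities in an arbitrary commutative ring. `Cone-cancel` permits multiplying a
  -- claim by x y before proving it.
  record ConeRing : Set₁ where
    field
      R : CommutativeRing 0ℓ 0ℓ
      ι : ℤ-raw -Raw-AlmostCommutative⟶ fromCommutativeRing R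
    open CommutativeRing R public
    open Powers R ι public
    field
      x y : Carrier
      Cone : Carrier → Set
      Cone-resp   : ∀ {f g} → f ≈ g → Cone f → Cone g
      Cone-+      : ∀ {f g} → Cone f → Cone g → Cone (f + g)
      Cone-V      : ∀ {f} → Cone f → Cone ((x + y) * f)
      Cone-e      : ∀ {f} → Cone f → Cone ((x * y) * f)
      Cone-d      : ∀ k → Cone (pow y k - pow x k)
      Cone-cancel : ∀ {f} → Cone ((x * y) * f) → Cone f

  module Cones (CR : ConeRing) where
    open ConeRing CR public
    open IntSolver R ι public

    e V d1 : Carrier
    e = x * y
    V = x + y
    d1 = y - x

    -- These elements form a semiring containing x + y and x y. Membership replaces an explicit
    -- presentation as a polynomial in x + y and x y over ℕ.
    Mult : Carrier → Set
    Mult n = ∀ {f} → Cone f → Cone (n * f)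

    Cone-0 : Cone 0#
    Cone-0 = Cone-resp (-‿inverseʳ one) (Cone-d 0)

    one≈1 : one ≈ 1#
    one≈1 = _-Raw-AlmostCommutative⟶_.1-homo ι

    idʳ : ∀ z → z * one ≈ z
    idʳ z = trans (*-congˡ one≈1) (*-identityʳ z)

    idˡ : ∀ z → one * z ≈ z
    idˡ z = trans (*-congʳ one≈1) (*-identityˡ z)

    Cone-d1 : Cone d1
    Cone-d1 = Cone-resp (+-cong (idʳ y) (-‿cong (idʳ x))) (Cone-d 1)

    Mult-resp : ∀ {m n} → m ≈ n → Mult m → Mult n
    Mult-resp p M c = Cone-resp (*-congʳ p) (M c)

    infixl 6 _⊞_
    infixl 7 _⊡_
    _⊞_ : ∀ {m n} → Mult m → Mult n → Mult (m + n)
    (M ⊞ N) c = Cone-resp (sym (distribʳ _ _ _)) (Cone-+ (M c) (N c))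

    _⊡_ : ∀ {m n} → Mult m → Mult n → Mult (m * n)
    (M ⊡ N) c = Cone-resp (sym (*-assoc _ _ _)) (M (N c))

    Mult-1 : Mult 1#
    Mult-1 c = Cone-resp (sym (*-identityˡ _)) c

    Mult-one : Mult one
    Mult-one = Mult-resp (sym one≈1) Mult-1

    Mult-0 : Mult 0#
    Mult-0 c = Cone-resp (sym (zeroˡ _)) Cone-0

    -- For three consecutive terms of the leg recurrence in x and in y: their products are σ + x τ with multipliers
    -- σ and τ, and budget pays for the only subtraction that occurs when a leg is expanded.
    record Pairing (gx0 gx1 gx2 gy0 gy1 gy2 : Carrier) : Set where
      field
        a0 a1 a2 s1 t0 t1 p q w ρ : Carrier
        Ma0 : Mult a0
        Ma1 : Mult a1
        Ma2 : Mult a2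
        Ms1 : Mult s1
        Mt0 : Mult t0
        Mt1 : Mult t1
        Mp  : Mult p
        Mq  : Mult q
        Mw  : Mult w
        Mρ  : Mult ρ
        eq00 : gx0 * gy0 ≈ a0
        eq11 : gx1 * gy1 ≈ a1
        eq22 : gx2 * gy2 ≈ a2
        eq01 : gx0 * gy1 ≈ e * (t1 + w) + x * t0
        eq10 : gx1 * gy0 ≈ e * (t1 + w) + y * t0
        eq12 : gx1 * gy2 ≈ s1 + x * t1
        eq21 : gx2 * gy1 ≈ s1 + y * t1
        eq02 : gx0 * gy2 ≈ p + x * q + x * x * t1
        eq20 : gx2 * gy0 ≈ p + y * q + y * y * t1
        budget : a0 + a0 + e * (a1 + a2 + (s1 + s1) + V * t1)
                 ≈ e * (t0 + q + V * t1) + (e * t0 + e * t0) + ρ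
      s0 BB S1 S2 S3 S2′ : Carrier
      s0 = e * (t1 + w)
      BB = e * (a1 + a2 + (s1 + s1) + V * t1)
      S1 = e * (a1 + s1)
      S2 = e * (t0 + q + V * t1)
      S3 = e * t0
      S2′ = e * w + p
      Ms0 : Mult s0
      Ms0 = Cone-e ⊡ (Mt1 ⊞ Mw)
      MBB : Mult BB
      MBB = Cone-e ⊡ (Ma1 ⊞ Ma2 ⊞ (Ms1 ⊞ Ms1) ⊞ Cone-V ⊡ Mt1)
      MS1 : Mult S1
      MS1 = Cone-e ⊡ (Ma1 ⊞ Ms1)
      MS2 : Mult S2
      MS2 = Cone-e ⊡ (Mt0 ⊞ Mq ⊞ Cone-V ⊡ Mt1)
      MS3 : Mult S3
      MS3 = Cone-e ⊡ Mt0
      MS2′ : Mult S2′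
      MS2′ = Cone-e ⊡ Mw ⊞ Mp

    pairing₀ : Pairing 1# 0# 0# 1# 0# 0#
    pairing₀ = record
      { a0 = 1# ; a1 = 0# ; a2 = 0# ; s1 = 0# ; t0 = 0# ; t1 = 0# ; p = 0# ; q = 0# ; w = 0# ; ρ = 1# + 1#
      ; Ma0 = Mult-1 ; Ma1 = Mult-0 ; Ma2 = Mult-0 ; Ms1 = Mult-0 ; Mt0 = Mult-0 ; Mt1 = Mult-0
      ; Mp = Mult-0 ; Mq = Mult-0 ; Mw = Mult-0 ; Mρ = Mult-1 ⊞ Mult-1
      ; eq00 = *-identityˡ _ ; eq11 = zeroˡ _ ; eq22 = zeroˡ _
      ; eq01 = z1 x ; eq10 = z2 y
      ; eq12 = z3 x ; eq21 = z3 y ; eq02 = z4 x ; eq20 = z5 y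
      ; budget = z6 x y }
      where
      z1 : ∀ z → 1# * 0# ≈ e * (0# + 0#) + z * 0#
      z1 z = trans (zeroʳ _) (sym (trans (+-cong (trans (*-congˡ (+-identityˡ _)) (zeroʳ _)) (zeroʳ _)) (+-identityˡ _)))
      z2 : ∀ z → 0# * 1# ≈ e * (0# + 0#) + z * 0#
      z2 z = trans (*-comm _ _) (z1 z)
      z3 : ∀ z → 0# * 0# ≈ 0# + z * 0#
      z3 z = trans (zeroʳ _) (sym (trans (+-identityˡ _) (zeroʳ _)))
      z4 : ∀ z → 1# * 0# ≈ 0# + z * 0# + z * z * 0#
      z4 z = trans (zeroʳ _) (sym (trans (+-cong (trans (+-identityˡ _) (zeroʳ _)) (zeroʳ _)) (+-identityˡ _)))
      z5 : ∀ z → 0# * 1# ≈ 0# + z * 0# + z * z * 0#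
      z5 z = trans (*-comm _ _) (z4 z)
      z6 : ∀ x y → 1# + 1# + e * (0# + 0# + (0# + 0#) + V * 0#) ≈ e * (0# + 0# + V * 0#) + (e * 0# + e * 0#) + (1# + 1#)
      z6 x y = trans (+-congˡ (trans (*-congˡ (trans (+-cong (trans (+-cong (+-identityˡ _) (+-identityˡ _)) (+-identityˡ _)) (zeroʳ _)) (+-identityˡ _))) (zeroʳ _)))
        (trans (+-comm _ _) (+-congʳ (sym (trans (+-cong (trans (*-congˡ (trans (+-cong (+-identityˡ _) (zeroʳ _)) (+-identityˡ _))) (zeroʳ _)) (trans (+-cong (zeroʳ _) (zeroʳ _)) (+-identityˡ _))) (+-identityˡ _)))))

    module Step {gx0 gx1 gx2 gy0 gy1 gy2} (P : Pairing gx0 gx1 gx2 gy0 gy1 gy2) where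
      open Pairing P

      bilinear : ∀ u0 u1 u2 v0 v1 v2 →
        (u0 * gx0 + u1 * gx1 + u2 * gx2) * (v0 * gy0 + v1 * gy1 + v2 * gy2) ≈
        u0 * v0 * a0 + u0 * v1 * (s0 + x * t0) + u0 * v2 * (p + x * q + x * x * t1)
        + (u1 * v0 * (s0 + y * t0) + u1 * v1 * a1 + u1 * v2 * (s1 + x * t1))
        + (u2 * v0 * (p + y * q + y * y * t1) + u2 * v1 * (s1 + y * t1) + u2 * v2 * a2)
      bilinear u0 u1 u2 v0 v1 v2 = trans
        (solve 12 (λ u0 u1 u2 v0 v1 v2 gx0 gx1 gx2 gy0 gy1 gy2 →
          (u0 :* gx0 :+ u1 :* gx1 :+ u2 :* gx2) :* (v0 :* gy0 :+ v1 :* gy1 :+ v2 :* gy2) :=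
          u0 :* v0 :* (gx0 :* gy0) :+ u0 :* v1 :* (gx0 :* gy1) :+ u0 :* v2 :* (gx0 :* gy2)
          :+ (u1 :* v0 :* (gx1 :* gy0) :+ u1 :* v1 :* (gx1 :* gy1) :+ u1 :* v2 :* (gx1 :* gy2))
          :+ (u2 :* v0 :* (gx2 :* gy0) :+ u2 :* v1 :* (gx2 :* gy1) :+ u2 :* v2 :* (gx2 :* gy2)))
          refl u0 u1 u2 v0 v1 v2 gx0 gx1 gx2 gy0 gy1 gy2)
        (+-cong (+-cong (+-cong (+-cong (*-congˡ eq00) (*-congˡ eq01)) (*-congˡ eq02))
                        (+-cong (+-cong (*-congˡ eq10) (*-congˡ eq11)) (*-congˡ eq12)))
                (+-cong (+-cong (*-congˡ eq20) (*-congˡ eq21)) (*-congˡ eq22)))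

      -- The recurrence maps (g0, g1, g2) to (z (g0 + g1 + g2), g0, g1). Products of the last two
      -- new terms are old ones, so `a1`, `a2`, `s1` and `t1` just move along. In a product with the
      -- new leading term, the outer x meets the y of y t0, y q and y² t1 and produces e.
      step : Pairing (x * (gx0 + gx1 + gx2)) gx0 gx1 (y * (gy0 + gy1 + gy2)) gy0 gy1
      step = record
        { a0 = e * (a0 + a1 + a2 + (e * w + e * w) + V * t0 + (s1 + s1) + V * t1 + (p + p) + V * q + V * V * t1)
        ; a1 = a0 ; a2 = a1 ; s1 = s0 ; t0 = a0 + p + e * w ; t1 = t0 ; p = e * t1 ; q = s0 + s1 + a1
        ; w = q + V * t1
        ; ρ = e * ((a1 + a1) + (a2 + a2) + e * w + (V * t0 + V * t0) + (s1 + s1 + s1) + (V * t1 + V * t1) + p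
                   + (V * q + V * q) + (V * V * t1 + V * V * t1) + s0)
        ; Ma0 = Cone-e ⊡ (Ma0 ⊞ Ma1 ⊞ Ma2 ⊞ (Cone-e ⊡ Mw ⊞ Cone-e ⊡ Mw) ⊞ Cone-V ⊡ Mt0 ⊞ (Ms1 ⊞ Ms1) ⊞ Cone-V ⊡ Mt1
                  ⊞ (Mp ⊞ Mp) ⊞ Cone-V ⊡ Mq ⊞ Cone-V ⊡ Cone-V ⊡ Mt1)
        ; Ma1 = Ma0 ; Ma2 = Ma1 ; Ms1 = Ms0 ; Mt0 = Ma0 ⊞ Mp ⊞ Cone-e ⊡ Mw ; Mt1 = Mt0 ; Mp = Cone-e ⊡ Mt1
        ; Mq = Ms0 ⊞ Ms1 ⊞ Ma1 ; Mw = Mq ⊞ Cone-V ⊡ Mt1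
        ; Mρ = Cone-e ⊡ ((Ma1 ⊞ Ma1) ⊞ (Ma2 ⊞ Ma2) ⊞ Cone-e ⊡ Mw ⊞ (Cone-V ⊡ Mt0 ⊞ Cone-V ⊡ Mt0) ⊞ (Ms1 ⊞ Ms1 ⊞ Ms1)
                 ⊞ (Cone-V ⊡ Mt1 ⊞ Cone-V ⊡ Mt1) ⊞ Mp ⊞ (Cone-V ⊡ Mq ⊞ Cone-V ⊡ Mq)
                 ⊞ (Cone-V ⊡ Cone-V ⊡ Mt1 ⊞ Cone-V ⊡ Cone-V ⊡ Mt1) ⊞ Ms0)
        ; eq00 = trans (solve 8 (λ x y gx0 gx1 gx2 gy0 gy1 gy2 →
                     (x :* (gx0 :+ gx1 :+ gx2)) :* (y :* (gy0 :+ gy1 :+ gy2)) :=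
                     (x :* gx0 :+ x :* gx1 :+ x :* gx2) :* (y :* gy0 :+ y :* gy1 :+ y :* gy2)) refl x y gx0 gx1 gx2 gy0 gy1 gy2)
                 (trans (bilinear x x x y y y)
                 (solve 11 (λ x y a0 a1 a2 s1 t0 t1 p q w →
                   let e = x :* y ; V = x :+ y ; s0 = e :* (t1 :+ w) in
                   x :* y :* a0 :+ x :* y :* (s0 :+ x :* t0) :+ x :* y :* (p :+ x :* q :+ x :* x :* t1)
                   :+ (x :* y :* (s0 :+ y :* t0) :+ x :* y :* a1 :+ x :* y :* (s1 :+ x :* t1))
                   :+ (x :* y :* (p :+ y :* q :+ y :* y :* t1) :+ x :* y :* (s1 :+ y :* t1) :+ x :* y :* a2)
                   := e :* (a0 :+ a1 :+ a2 :+ (e :* w :+ e :* w) :+ V :* t0 :+ (s1 :+ s1) :+ V :* t1 :+ (p :+ p) :+ V :* q :+ V :* V :* t1))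
                   refl x y a0 a1 a2 s1 t0 t1 p q w))
        ; eq11 = eq00 ; eq22 = eq11
        -- The summand e t1 of `s0`, multiplied by x, completes e y t1 to e (x + y) t1; this is why
        -- `s0` is kept in the form e (t1 + w).
        ; eq01 = trans (solve 5 (λ x gx0 gx1 gx2 gy0 → (x :* (gx0 :+ gx1 :+ gx2)) :* gy0
                     := x :* (gx0 :* gy0 :+ gx1 :* gy0 :+ gx2 :* gy0)) refl x gx0 gx1 gx2 gy0)
                 (trans (*-congˡ (+-cong (+-cong eq00 eq10) eq20))
                 (solve 8 (λ x y a0 t0 t1 p q w → x :* (a0 :+ (x :* y :* (t1 :+ w) :+ y :* t0) :+ (p :+ y :* q :+ y :* y :* t1))
                     := x :* y :* (t0 :+ (q :+ (x :+ y) :* t1)) :+ x :* (a0 :+ p :+ x :* y :* w)) refl x y a0 t0 t1 p q w))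
        ; eq10 = trans (solve 5 (λ y gy0 gy1 gy2 gx0 → gx0 :* (y :* (gy0 :+ gy1 :+ gy2))
                     := y :* (gx0 :* gy0 :+ gx0 :* gy1 :+ gx0 :* gy2)) refl y gy0 gy1 gy2 gx0)
                 (trans (*-congˡ (+-cong (+-cong eq00 eq01) eq02))
                 (solve 8 (λ x y a0 t0 t1 p q w → y :* (a0 :+ (x :* y :* (t1 :+ w) :+ x :* t0) :+ (p :+ x :* q :+ x :* x :* t1))
                     := x :* y :* (t0 :+ (q :+ (x :+ y) :* t1)) :+ y :* (a0 :+ p :+ x :* y :* w)) refl x y a0 t0 t1 p q w))
        ; eq12 = eq01 ; eq21 = eq10
        ; eq02 = trans (solve 5 (λ x gx0 gx1 gx2 gy0 → (x :* (gx0 :+ gx1 :+ gx2)) :* gy0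
                     := x :* (gx0 :* gy0 :+ gx1 :* gy0 :+ gx2 :* gy0)) refl x gx0 gx1 gx2 gy1)
                 (trans (*-congˡ (+-cong (+-cong eq01 eq11) eq21))
                 (solve 7 (λ x y a1 s0 s1 t0 t1 → x :* ((s0 :+ x :* t0) :+ a1 :+ (s1 :+ y :* t1))
                     := x :* y :* t1 :+ x :* (s0 :+ s1 :+ a1) :+ x :* x :* t0) refl x y a1 s0 s1 t0 t1))
        ; eq20 = trans (solve 5 (λ y gy0 gy1 gy2 gx0 → gx0 :* (y :* (gy0 :+ gy1 :+ gy2))
                     := y :* (gx0 :* gy0 :+ gx0 :* gy1 :+ gx0 :* gy2)) refl y gy0 gy1 gy2 gx1)
                 (trans (*-congˡ (+-cong (+-cong eq10 eq11) eq12))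
                 (solve 7 (λ x y a1 s0 s1 t0 t1 → y :* ((s0 :+ y :* t0) :+ a1 :+ (s1 :+ x :* t1))
                     := x :* y :* t1 :+ y :* (s0 :+ s1 :+ a1) :+ y :* y :* t0) refl x y a1 s0 s1 t0 t1))
        ; budget = solve 11 (λ x y a0 a1 a2 s1 t0 t1 p q w →
                   let e = x :* y ; V = x :+ y ; s0 = e :* (t1 :+ w)
                       A = e :* (a0 :+ a1 :+ a2 :+ (e :* w :+ e :* w) :+ V :* t0 :+ (s1 :+ s1) :+ V :* t1 :+ (p :+ p) :+ V :* q :+ V :* V :* t1)
                       T = a0 :+ p :+ e :* w in
                   A :+ A :+ e :* (a0 :+ a1 :+ (s0 :+ s0) :+ V :* t0)
                   := e :* (T :+ (s0 :+ s1 :+ a1) :+ V :* t0) :+ (e :* T :+ e :* T)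
                      :+ e :* ((a1 :+ a1) :+ (a2 :+ a2) :+ e :* w :+ (V :* t0 :+ V :* t0) :+ (s1 :+ s1 :+ s1) :+ (V :* t1 :+ V :* t1) :+ p
                         :+ (V :* q :+ V :* q) :+ (V :* V :* t1 :+ V :* V :* t1) :+ s0))
                   refl x y a0 a1 a2 s1 t0 t1 p q w
        }

-- Products of leg polynomials, expanded with multipliers.

module LegProducts where
  open ConeRings
  open import Data.Integer.Base using (+_)

  module Legs (CR : ConeRing) where
    open Cones CR public

    -- `legO` is the part of D whose sets contain the endpoint next to the centre.
    legA legD legE legO : Carrier → Carrier → Carrier → Carrier → Carrier
    legA z g0 g1 g2 = z * (g0 + g1 + g2) + g0
    legE z g0 g1 g2 = z * (g1 + g2)
    legO z g0 g1 g2 = z * (g0 + g1)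
    legD z g0 g1 g2 = legE z g0 g1 g2 + legO z g0 g1 g2

    -- The factors of the operation `wide`. From h = wx + y² = wy + x² the recurrence of `U` later
    -- gets its error term.
    h wx wy : Carrier
    h  = x * x + (e + e + e + e) + y * y
    wx = x * x + (e + e + e + e)
    wy = y * y + (e + e + e + e)

    -- One multiplier for each of the elementary operations on good tuples whose sum attaches the leg.
    record LegKernel (Ax Ay Dx Dy Ex Ey : Carrier) : Set where
      field
        kE kG kG′ kT kT′ kS kSS kW : Carrier
        ME  : Mult kE
        MG  : Mult kG
        MG′ : Mult kG′
        MT  : Mult kT
        MT′ : Mult kT′
        MS  : Mult kS
        MSS : Mult kSS
        MW  : Mult kW
        AA : Ax * Ay ≈ (kE + kG + kG′) + (V * kT + V * kT′ + V * kS + V * V * kSS + h * kW)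
        DA : Dx * Ay ≈ (kG + kG′) + (x * kT + x * kT′ + V * kS + V * V * kSS + wx * kW)
        AD : Ax * Dy ≈ (kG + kG′) + (y * kT + y * kT′ + V * kS + V * V * kSS + wy * kW)
        EA : Ex * Ay ≈ kG + (x * kT′ + y * kS + y * y * kSS)
        AE : Ax * Ey ≈ kG + (y * kT′ + x * kS + x * x * kSS)

    module Long {gx0 gx1 gx2 gy0 gy1 gy2} (P : Pairing gx0 gx1 gx2 gy0 gy1 gy2) where
      open Pairing P
      open Step P using (bilinear)
      private
        nx = x * (gx0 + gx1 + gx2)
        ny = y * (gy0 + gy1 + gy2)
      Ax Ay Dx Dy Ex Ey : Carrier
      Ax = legA x nx gx0 gx1
      Ay = legA y ny gy0 gy1
      Dx = legD x nx gx0 gx1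
      Dy = legD y ny gy0 gy1
      Ex = legE x nx gx0 gx1
      Ey = legE y ny gy0 gy1

      -- With the recurrence applied once more, every coefficient has a factor z, and every product
      -- of a leg in x with one in y a factor e. Legs with at least two vertices can be written in
      -- this way.
      A-coeffs : ∀ z g0 g1 g2 → legA z (z * (g0 + g1 + g2)) g0 g1
                 ≈ (z * z + (z + z)) * g0 + (z * z + (z + z)) * g1 + (z * z + z) * g2
      A-coeffs = solve 4 (λ z g0 g1 g2 → z :* (z :* (g0 :+ g1 :+ g2) :+ g0 :+ g1) :+ z :* (g0 :+ g1 :+ g2)
                 := (z :* z :+ (z :+ z)) :* g0 :+ (z :* z :+ (z :+ z)) :* g1 :+ (z :* z :+ z) :* g2) refl

      D-coeffs : ∀ z g0 g1 g2 → legD z (z * (g0 + g1 + g2)) g0 g1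
                 ≈ (z * z + (z + z)) * g0 + (z * z + z) * g1 + (z * z) * g2
      D-coeffs = solve 4 (λ z g0 g1 g2 → z :* (g0 :+ g1) :+ z :* (z :* (g0 :+ g1 :+ g2) :+ g0)
                 := (z :* z :+ (z :+ z)) :* g0 :+ (z :* z :+ z) :* g1 :+ (z :* z) :* g2) refl

      -- The vanishing third coefficient is written z - z, so that `bilinear` applies to E as to A
      -- and D, with coefficients built from the variables.
      E-coeffs : ∀ z g0 g1 g2 → legE z (z * (g0 + g1 + g2)) g0 g1 ≈ z * g0 + z * g1 + (z - z) * g2
      E-coeffs = solve 4 (λ z g0 g1 g2 → z :* (g0 :+ g1) := z :* g0 :+ z :* g1 :+ (z :- z) :* g2) refl

      kG′₀ kE kG kT kT′ kS kSS kW Z : Carrier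
      kE   = BB + S1 + e * (S2′ + S2′)
      kG   = S1 + e * (e * t1) + e * S2 + e * S2′ + e * (a0 + a0) + e * a1 + V * S3 + e * (s0 + s0 + s0)
      kG′₀ = e * (e * t1) + e * V * S2 + e * (V + (e + e)) * S2′ + e * S2′ + e * (V + e) * a0 + e * s0
      kT   = BB + S2 + e * S2′
      kT′  = e * t1 + S2
      kS   = S1 + e * S2′ + e * a0 + S3 + e * s0
      kSS  = S3
      kW   = S2
      Z    = S2 + (S3 + S3)

      -- `kG′₀` is the visibly positive part of kG′. The rest is e (2 a0 + BB - S2 - 2 S3), which
      -- `budget` identifies as e ρ.
      use-budget : ∀ {L K U} → L ≈ K + (kG′₀ + (e * (a0 + a0 + BB) - e * Z)) + U → L ≈ K + (kG′₀ + e * ρ) + U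
      use-budget {L} {K} {U} p = trans p (trans
        (+-congʳ (+-congˡ (+-congˡ (+-congʳ (*-congˡ budget)))))
        (solve 6 (λ K G U e Z ρ → K :+ (G :+ (e :* (Z :+ ρ) :- e :* Z)) :+ U := K :+ (G :+ e :* ρ) :+ U) refl K kG′₀ U e Z ρ))

      private
        module Templates {n} (x y a0 a1 a2 s1 t0 t1 p q w : Polynomial n) where
          eᵖ   = x :* y
          Vᵖ   = x :+ y
          s0ᵖ   = eᵖ :* (t1 :+ w)
          BBᵖ  = eᵖ :* (a1 :+ a2 :+ (s1 :+ s1) :+ Vᵖ :* t1)
          S1ᵖ  = eᵖ :* (a1 :+ s1)
          S2ᵖ  = eᵖ :* (t0 :+ q :+ Vᵖ :* t1)
          S3ᵖ  = eᵖ :* t0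
          S2′ᵖ = eᵖ :* w :+ p
          kG′ᵖ    = eᵖ :* (eᵖ :* t1) :+ eᵖ :* Vᵖ :* S2ᵖ :+ eᵖ :* (Vᵖ :+ (eᵖ :+ eᵖ)) :* S2′ᵖ :+ eᵖ :* S2′ᵖ :+ eᵖ :* (Vᵖ :+ eᵖ) :* a0 :+ eᵖ :* s0ᵖ
                 :+ (eᵖ :* (a0 :+ a0 :+ BBᵖ) :- eᵖ :* (S2ᵖ :+ (S3ᵖ :+ S3ᵖ)))
          kEᵖ  = BBᵖ :+ S1ᵖ :+ eᵖ :* (S2′ᵖ :+ S2′ᵖ)
          kGᵖ  = S1ᵖ :+ eᵖ :* (eᵖ :* t1) :+ eᵖ :* S2ᵖ :+ eᵖ :* S2′ᵖ :+ eᵖ :* (a0 :+ a0) :+ eᵖ :* a1 :+ Vᵖ :* S3ᵖ :+ eᵖ :* (s0ᵖ :+ s0ᵖ :+ s0ᵖ)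
          kTᵖ  = BBᵖ :+ S2ᵖ :+ eᵖ :* S2′ᵖ
          kT′ᵖ = eᵖ :* t1 :+ S2ᵖ
          kSᵖ  = S1ᵖ :+ eᵖ :* S2′ᵖ :+ eᵖ :* a0 :+ S3ᵖ :+ eᵖ :* s0ᵖ
          wᵖ : Polynomial n → Polynomial n
          wᵖ z = z :* z :+ (eᵖ :+ eᵖ :+ eᵖ :+ eᵖ)

          expand : (u0 u1 u2 v0 v1 v2 : Polynomial n) → Polynomial n
          expand u0 u1 u2 v0 v1 v2 =
            u0 :* v0 :* a0 :+ u0 :* v1 :* (s0ᵖ :+ x :* t0) :+ u0 :* v2 :* (p :+ x :* q :+ x :* x :* t1)
            :+ (u1 :* v0 :* (s0ᵖ :+ y :* t0) :+ u1 :* v1 :* a1 :+ u1 :* v2 :* (s1 :+ x :* t1))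
            :+ (u2 :* v0 :* (p :+ y :* q :+ y :* y :* t1) :+ u2 :* v1 :* (s1 :+ y :* t1) :+ u2 :* v2 :* a2)

        A₀ A₂ : ∀ {n} → Polynomial n → Polynomial n
        A₀ z = z :* z :+ (z :+ z)
        A₂ z = z :* z :+ z

      AA₀ : Ax * Ay ≈ (kE + kG + (kG′₀ + e * ρ)) + (V * kT + V * kT′ + V * kS + V * V * kSS + h * kW)
      AA₀ = use-budget (trans (*-cong (A-coeffs x gx0 gx1 gx2) (A-coeffs y gy0 gy1 gy2))
        (trans (bilinear (x * x + (x + x)) (x * x + (x + x)) (x * x + x) (y * y + (y + y)) (y * y + (y + y)) (y * y + y))
        (solve 11 (λ x y a0 a1 a2 s1 t0 t1 p q w → let open Templates x y a0 a1 a2 s1 t0 t1 p q w in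
          expand (A₀ x) (A₀ x) (A₂ x) (A₀ y) (A₀ y) (A₂ y)
          := (kEᵖ :+ kGᵖ :+ kG′ᵖ) :+ (Vᵖ :* kTᵖ :+ Vᵖ :* kT′ᵖ :+ Vᵖ :* kSᵖ :+ Vᵖ :* Vᵖ :* S3ᵖ :+ (x :* x :+ (eᵖ :+ eᵖ :+ eᵖ :+ eᵖ) :+ y :* y) :* S2ᵖ)) refl x y a0 a1 a2 s1 t0 t1 p q w)))

      DA₀ : Dx * Ay ≈ (kG + (kG′₀ + e * ρ)) + (x * kT + x * kT′ + V * kS + V * V * kSS + wx * kW)
      DA₀ = use-budget (trans (*-cong (D-coeffs x gx0 gx1 gx2) (A-coeffs y gy0 gy1 gy2))
        (trans (bilinear (x * x + (x + x)) (x * x + x) (x * x) (y * y + (y + y)) (y * y + (y + y)) (y * y + y))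
        (solve 11 (λ x y a0 a1 a2 s1 t0 t1 p q w → let open Templates x y a0 a1 a2 s1 t0 t1 p q w in
          expand (A₀ x) (A₂ x) (x :* x) (A₀ y) (A₀ y) (A₂ y)
          := (kGᵖ :+ kG′ᵖ) :+ (x :* kTᵖ :+ x :* kT′ᵖ :+ Vᵖ :* kSᵖ :+ Vᵖ :* Vᵖ :* S3ᵖ :+ wᵖ x :* S2ᵖ)) refl x y a0 a1 a2 s1 t0 t1 p q w)))

      AD₀ : Ax * Dy ≈ (kG + (kG′₀ + e * ρ)) + (y * kT + y * kT′ + V * kS + V * V * kSS + wy * kW)
      AD₀ = use-budget (trans (*-cong (A-coeffs x gx0 gx1 gx2) (D-coeffs y gy0 gy1 gy2))
        (trans (bilinear (x * x + (x + x)) (x * x + (x + x)) (x * x + x) (y * y + (y + y)) (y * y + y) (y * y))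
        (solve 11 (λ x y a0 a1 a2 s1 t0 t1 p q w → let open Templates x y a0 a1 a2 s1 t0 t1 p q w in
          expand (A₀ x) (A₀ x) (A₂ x) (A₀ y) (A₂ y) (y :* y)
          := (kGᵖ :+ kG′ᵖ) :+ (y :* kTᵖ :+ y :* kT′ᵖ :+ Vᵖ :* kSᵖ :+ Vᵖ :* Vᵖ :* S3ᵖ :+ wᵖ y :* S2ᵖ)) refl x y a0 a1 a2 s1 t0 t1 p q w)))

      EA₀ : Ex * Ay ≈ kG + (x * kT′ + y * kS + y * y * kSS)
      EA₀ = trans (*-cong (E-coeffs x gx0 gx1 gx2) (A-coeffs y gy0 gy1 gy2))
        (trans (bilinear x x (x - x) (y * y + (y + y)) (y * y + (y + y)) (y * y + y))
        (solve 11 (λ x y a0 a1 a2 s1 t0 t1 p q w → let open Templates x y a0 a1 a2 s1 t0 t1 p q w in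
          expand x x (x :- x) (A₀ y) (A₀ y) (A₂ y)
          := kGᵖ :+ (x :* kT′ᵖ :+ y :* kSᵖ :+ y :* y :* S3ᵖ)) refl x y a0 a1 a2 s1 t0 t1 p q w))

      AE₀ : Ax * Ey ≈ kG + (y * kT′ + x * kS + x * x * kSS)
      AE₀ = trans (*-cong (A-coeffs x gx0 gx1 gx2) (E-coeffs y gy0 gy1 gy2))
        (trans (bilinear (x * x + (x + x)) (x * x + (x + x)) (x * x + x) y y (y - y))
        (solve 11 (λ x y a0 a1 a2 s1 t0 t1 p q w → let open Templates x y a0 a1 a2 s1 t0 t1 p q w in
          expand (A₀ x) (A₀ x) (A₂ x) y y (y :- y)
          := kGᵖ :+ (y :* kT′ᵖ :+ x :* kSᵖ :+ x :* x :* S3ᵖ)) refl x y a0 a1 a2 s1 t0 t1 p q w))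

      ME : Mult kE
      ME = MBB ⊞ MS1 ⊞ Cone-e ⊡ (MS2′ ⊞ MS2′)
      kernel : LegKernel Ax Ay Dx Dy Ex Ey
      kernel = record
        { kE = kE ; kG = kG ; kG′ = kG′₀ + e * ρ ; kT = kT ; kT′ = kT′ ; kS = kS ; kSS = kSS ; kW = kW
        ; ME = ME
        ; MG = MS1 ⊞ Cone-e ⊡ (Cone-e ⊡ Mt1) ⊞ Cone-e ⊡ MS2 ⊞ Cone-e ⊡ MS2′ ⊞ Cone-e ⊡ (Ma0 ⊞ Ma0) ⊞ Cone-e ⊡ Ma1
               ⊞ Cone-V ⊡ MS3 ⊞ Cone-e ⊡ (Ms0 ⊞ Ms0 ⊞ Ms0)
        ; MG′ = Cone-e ⊡ (Cone-e ⊡ Mt1) ⊞ Cone-e ⊡ Cone-V ⊡ MS2 ⊞ Cone-e ⊡ (Cone-V ⊞ (Cone-e ⊞ Cone-e)) ⊡ MS2′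
                ⊞ Cone-e ⊡ MS2′ ⊞ Cone-e ⊡ (Cone-V ⊞ Cone-e) ⊡ Ma0 ⊞ Cone-e ⊡ Ms0 ⊞ Cone-e ⊡ Mρ
        ; MT = MBB ⊞ MS2 ⊞ Cone-e ⊡ MS2′
        ; MT′ = Cone-e ⊡ Mt1 ⊞ MS2
        ; MS = MS1 ⊞ Cone-e ⊡ MS2′ ⊞ Cone-e ⊡ Ma0 ⊞ MS3 ⊞ Cone-e ⊡ Ms0
        ; MSS = MS3 ; MW = MS2
        ; AA = AA₀ ; DA = DA₀ ; AD = AD₀ ; EA = EA₀ ; AE = AE₀ }

    -- For one vertex A = 1 + z, D = z and E = 0. In the product 1 + x y + (x + y) of the A's, the
    -- three parts are handled by `undominated`, `no-gap` and `leafy`.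
    leaf-kernel : LegKernel (legA x 1# 0# 0#) (legA y 1# 0# 0#) (legD x 1# 0# 0#) (legD y 1# 0# 0#)
                            (legE x 1# 0# 0#) (legE y 1# 0# 0#)
    leaf-kernel = record
      { kE = 1# ; kG = 0# ; kG′ = e ; kT = 1# ; kT′ = 0# ; kS = 0# ; kSS = 0# ; kW = 0#
      ; ME = Mult-1 ; MG = Mult-0 ; MG′ = Cone-e ; MT = Mult-1 ; MT′ = Mult-0 ; MS = Mult-0 ; MSS = Mult-0 ; MW = Mult-0
      ; AA = trans (*-cong (A-leaf x) (A-leaf y)) (trans
               (solve 3 (λ x y u → (x :* u :+ u) :* (y :* u :+ u) := u :* u :+ x :* y :* (u :* u) :+ (x :+ y) :* (u :* u)) refl x y 1#)
               (+-cong (+-cong (trans (*-identityˡ _) (sym (+-identityʳ _))) (trans (*-congˡ (*-identityˡ _)) (*-identityʳ _)))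
                       (trans (*-congˡ (*-identityˡ _)) (sym (drop V V V (V * V) h)))))
      ; DA = trans (*-cong (D-leaf x) (A-leaf y)) (trans
               (solve 3 (λ x y u → (x :* u) :* (y :* u :+ u) := x :* y :* (u :* u) :+ x :* (u :* u)) refl x y 1#)
               (+-cong (trans (trans (*-congˡ (*-identityˡ _)) (*-identityʳ _)) (sym (+-identityˡ _)))
                       (trans (*-congˡ (*-identityˡ _)) (sym (drop x x V (V * V) wx)))))
      ; AD = trans (*-cong (A-leaf x) (D-leaf y)) (trans
               (solve 3 (λ x y u → (x :* u :+ u) :* (y :* u) := x :* y :* (u :* u) :+ y :* (u :* u)) refl x y 1#)
               (+-cong (trans (trans (*-congˡ (*-identityˡ _)) (*-identityʳ _)) (sym (+-identityˡ _)))
                       (trans (*-congˡ (*-identityˡ _)) (sym (drop y y V (V * V) wy)))))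
      ; EA = trans (*-congʳ (E-leaf x)) (trans (zeroˡ _) (sym (drop0 x y (y * y))))
      ; AE = trans (*-congˡ (E-leaf y)) (trans (zeroʳ _) (sym (drop0 y x (x * x)))) }
      where
      E-leaf : ∀ z → legE z 1# 0# 0# ≈ 0#
      E-leaf z = trans (*-congˡ (+-identityˡ _)) (zeroʳ _)
      D-leaf : ∀ z → legD z 1# 0# 0# ≈ z * 1#
      D-leaf z = trans (+-cong (E-leaf z) (*-congˡ (+-identityʳ _))) (+-identityˡ _)
      A-leaf : ∀ z → legA z 1# 0# 0# ≈ z * 1# + 1#
      A-leaf z = +-congʳ (*-congˡ (trans (+-identityʳ _) (+-identityʳ _)))
      z+ : ∀ {a b} → a ≈ 0# → b ≈ 0# → a + b ≈ 0#
      z+ p q = trans (+-cong p q) (+-identityˡ _)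
      +z : ∀ {a b} c → a ≈ b → a + c * 0# ≈ b
      +z c p = trans (+-cong p (zeroʳ c)) (+-identityʳ _)
      drop : ∀ c1 c2 c3 c4 c5 → c1 * 1# + c2 * 0# + c3 * 0# + c4 * 0# + c5 * 0# ≈ c1 * 1#
      drop c1 c2 c3 c4 c5 = +z c5 (+z c4 (+z c3 (+z c2 refl)))
      drop0 : ∀ c2 c3 c4 → 0# + (c2 * 0# + c3 * 0# + c4 * 0#) ≈ 0#
      drop0 c2 c3 c4 = z+ refl (+z c4 (+z c3 (zeroʳ c2)))

-- Inequalities between G, H and g = G - H.

module GapInequalities where
  open ConeRings
  open LegProducts
  open import Data.Nat.Base using (suc)

  module Gap (CR : ConeRing) where
    open Legs CR public

    -- E(x) O(y) and O(x) E(y) differ only in the variable attached to a common multiplier. This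
    -- keeps differences that change sign under exchanging x and y within the cone.
    record GapKernel (Ex Ey Ox Oy : Carrier) : Set where
      field
        n n′ : Carrier
        Mn  : Mult n
        Mn′ : Mult n′
        MEE : Mult (Ex * Ey)
        MOO : Mult (Ox * Oy)
        EO  : Ex * Oy ≈ n + y * n′
        OE  : Ox * Ey ≈ n + x * n′

    gap-kernel : ∀ {gx0 gx1 gx2 gy0 gy1 gy2} → Pairing gx0 gx1 gx2 gy0 gy1 gy2 →
                 GapKernel (legE x gx0 gx1 gx2) (legE y gy0 gy1 gy2) (legO x gx0 gx1 gx2) (legO y gy0 gy1 gy2)
    gap-kernel {gx0} {gx1} {gx2} {gy0} {gy1} {gy2} P = record
      { n = e * (e * w + a1 + p + s1) ; n′ = e * (t0 + q + V * t1 + t1)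
      ; Mn = Cone-e ⊡ (Cone-e ⊡ Mw ⊞ Ma1 ⊞ Mp ⊞ Ms1) ; Mn′ = Cone-e ⊡ (Mt0 ⊞ Mq ⊞ Cone-V ⊡ Mt1 ⊞ Mt1)
      ; MEE = Mult-resp (sym (trans (product gx1 gx2 gy1 gy2) (trans (*-congˡ (+-cong (+-cong (+-cong eq11 eq12) eq21) eq22))
          (solve 6 (λ x y a b s t → x :* y :* (a :+ (s :+ x :* t) :+ (s :+ y :* t) :+ b) := x :* y :* (a :+ b :+ (s :+ s) :+ (x :+ y) :* t))
             refl x y a1 a2 s1 t1)))) (Cone-e ⊡ (Ma1 ⊞ Ma2 ⊞ (Ms1 ⊞ Ms1) ⊞ Cone-V ⊡ Mt1))
      ; MOO = Mult-resp (sym (trans (product gx0 gx1 gy0 gy1) (trans (*-congˡ (+-cong (+-cong (+-cong eq00 eq01) eq10) eq11))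
          (solve 6 (λ x y a b s t → x :* y :* (a :+ (s :+ x :* t) :+ (s :+ y :* t) :+ b) := x :* y :* (a :+ b :+ (s :+ s) :+ (x :+ y) :* t))
             refl x y a0 a1 s0 t0)))) (Cone-e ⊡ (Ma0 ⊞ Ma1 ⊞ (Ms0 ⊞ Ms0) ⊞ Cone-V ⊡ Mt0))
      ; EO = trans (product gx1 gx2 gy0 gy1) (trans (*-congˡ (+-cong (+-cong (+-cong eq10 eq11) eq20) eq21))
          (solve 9 (λ x y a1 s1 t0 t1 p q w →
             x :* y :* ((x :* y :* (t1 :+ w) :+ y :* t0) :+ a1 :+ (p :+ y :* q :+ y :* y :* t1) :+ (s1 :+ y :* t1))
             := x :* y :* (x :* y :* w :+ a1 :+ p :+ s1) :+ y :* (x :* y :* (t0 :+ q :+ (x :+ y) :* t1 :+ t1)))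
             refl x y a1 s1 t0 t1 p q w))
      ; OE = trans (product gx0 gx1 gy1 gy2) (trans (*-congˡ (+-cong (+-cong (+-cong eq01 eq02) eq11) eq12))
          (solve 9 (λ x y a1 s1 t0 t1 p q w →
             x :* y :* ((x :* y :* (t1 :+ w) :+ x :* t0) :+ (p :+ x :* q :+ x :* x :* t1) :+ a1 :+ (s1 :+ x :* t1))
             := x :* y :* (x :* y :* w :+ a1 :+ p :+ s1) :+ x :* (x :* y :* (t0 :+ q :+ (x :+ y) :* t1 :+ t1)))
             refl x y a1 s1 t0 t1 p q w)) }
      where
      open Pairing P
      product : ∀ a b c d → (x * (a + b)) * (y * (c + d)) ≈ x * y * (a * c + a * d + b * c + b * d)
      product a b c d = solve 6 (λ x y a b c d → (x :* (a :+ b)) :* (y :* (c :+ d)) := x :* y :* (a :* c :+ a :* d :+ b :* c :+ b :* d))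
        refl x y a b c d

    -- Arbitrary exponents k are needed: attaching a leg mixes the exponents k and k + 1.
    record GapCones (Gx Gy Hx Hy gx gy : Carrier) : Set where
      field
        sumx : Gx ≈ gx + Hx
        sumy : Gy ≈ gy + Hy
        MG   : Mult (Gx * Gy)
        HG   : ∀ k → Cone (pow y k * (Hx * Gy) - pow x k * (Gx * Hy))
        gG   : ∀ k → Cone (pow y (suc k) * (gx * Gy) - pow x (suc k) * (Gx * gy))
        Gg   : Cone (y * (Gx * gy) - x * (gx * Gy))
        gg   : Cone (d1 * (gx * gy))

      -- Substituting H = G - g in `HG` with k = 0 cancels the products G(x) G(y).
      Gg₀ : Cone (Gx * gy - gx * Gy)
      Gg₀ = Cone-resp (trans
        (solve 5 (λ u gx hx gy hy → u :* (hx :* (gy :+ hy)) :- u :* ((gx :+ hx) :* hy) := u :* ((gx :+ hx) :* gy :- gx :* (gy :+ hy)))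
           refl one gx Hx gy Hy)
        (trans (idˡ _) (+-cong (*-congʳ (sym sumx)) (-‿cong (*-congˡ (sym sumy))))))
        (Cone-resp (+-cong (*-congˡ (*-congˡ sumy)) (-‿cong (*-congˡ (*-congʳ sumx)))) (HG 0))

    -- Each difference is expanded in E(x) E(y), O(x) O(y) and the mixed products; after `EO` and
    -- `OE` it becomes a sum of multiples of the given cone elements and of differences y^k - x^k.
    gap-step : ∀ {Gx Gy Hx Hy gx gy Ex Ey Ox Oy} → GapKernel Ex Ey Ox Oy → GapCones Gx Gy Hx Hy gx gy →
               GapCones (Gx * (Ex + Ox)) (Gy * (Ey + Oy)) (Hx * Ex) (Hy * Ey) (gx * Ex + Gx * Ox) (gy * Ey + Gy * Oy)
    gap-step {Gx} {Gy} {Hx} {Hy} {gx} {gy} {Ex} {Ey} {Ox} {Oy} K C = record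
      { sumx = sum sumx
      ; sumy = sum sumy
      ; MG = Mult-resp (sym (trans
          (solve 6 (λ a b E O E′ O′ → (a :* (E :+ O)) :* (b :* (E′ :+ O′)) := (E :* E′ :+ O :* O′ :+ (E :* O′ :+ O :* E′)) :* (a :* b))
             refl Gx Gy Ex Ox Ey Oy)
          (*-congʳ (+-congˡ (trans (+-cong EO OE)
             (solve 4 (λ x y n m → (n :+ y :* m) :+ (n :+ x :* m) := (n :+ n) :+ (x :+ y) :* m) refl x y n n′))))))
          ((MEE ⊞ MOO ⊞ ((Mn ⊞ Mn) ⊞ Cone-V ⊡ Mn′)) ⊡ MG)
      ; HG = λ k → Cone-resp (sym (trans
          (solve 10 (λ Y X H G H′ G′ E O E′ O′ →
              Y :* ((H :* E) :* (G′ :* (E′ :+ O′))) :- X :* ((G :* (E :+ O)) :* (H′ :* E′))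
              := Y :* (H :* G′) :* (E :* E′ :+ E :* O′) :- X :* (G :* H′) :* (E :* E′ :+ O :* E′))
             refl (pow y k) (pow x k) Hx Gx Hy Gy Ex Ox Ey Oy)
          (trans (+-cong (*-congˡ (+-congˡ EO)) (-‿cong (*-congˡ (+-congˡ OE))))
          (solve 9 (λ x y Y X a b E n m →
              Y :* a :* (E :+ (n :+ y :* m)) :- X :* b :* (E :+ (n :+ x :* m))
              := (E :+ n) :* (Y :* a :- X :* b) :+ m :* (y :* Y :* a :- x :* X :* b))
             refl x y (pow y k) (pow x k) (Hx * Gy) (Gx * Hy) (Ex * Ey) n n′))))
          (Cone-+ ((MEE ⊞ Mn) (HG k)) (Mn′ (HG (suc k))))
      ; gG = λ k → Cone-resp (sym (trans
          (solve 10 (λ Y X g G g′ G′ E O E′ O′ →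
              Y :* ((g :* E :+ G :* O) :* (G′ :* (E′ :+ O′))) :- X :* ((G :* (E :+ O)) :* (g′ :* E′ :+ G′ :* O′))
              := (Y :* (g :* G′) :* (E :* E′ :+ E :* O′) :- X :* (G :* g′) :* (E :* E′ :+ O :* E′))
                 :+ (G :* G′) :* (Y :* (O :* E′) :- X :* (E :* O′)) :+ (G :* G′) :* (O :* O′) :* (Y :- X))
             refl (pow y (suc k)) (pow x (suc k)) gx Gx gy Gy Ex Ox Ey Oy)
          (trans (+-congʳ (+-cong (+-cong (*-congˡ (+-congˡ EO)) (-‿cong (*-congˡ (+-congˡ OE))))
                          (*-congˡ (+-cong (*-congˡ OE) (-‿cong (*-congˡ EO))))))
          (solve 11 (λ x y Y X a b E n m P O →
              (y :* Y :* a :* (E :+ (n :+ y :* m)) :- x :* X :* b :* (E :+ (n :+ x :* m)))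
              :+ P :* (y :* Y :* (n :+ x :* m) :- x :* X :* (n :+ y :* m)) :+ P :* O :* (y :* Y :- x :* X)
              := ((E :+ n) :* (y :* Y :* a :- x :* X :* b) :+ m :* (y :* (y :* Y) :* a :- x :* (x :* X) :* b))
                 :+ (P :* (n :* (y :* Y :- x :* X)) :+ P :* (m :* (x :* y :* (Y :- X)))) :+ P :* (O :* (y :* Y :- x :* X)))
             refl x y (pow y k) (pow x k) (gx * Gy) (Gx * gy) (Ex * Ey) n n′ (Gx * Gy) (Ox * Oy)))))
          (Cone-+ (Cone-+ (Cone-+ ((MEE ⊞ Mn) (gG k)) (Mn′ (gG (suc k))))
                          (Cone-+ (MG (Mn (Cone-d (suc k)))) (MG (Mn′ (Cone-e (Cone-d k))))))
                  (MG (MOO (Cone-d (suc k)))))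
      ; Gg = Cone-resp (sym (trans
          (solve 10 (λ y x g G g′ G′ E O E′ O′ →
              y :* ((G :* (E :+ O)) :* (g′ :* E′ :+ G′ :* O′)) :- x :* ((g :* E :+ G :* O) :* (G′ :* (E′ :+ O′)))
              := (y :* (G :* g′) :* (E :* E′ :+ O :* E′) :- x :* (g :* G′) :* (E :* E′ :+ E :* O′))
                 :+ (G :* G′) :* (y :* (E :* O′) :- x :* (O :* E′)) :+ (G :* G′) :* (O :* O′) :* (y :- x))
             refl y x gx Gx gy Gy Ex Ox Ey Oy)
          (trans (+-congʳ (+-cong (+-cong (*-congˡ (+-congˡ OE)) (-‿cong (*-congˡ (+-congˡ EO))))
                          (*-congˡ (+-cong (*-congˡ EO) (-‿cong (*-congˡ OE))))))
          (solve 9 (λ x y a b E n m P O →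
              (y :* b :* (E :+ (n :+ x :* m)) :- x :* a :* (E :+ (n :+ y :* m)))
              :+ P :* (y :* (n :+ y :* m) :- x :* (n :+ x :* m)) :+ P :* O :* (y :- x)
              := ((E :+ n) :* (y :* b :- x :* a) :+ m :* (x :* y :* (b :- a)))
                 :+ (P :* (n :* (y :- x)) :+ P :* (m :* ((x :+ y) :* (y :- x)))) :+ P :* (O :* (y :- x)))
             refl x y (gx * Gy) (Gx * gy) (Ex * Ey) n n′ (Gx * Gy) (Ox * Oy)))))
          (Cone-+ (Cone-+ (Cone-+ ((MEE ⊞ Mn) Gg) (Mn′ (Cone-e Gg₀)))
                          (Cone-+ (MG (Mn Cone-d1)) (MG (Mn′ (Cone-V Cone-d1)))))
                  (MG (MOO Cone-d1)))
      -- The mixed terms g(x) G(y) and G(x) g(y) are out of reach of the old `gg`. They combine into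
      -- `gG` with exponents 1 and 2, `Gg`, and e times `Gg₀`.
      ; gg = Cone-resp (sym (trans
          (solve 10 (λ y x g G g′ G′ E O E′ O′ →
              (y :- x) :* ((g :* E :+ G :* O) :* (g′ :* E′ :+ G′ :* O′))
              := (E :* E′) :* ((y :- x) :* (g :* g′)) :+ (y :- x) :* ((g :* G′) :* (E :* O′) :+ (G :* g′) :* (O :* E′))
                 :+ (G :* G′) :* ((O :* O′) :* (y :- x)))
             refl y x gx Gx gy Gy Ex Ox Ey Oy)
          (trans (+-congʳ (+-congˡ (*-congˡ (+-cong (*-congˡ EO) (*-congˡ OE)))))
          (+-congʳ (+-congˡ (solve 6 (λ x y a b n m →
              (y :- x) :* (a :* (n :+ y :* m) :+ b :* (n :+ x :* m))
              := n :* ((y :* a :- x :* b) :+ (y :* b :- x :* a))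
                 :+ m :* ((y :* y :* a :- x :* x :* b) :+ x :* y :* (b :- a)))
             refl x y (gx * Gy) (Gx * gy) n n′))))))
          (Cone-+ (Cone-+ (MEE gg) (Cone-+ (Mn (Cone-+ gG₁ Gg)) (Mn′ (Cone-+ gG₂ (Cone-e Gg₀))))) (MG (MOO Cone-d1)))
      }
      where
      open GapKernel K
      open GapCones C
      sum : ∀ {G g H E O} → G ≈ g + H → G * (E + O) ≈ g * E + G * O + H * E
      sum {G} {g} {H} {E} {O} p = trans (distribˡ G E O) (trans (+-congʳ (trans (*-congʳ p) (distribʳ E g H)))
        (trans (+-assoc _ _ _) (trans (+-congˡ (+-comm _ _)) (sym (+-assoc _ _ _)))))
      gG₁ : Cone (y * (gx * Gy) - x * (Gx * gy))
      gG₁ = Cone-resp (+-cong (*-congʳ (idʳ y)) (-‿cong (*-congʳ (idʳ x)))) (gG 0)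
      gG₂ : Cone (y * y * (gx * Gy) - x * x * (Gx * gy))
      gG₂ = Cone-resp (+-cong (*-congʳ (*-congˡ (idʳ y))) (-‿cong (*-congʳ (*-congˡ (idʳ x))))) (gG 1)

    gap-base : GapCones one one one one 0# 0#
    gap-base = record
      { sumx = sym (+-identityˡ _) ; sumy = sym (+-identityˡ _)
      ; MG = Mult-resp (sym (trans (idʳ _) one≈1)) Mult-1
      ; HG = λ k → Cone-resp (+-cong (units k) (-‿cong (units k))) (Cone-d k)
      ; gG = λ k → Cone-resp (sym (diff (trans (*-congˡ (zeroˡ _)) (zeroʳ _)) (trans (*-congˡ (zeroʳ _)) (zeroʳ _)))) Cone-0
      ; Gg = Cone-resp (sym (diff (trans (*-congˡ (zeroʳ _)) (zeroʳ _)) (trans (*-congˡ (zeroˡ _)) (zeroʳ _)))) Cone-0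
      ; gg = Cone-resp (sym (trans (*-congˡ (zeroˡ _)) (zeroʳ _))) Cone-0 }
      where
      units : ∀ {z} k → pow z k ≈ pow z k * (one * one)
      units k = sym (trans (*-congˡ (idʳ _)) (idʳ _))
      diff : ∀ {a b} → a ≈ 0# → b ≈ 0# → a - b ≈ 0#
      diff p q = trans (+-cong p (-‿cong q)) (-‿inverseʳ 0#)

-- Families of inequalities closed under attaching a leg.

module GoodTuples where
  open ConeRings
  open LegProducts
  open GapInequalities
  open import Data.Nat.Base using (zero; suc)

  module Weighted (CR : ConeRing) where
    open Gap CR public

    module Weights (c0 c1 c2 : Carrier) (Mc0 : Mult c0) where

      -- With X = F(x)F(y), Y = g(x)F(y) and Y′ = F(x)g(y), the coefficients just above the diagonal are
      -- c0 (Fᵢ² − Fᵢ₋₁Fᵢ₊₁) + c1 (gᵢFᵢ − Fᵢ₋₁gᵢ₊₁) + c2 (gᵢ₊₁Fᵢ₋₁ − Fᵢ₋₂gᵢ₊₂).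
      Φ : Carrier → Carrier → Carrier → Carrier
      Φ X Y Y′ = c0 * (e * (d1 * X)) + c1 * (e * (y * Y - x * Y′)) + c2 * (y * y * y * Y - x * x * x * Y′)

      Φ-cong : ∀ {X X₁ Y Y₁ Y′ Y′₁} → X ≈ X₁ → Y ≈ Y₁ → Y′ ≈ Y′₁ → Φ X Y Y′ ≈ Φ X₁ Y₁ Y′₁
      Φ-cong p q r = +-cong (+-cong (*-congˡ (*-congˡ (*-congˡ p))) (*-congˡ (*-congˡ (+-cong (*-congˡ q) (-‿cong (*-congˡ r))))))
                            (*-congˡ (+-cong (*-congˡ q) (-‿cong (*-congˡ r))))

      Φ-+ : ∀ X X₁ Y Y₁ Y′ Y′₁ → Φ (X + X₁) (Y + Y₁) (Y′ + Y′₁) ≈ Φ X Y Y′ + Φ X₁ Y₁ Y′₁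
      Φ-+ X X₁ Y Y₁ Y′ Y′₁ = solve 11 (λ x y c0 c1 c2 X X₁ Y Y₁ Y′ Y′₁ →
        let F = λ X Y Y′ → c0 :* (x :* y :* ((y :- x) :* X)) :+ c1 :* (x :* y :* (y :* Y :- x :* Y′)) :+ c2 :* (y :* y :* y :* Y :- x :* x :* x :* Y′)
        in F (X :+ X₁) (Y :+ Y₁) (Y′ :+ Y′₁) := F X Y Y′ :+ F X₁ Y₁ Y′₁) refl x y c0 c1 c2 X X₁ Y Y₁ Y′ Y′₁

      Φ-* : ∀ n X Y Y′ → Φ (n * X) (n * Y) (n * Y′) ≈ n * Φ X Y Y′
      Φ-* n X Y Y′ = solve 9 (λ x y c0 c1 c2 n X Y Y′ →
        let F = λ X Y Y′ → c0 :* (x :* y :* ((y :- x) :* X)) :+ c1 :* (x :* y :* (y :* Y :- x :* Y′)) :+ c2 :* (y :* y :* y :* Y :- x :* x :* x :* Y′)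
        in F (n :* X) (n :* Y) (n :* Y′) := n :* F X Y Y′) refl x y c0 c1 c2 n X Y Y′

      -- The wanted inequality is g1 at a = b = 0; the other members are what makes the family closed under attaching
      -- a leg, where X = F(x)F(y), Y = G(x)F(y), H = H(x)F(y), and Y′, H′ have x and y exchanged.
      record Good (X Y Y′ H H′ : Carrier) : Set where
        field
          gx : Mult X
          g0 : ∀ a m → Cone (Φ (pow V a * pow h m * X) (pow x a * pow wx m * Y) (pow y a * pow wy m * Y′))
          g1 : ∀ a b → Cone (Φ (pow V a * pow V b * X) (pow x a * (pow V b * Y - pow y b * H))
                               (pow y a * (pow V b * Y′ - pow x b * H′)))
          fg : ∀ k → Cone (pow y k * Y′ - pow x k * Y)
      open Good

      Good-resp : ∀ {X X₁ Y Y₁ Y′ Y′₁ H H₁ H′ H′₁} → X ≈ X₁ → Y ≈ Y₁ → Y′ ≈ Y′₁ → H ≈ H₁ → H′ ≈ H′₁ →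
                  Good X Y Y′ H H′ → Good X₁ Y₁ Y′₁ H₁ H′₁
      Good-resp p q r s t G = record
        { gx = Mult-resp p (gx G)
        ; g0 = λ a m → Cone-resp (Φ-cong (*-congˡ p) (*-congˡ q) (*-congˡ r)) (g0 G a m)
        ; g1 = λ a b → Cone-resp (Φ-cong (*-congˡ p) (*-congˡ (+-cong (*-congˡ q) (-‿cong (*-congˡ s))))
                                        (*-congˡ (+-cong (*-congˡ r) (-‿cong (*-congˡ t))))) (g1 G a b)
        ; fg = λ k → Cone-resp (+-cong (*-congˡ r) (-‿cong (*-congˡ q))) (fg G k) }

      mix+ : ∀ q b c Y Y₁ H H₁ → q * (b * (Y + Y₁) - c * (H + H₁)) ≈ q * (b * Y - c * H) + q * (b * Y₁ - c * H₁)
      mix+ = solve 7 (λ q b c Y Y₁ H H₁ → q :* (b :* (Y :+ Y₁) :- c :* (H :+ H₁)) := q :* (b :* Y :- c :* H) :+ q :* (b :* Y₁ :- c :* H₁)) refl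

      mix* : ∀ n q b c Y H → q * (b * (n * Y) - c * (n * H)) ≈ n * (q * (b * Y - c * H))
      mix* = solve 6 (λ n q b c Y H → q :* (b :* (n :* Y) :- c :* (n :* H)) := n :* (q :* (b :* Y :- c :* H))) refl

      swap* : ∀ n a b X → a * b * (n * X) ≈ n * (a * b * X)
      swap* = solve 4 (λ n a b X → a :* b :* (n :* X) := n :* (a :* b :* X)) refl

      infixl 6 _⊕_
      _⊕_ : ∀ {X X₁ Y Y₁ Y′ Y′₁ H H₁ H′ H′₁} → Good X Y Y′ H H′ → Good X₁ Y₁ Y′₁ H₁ H′₁ →
            Good (X + X₁) (Y + Y₁) (Y′ + Y′₁) (H + H₁) (H′ + H′₁)
      _⊕_ G K = record
        { gx = gx G ⊞ gx K
        ; g0 = λ a m → Cone-resp (sym (trans (Φ-cong (distribˡ _ _ _) (distribˡ _ _ _) (distribˡ _ _ _)) (Φ-+ _ _ _ _ _ _)))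
                 (Cone-+ (g0 G a m) (g0 K a m))
        ; g1 = λ a b → Cone-resp (sym (trans (Φ-cong (distribˡ _ _ _) (mix+ _ _ _ _ _ _ _) (mix+ _ _ _ _ _ _ _)) (Φ-+ _ _ _ _ _ _)))
                 (Cone-+ (g1 G a b) (g1 K a b))
        ; fg = λ k → Cone-resp (solve 6 (λ a b Y Y₁ Z Z₁ → (a :* Z :- b :* Y) :+ (a :* Z₁ :- b :* Y₁) := a :* (Z :+ Z₁) :- b :* (Y :+ Y₁))
                         refl (pow y k) (pow x k) _ _ _ _) (Cone-+ (fg G k) (fg K k)) }

      infixr 7 _⊙_
      _⊙_ : ∀ {n X Y Y′ H H′} → Mult n → Good X Y Y′ H H′ → Good (n * X) (n * Y) (n * Y′) (n * H) (n * H′)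
      _⊙_ {n} M G = record
        { gx = M ⊡ gx G
        ; g0 = λ a m → Cone-resp (sym (trans (Φ-cong (swap* n _ _ _) (swap* n _ _ _) (swap* n _ _ _)) (Φ-* n _ _ _))) (M (g0 G a m))
        ; g1 = λ a b → Cone-resp (sym (trans (Φ-cong (swap* n _ _ _) (mix* n _ _ _ _ _) (mix* n _ _ _ _ _)) (Φ-* n _ _ _))) (M (g1 G a b))
        ; fg = λ k → Cone-resp (solve 5 (λ n a b Y Z → n :* (a :* Z :- b :* Y) := a :* (n :* Z) :- b :* (n :* Y)) refl n (pow y k) (pow x k) _ _)
                       (M (fg G k)) }

      Mult-V^ : ∀ a → Mult (pow V a)
      Mult-V^ zero    = Mult-one
      Mult-V^ (suc a) = Cone-V ⊡ Mult-V^ a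

      Mult-h : Mult h
      Mult-h = Mult-resp (solve 2 (λ x y → (x :+ y) :* (x :+ y) :+ (x :* y :+ x :* y)
                 := x :* x :+ (x :* y :+ x :* y :+ x :* y :+ x :* y) :+ y :* y) refl x y)
               (Cone-V ⊡ Cone-V ⊞ (Cone-e ⊞ Cone-e))

      Mult-h^ : ∀ m → Mult (pow h m)
      Mult-h^ zero    = Mult-one
      Mult-h^ (suc m) = Mult-h ⊡ Mult-h^ m

      -- This part of a leg contributes to F only. Of `Φ` just the log-concavity term is left, in
      -- the cone because F(x) F(y) is a multiplier. The zeros are written as differences to remain
      -- expressions in the given variables.
      undominated : ∀ {X Y Y′ H H′} → Good X Y Y′ H H′ → Good X (Y - Y) (Y′ - Y′) (H - H) (H′ - H′)
      undominated {X} {Y} {Y′} {H} {H′} G = record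
        { gx = gx G
        ; g0 = λ a m → Cone-resp (solve 12 (λ x y c0 c1 c2 A h Q Q′ X Y Y′ →
                   c0 :* (x :* y :* (A :* h :* X :* (y :- x))) :=
                   c0 :* (x :* y :* ((y :- x) :* (A :* h :* X))) :+ c1 :* (x :* y :* (y :* (Q :* (Y :- Y)) :- x :* (Q′ :* (Y′ :- Y′))))
                   :+ c2 :* (y :* y :* y :* (Q :* (Y :- Y)) :- x :* x :* x :* (Q′ :* (Y′ :- Y′))))
                   refl x y c0 c1 c2 (pow V a) (pow h m) (pow x a * pow wx m) (pow y a * pow wy m) X Y Y′)
                 (Mc0 (Cone-e ((Mult-V^ a ⊡ Mult-h^ m ⊡ gx G) Cone-d1)))
        ; g1 = λ a b → Cone-resp (solve 16 (λ x y c0 c1 c2 A B Q Q′ X Y Y′ H H′ C D →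
                   c0 :* (x :* y :* (A :* B :* X :* (y :- x))) :=
                   c0 :* (x :* y :* ((y :- x) :* (A :* B :* X)))
                   :+ c1 :* (x :* y :* (y :* (Q :* (B :* (Y :- Y) :- C :* (H :- H))) :- x :* (Q′ :* (B :* (Y′ :- Y′) :- D :* (H′ :- H′)))))
                   :+ c2 :* (y :* y :* y :* (Q :* (B :* (Y :- Y) :- C :* (H :- H))) :- x :* x :* x :* (Q′ :* (B :* (Y′ :- Y′) :- D :* (H′ :- H′)))))
                   refl x y c0 c1 c2 (pow V a) (pow V b) (pow x a) (pow y a) X Y Y′ H H′ (pow y b) (pow x b))
                 (Mc0 (Cone-e ((Mult-V^ a ⊡ Mult-V^ b ⊡ gx G) Cone-d1)))
        ; fg = λ k → Cone-resp (sym (trans (solve 4 (λ a b Y Z → a :* (Z :- Z) :- b :* (Y :- Y) := Y :- Y) refl (pow y k) (pow x k) Y Y′) (-‿inverseʳ Y))) Cone-0 }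

      -- Without the subtracted term the second family is the first one times a power of V.
      drop-gap : ∀ {X Y Y′} A Q Q′ H H′ b → Cone (Φ (A * X) (Q * Y) (Q′ * Y′)) →
                 Cone (Φ (A * pow V b * X) (Q * (pow V b * Y - pow y b * (H - H))) (Q′ * (pow V b * Y′ - pow x b * (H′ - H′))))
      drop-gap {X} {Y} {Y′} A Q Q′ H H′ b c = Cone-resp
        (trans (sym (Φ-* _ _ _ _)) (Φ-cong
          (solve 3 (λ a b c → b :* (a :* c) := a :* b :* c) refl _ _ _)
          (solve 5 (λ B Q Y C H → B :* (Q :* Y) := Q :* (B :* Y :- C :* (H :- H))) refl _ _ _ _ H)
          (solve 5 (λ B Q Y C H → B :* (Q :* Y) := Q :* (B :* Y :- C :* (H :- H))) refl _ _ _ _ H′)))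
        (Mult-V^ b c)

      no-gap : ∀ {X Y Y′ H H′} → Good X Y Y′ H H′ → Good X Y Y′ (H - H) (H′ - H′)
      no-gap {X} {Y} {Y′} {H} {H′} G = record
        { gx = gx G ; g0 = g0 G ; fg = fg G
        ; g1 = λ a b → drop-gap _ _ _ H H′ b (Cone-resp (Φ-cong (unit _ _) (unit _ _) (unit _ _)) (g0 G a 0)) }
        where
        unit : ∀ a X → a * one * X ≈ a * X
        unit a X = *-congʳ (idʳ a)

      -- The exponent `a` exists for this operation: the inequalities at a for the new tuple are
      -- those at a + 1 for the old one.
      leafy : ∀ {X Y Y′ H H′} → Good X Y Y′ H H′ → Good (V * X) (x * Y) (y * Y′) (H - H) (H′ - H′)
      leafy {X} {Y} {Y′} {H} {H′} G = record
        { gx = Cone-V ⊡ gx G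
        ; g0 = λ a m → Cone-resp (Φ-cong (mv _ _ _ _) (mv _ _ _ _) (mv _ _ _ _)) (g0 G (suc a) m)
        ; g1 = λ a b → drop-gap _ _ _ H H′ b
                 (Cone-resp (Φ-cong (unit _ _ _) (unit _ _ _) (unit _ _ _)) (g0 G (suc a) 0))
        ; fg = λ k → Cone-resp (+-cong (sw _ _ _) (-‿cong (sw _ _ _))) (fg G (suc k)) }
        where
        mv : ∀ z a m X → z * a * m * X ≈ a * m * (z * X)
        mv = solve 4 (λ z a m X → z :* a :* m :* X := a :* m :* (z :* X)) refl
        sw : ∀ z a X → z * a * X ≈ a * (z * X)
        sw = solve 3 (λ z a X → z :* a :* X := a :* (z :* X)) refl
        unit : ∀ z a X → z * a * one * X ≈ a * (z * X)
        unit z a X = trans (*-congʳ (idʳ _)) (sw z a X)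

      leafy-gap : ∀ {X Y Y′ H H′} → Good X Y Y′ H H′ → Good (V * X) (x * Y) (y * Y′) (x * H) (y * H′)
      leafy-gap {X} {Y} {Y′} {H} {H′} G = record
        { gx = gx (leafy G) ; g0 = g0 (leafy G) ; fg = fg (leafy G)
        ; g1 = λ a b → Cone-resp (Φ-cong
                 (solve 4 (λ z a m X → z :* a :* m :* X := a :* m :* (z :* X)) refl V (pow V a) (pow V b) X)
                 (mv x (pow x a) (pow V b) Y (pow y b) H) (mv y (pow y a) (pow V b) Y′ (pow x b) H′)) (g1 G (suc a) b) }
        where
        mv : ∀ z a b Y c H → z * a * (b * Y - c * H) ≈ a * (b * (z * Y) - c * (z * H))
        mv = solve 6 (λ z a b Y c H → z :* a :* (b :* Y :- c :* H) := a :* (b :* (z :* Y) :- c :* (z :* H))) refl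

      -- Raises `b`: with G multiplied by x + y and H by y, V^b Y - y^b H becomes V^(b+1) Y -
      -- y^(b+1) H. Where H is absent, multiplying the whole tuple by V suffices.
      gap-shift : ∀ {X Y Y′ H H′} → Good X Y Y′ H H′ → Good (V * X) (V * Y) (V * Y′) (y * H) (x * H′)
      gap-shift {X} {Y} {Y′} {H} {H′} G = record
        { gx = Cone-V ⊡ gx G
        ; g0 = g0 VG ; fg = fg VG
        ; g1 = λ a b → Cone-resp (Φ-cong
                 (solve 4 (λ z a m X → a :* (z :* m) :* X := a :* m :* (z :* X)) refl V (pow V a) (pow V b) X)
                 (mv V y (pow x a) (pow V b) Y (pow y b) H) (mv V x (pow y a) (pow V b) Y′ (pow x b) H′)) (g1 G a (suc b)) }
        where
        VG : Good (V * X) (V * Y) (V * Y′) (V * H) (V * H′)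
        VG = Cone-V ⊙ G
        mv : ∀ v z a b Y c H → a * (v * b * Y - z * c * H) ≈ a * (b * (v * Y) - c * (z * H))
        mv = solve 7 (λ v z a b Y c H → a :* (v :* b :* Y :- z :* c :* H) := a :* (b :* (v :* Y) :- c :* (z :* H))) refl

      -- Raises `m`. For `fg` the exponents k + 2 and k are combined, as wy = y² + 4 e and wx = x² +
      -- 4 e.
      wide : ∀ {X Y Y′ H H′} → Good X Y Y′ H H′ → Good (h * X) (wx * Y) (wy * Y′) (H - H) (H′ - H′)
      wide {X} {Y} {Y′} {H} {H′} G = record
        { gx = Mult-h ⊡ gx G
        ; g0 = λ a m → Cone-resp (Φ-cong (mv _ _ _ _) (mv _ _ _ _) (mv _ _ _ _)) (g0 G a (suc m))
        ; g1 = λ a b → drop-gap _ _ _ H H′ b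
                 (Cone-resp (Φ-cong (unit _ _ _) (unit _ _ _) (unit _ _ _)) (g0 G a 1))
        ; fg = λ k → Cone-resp (solve 6 (λ x y a b Y Y′ →
                   (y :* (y :* a) :* Y′ :- x :* (x :* b) :* Y)
                   :+ (x :* y :+ x :* y :+ x :* y :+ x :* y) :* (a :* Y′ :- b :* Y)
                   := a :* ((y :* y :+ (x :* y :+ x :* y :+ x :* y :+ x :* y)) :* Y′)
                      :- b :* ((x :* x :+ (x :* y :+ x :* y :+ x :* y :+ x :* y)) :* Y)) refl x y (pow y k) (pow x k) Y Y′)
                 (Cone-+ (fg G (suc (suc k))) ((Cone-e ⊞ Cone-e ⊞ Cone-e ⊞ Cone-e) (fg G k))) }
        where
        mv : ∀ z a m X → a * (z * m) * X ≈ a * m * (z * X)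
        mv = solve 4 (λ z a m X → a :* (z :* m) :* X := a :* m :* (z :* X)) refl
        unit : ∀ z a X → a * (z * one) * X ≈ a * (z * X)
        unit z a X = trans (*-congʳ (*-congˡ (idʳ z))) (*-assoc a z X)

      good-step : ∀ {X Y Y′ H H′ Ax Ay Dx Dy Ex Ey} → LegKernel Ax Ay Dx Dy Ex Ey → Good X Y Y′ H H′ →
                  Good (Ax * Ay * X) (Dx * Ay * Y) (Ax * Dy * Y′) (Ex * Ay * H) (Ax * Ey * H′)
      good-step {X} {Y} {Y′} {H} {H′} K G = Good-resp
        (trans (solve 11 (λ V h X a b c d p q r s → (a :* X :+ b :* X :+ c :* X) :+ (d :* (V :* X) :+ p :* (V :* X) :+ q :* (V :* X) :+ r :* (V :* (V :* X)) :+ s :* (h :* X))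
           := ((a :+ b :+ c) :+ (V :* d :+ V :* p :+ V :* q :+ V :* V :* r :+ h :* s)) :* X) refl V h X kE kG kG′ kT kT′ kS kSS kW) (*-congʳ (sym AA)))
        (trans (dom V x wx Y) (*-congʳ (sym DA)))
        (trans (dom V y wy Y′) (*-congʳ (sym AD)))
        (trans (gap x y H) (*-congʳ (sym EA)))
        (trans (gap y x H′) (*-congʳ (sym AE)))
        (((ME ⊙ undominated G) ⊕ (MG ⊙ G) ⊕ (MG′ ⊙ no-gap G))
          ⊕ ((MT ⊙ leafy G) ⊕ (MT′ ⊙ leafy-gap G) ⊕ (MS ⊙ gap-shift G) ⊕ (MSS ⊙ gap-shift (gap-shift G)) ⊕ (MW ⊙ wide G)))
        where
        open LegKernel K
        dom : ∀ V x w Y → (kE * (Y - Y) + kG * Y + kG′ * Y) + (kT * (x * Y) + kT′ * (x * Y) + kS * (V * Y) + kSS * (V * (V * Y)) + kW * (w * Y))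
              ≈ ((kG + kG′) + (x * kT + x * kT′ + V * kS + V * V * kSS + w * kW)) * Y
        dom V x w Y = solve 12 (λ V x w Y a b c d p q r s → (a :* (Y :- Y) :+ b :* Y :+ c :* Y)
            :+ (d :* (x :* Y) :+ p :* (x :* Y) :+ q :* (V :* Y) :+ r :* (V :* (V :* Y)) :+ s :* (w :* Y))
            := ((b :+ c) :+ (x :* d :+ x :* p :+ V :* q :+ V :* V :* r :+ w :* s)) :* Y) refl V x w Y kE kG kG′ kT kT′ kS kSS kW
        gap : ∀ x y H → (kE * (H - H) + kG * H + kG′ * (H - H)) + (kT * (H - H) + kT′ * (x * H) + kS * (y * H) + kSS * (y * (y * H)) + kW * (H - H))
              ≈ (kG + (x * kT′ + y * kS + y * y * kSS)) * H
        gap x y H = solve 11 (λ x y H a b c d p q r s → (a :* (H :- H) :+ b :* H :+ c :* (H :- H))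
            :+ (d :* (H :- H) :+ p :* (x :* H) :+ q :* (y :* H) :+ r :* (y :* (y :* H)) :+ s :* (H :- H))
            := (b :+ (x :* p :+ y :* q :+ y :* y :* r)) :* H) refl x y H kE kG kG′ kT kT′ kS kSS kW

-- Recurrences and lower bounds for the spider without legs.

module ChargeBounds where
  open ConeRings
  open LegProducts
  open GapInequalities
  open GoodTuples
  open IntegerSolver
  open import Data.Nat.Base as ℕ using (ℕ; zero; suc)
  open import Data.Integer.Base as ℤ using (ℤ; +_)
  open import Algebra.Solver.Ring.AlmostCommutativeRing using (_-Raw-AlmostCommutative⟶_)
  open import Relation.Binary.PropositionalEquality as ≡ using (_≡_)
  import Data.Nat.Properties as ℕₚ
  open import Data.Product.Base using (_×_; _,_)

  record ℤ³ : Set where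
    constructor ⟨_,_,_⟩
    field
      fst snd thd : ℤ

  infixl 6 _+³_
  _+³_ : ℤ³ → ℤ³ → ℤ³
  ⟨ a , b , c ⟩ +³ ⟨ a′ , b′ , c′ ⟩ = ⟨ a ℤ.+ a′ , b ℤ.+ b′ , c ℤ.+ c′ ⟩

  four³ : ℤ³ → ℤ³
  four³ ⟨ a , b , c ⟩ = ⟨ + 4 ℤ.* a , + 4 ℤ.* b , + 4 ℤ.* c ⟩

  -- Multiplication by h in the basis e² f1, e f3, f5 of `Track`, with one factor e taken out and
  -- the overflow into f7 dropped.
  heat : ℤ → ℤ³ → ℤ³
  heat κ ⟨ a , b , c ⟩ = ⟨ κ ℤ.* a ℤ.+ b , a ℤ.+ + 4 ℤ.* b ℤ.+ c , b ℤ.+ + 4 ℤ.* c ⟩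

  NonNeg³ : ℤ³ → Set
  NonNeg³ ⟨ a , b , c ⟩ = + 0 ℤ.≤ a × + 0 ℤ.≤ b × + 0 ℤ.≤ c

  0³ : ℤ³
  0³ = ⟨ + 0 , + 0 , + 0 ⟩

  -- Coordinates of lower bounds for R′ and U below, in the basis of Track.
  source : (ℕ → ℤ³) → ℕ → ℕ → ℤ³
  source t j zero    = t j
  source t j (suc m) = four³ (source t j m) +³ source t (suc j) m

  charge : ℤ → (ℕ → ℤ³) → ℤ³ → ℕ → ℕ → ℤ³
  charge κ t u j zero    = u
  charge κ t u j (suc m) = heat κ (charge κ t u j m) +³ source t j m

  double : ℕ → ℕ
  double zero    = zero
  double (suc j) = suc (suc (double j))

  module Base (CR : ConeRing) (w0 w1 w2 : ℕ) where
    open Weighted CR public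
    open _-Raw-AlmostCommutative⟶_ ι using (⟦_⟧; +-homo; *-homo; -‿homo)

    Mult-ι : ∀ n → Mult ⟦ + n ⟧
    Mult-ι zero    = Mult-resp (sym (_-Raw-AlmostCommutative⟶_.0-homo ι)) Mult-0
    Mult-ι (suc n) = Mult-resp (sym (+-homo (+ 1) (+ n))) (Mult-resp (sym one≈1) Mult-1 ⊞ Mult-ι n)

    Mult-ι⁺ : ∀ {z} → + 0 ℤ.≤ z → Mult ⟦ z ⟧
    Mult-ι⁺ {+ n} _ = Mult-ι n

    c0 c1 c2 : Carrier
    c0 = ⟦ + w0 ⟧
    c1 = ⟦ + w1 ⟧
    c2 = ⟦ + w2 ⟧

    Mc0 : Mult c0
    Mc0 = Mult-ι w0
    Mc1 : Mult c1
    Mc1 = Mult-ι w1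
    Mc2 : Mult c2
    Mc2 = Mult-ι w2

    open Weights c0 c1 c2 Mc0 public

    D : ℕ → ℕ → Carrier
    D c m = pow y c * pow wy m - pow x c * pow wx m

    four-e : Carrier
    four-e = e + e + e + e

    M4e : Mult four-e
    M4e = Cone-e ⊞ Cone-e ⊞ Cone-e ⊞ Cone-e

    Cone-D : ∀ m c → Cone (D c m)
    Cone-D zero    c = Cone-resp (sym (+-cong (idʳ _) (-‿cong (idʳ _)))) (Cone-d c)
    Cone-D (suc m) c = Cone-resp (solve 6 (λ x y a b p q → (y :* (y :* a) :* p :- x :* (x :* b) :* q)
          :+ (x :* y :+ x :* y :+ x :* y :+ x :* y) :* (a :* p :- b :* q)
          := a :* ((y :* y :+ (x :* y :+ x :* y :+ x :* y :+ x :* y)) :* p) :- b :* ((x :* x :+ (x :* y :+ x :* y :+ x :* y :+ x :* y)) :* q))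
        refl x y (pow y c) (pow x c) (pow wy m) (pow wx m))
      (Cone-+ (Cone-D m (suc (suc c))) (M4e (Cone-D m c)))

    -- R′ is the error term of the recurrence U a (suc m) = h U a m + R′ a m; membership in the cone is automatic only for a ≥ 5.
    U R′ : ℕ → ℕ → Carrier
    U a m = Φ (pow V a * pow h m) (pow x a * pow wx m) (pow y a * pow wy m)
    R′ a m = - (c1 * (e * (y * y * y * (pow x a * pow wx m) - x * x * x * (pow y a * pow wy m))))
             - c2 * (y * y * y * y * y * (pow x a * pow wx m) - x * x * x * x * x * (pow y a * pow wy m))

    -- One factor wx is written as h - y² and one factor wy as h - x²; the squares collect in `R′`.
    U-step : ∀ a m → U a (suc m) ≈ h * U a m + R′ a m
    U-step a m = solve 11 (λ x y c0 c1 c2 v w p q r s →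
      let e = x :* y ; f = e :+ e :+ e :+ e ; h = x :* x :+ f :+ y :* y ; wx = x :* x :+ f ; wy = y :* y :+ f
          F = λ X Y Y′ → c0 :* (e :* ((y :- x) :* X)) :+ c1 :* (e :* (y :* Y :- x :* Y′)) :+ c2 :* (y :* y :* y :* Y :- x :* x :* x :* Y′)
      in F (v :* (h :* w)) (p :* (wx :* q)) (r :* (wy :* s)) := h :* F (v :* w) (p :* q) (r :* s)
         :+ ((:- (c1 :* (e :* (y :* y :* y :* (p :* q) :- x :* x :* x :* (r :* s)))))
             :- c2 :* (y :* y :* y :* y :* y :* (p :* q) :- x :* x :* x :* x :* x :* (r :* s))))
      refl x y c0 c1 c2 (pow V a) (pow h m) (pow x a) (pow wx m) (pow y a) (pow wy m)

    -- Now wx = x² + 4 e and wy = y² + 4 e are used. The exponent a changes by two, so even and odd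
    -- a can be treated separately.
    R-step : ∀ a m → R′ a (suc m) ≈ four-e * R′ a m + R′ (suc (suc a)) m
    R-step a m = solve 8 (λ x y c1 c2 p q r s →
      let e = x :* y ; f = e :+ e :+ e :+ e ; wx = x :* x :+ f ; wy = y :* y :+ f
          F = λ p q r s → (:- (c1 :* (e :* (y :* y :* y :* (p :* q) :- x :* x :* x :* (r :* s)))))
             :- c2 :* (y :* y :* y :* y :* y :* (p :* q) :- x :* x :* x :* x :* x :* (r :* s))
      in F p (wx :* q) r (wy :* s) := f :* F p q r s :+ F (x :* (x :* p)) q (y :* (y :* r)) s)
      refl x y c1 c2 (pow x a) (pow wx m) (pow y a) (pow wy m)

    -- With five factors of each variable to spare, every subtracted difference reverses its order
    -- and becomes a power of e times some `D` with a positive sign.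
    Cone-R : ∀ k m → Cone (R′ (5 ℕ.+ k) m)
    Cone-R k m = Cone-resp (solve 8 (λ x y c1 c2 p q r s →
      let e = x :* y ; x2 = x :* (x :* p) ; y2 = y :* (y :* r) ; x5 = x :* (x :* (x :* x2)) ; y5 = y :* (y :* (y :* y2)) in
        c1 :* (e :* (e :* (e :* (e :* (y2 :* s :- x2 :* q))))) :+ c2 :* (e :* (e :* (e :* (e :* (e :* (r :* s :- p :* q))))))
        := (:- (c1 :* (e :* (y :* y :* y :* (x5 :* q) :- x :* x :* x :* (y5 :* s)))))
             :- c2 :* (y :* y :* y :* y :* y :* (x5 :* q) :- x :* x :* x :* x :* x :* (y5 :* s)))
      refl x y c1 c2 (pow x k) (pow wx m) (pow y k) (pow wy m))
      (Cone-+ (Mc1 (Cone-e (Cone-e (Cone-e (Cone-e (Cone-D m (suc (suc k)))))))) (Mc2 (Cone-e (Cone-e (Cone-e (Cone-e (Cone-e (Cone-D m k))))))))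

    infix 4 _≽_
    _≽_ : Carrier → Carrier → Set
    f ≽ g = Cone (f - g)

    ≽-Cone : ∀ {f g} → f ≽ g → Cone g → Cone f
    ≽-Cone {f} {g} p q = Cone-resp (solve 2 (λ f g → (f :- g) :+ g := f) refl f g) (Cone-+ p q)

    -- f₁, f₃, f₅, f₇ are consecutive terms yᵏ − xᵏ of equal parity, on which h acts as a tridiagonal matrix.
    module Track (κ : ℕ) (par : ℕ) (f1 f3 f5 f7 : Carrier)
                 (Cf1 : Cone f1) (Cf3 : Cone f3) (Cf5 : Cone f5) (Cf7 : Cone f7)
                 (hf1 : h * f1 ≈ f3 + ⟦ + κ ⟧ * (e * f1))
                 (hf3 : h * f3 ≈ f5 + ⟦ + 4 ⟧ * (e * f3) + e * e * f1)
                 (hf5 : h * f5 ≈ f7 + ⟦ + 4 ⟧ * (e * f5) + e * e * f3)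
                 (t : ℕ → ℤ³) where

      vec : ℕ → Carrier → Carrier → Carrier → Carrier
      vec n a b c = pow e n * (a * (e * e * f1) + b * (e * f3) + c * f5)

      v : ℕ → ℤ³ → Carrier
      v n ⟨ a , b , c ⟩ = vec n ⟦ a ⟧ ⟦ b ⟧ ⟦ c ⟧

      vec-cong : ∀ n {a a′ b b′ c c′} → a ≈ a′ → b ≈ b′ → c ≈ c′ → vec n a b c ≈ vec n a′ b′ c′
      vec-cong n p q r = *-congˡ (+-cong (+-cong (*-congʳ p) (*-congʳ q)) (*-congʳ r))

      Mult-e^ : ∀ n → Mult (pow e n)
      Mult-e^ zero    = Mult-resp (sym one≈1) Mult-1
      Mult-e^ (suc n) = Cone-e ⊡ Mult-e^ n

      Cone-v : ∀ n {z} → NonNeg³ z → Cone (v n z)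
      Cone-v n (p , q , r) = Mult-e^ n (Cone-+ (Cone-+ (Mult-ι⁺ p (Cone-resp (sym (*-assoc _ _ _)) (Cone-e (Cone-e Cf1))))
        (Mult-ι⁺ q (Cone-e Cf3))) (Mult-ι⁺ r Cf5))

      v-+ : ∀ n z z′ → v n (z +³ z′) ≈ v n z + v n z′
      v-+ n ⟨ a , b , c ⟩ ⟨ a′ , b′ , c′ ⟩ = trans (vec-cong n (+-homo a a′) (+-homo b b′) (+-homo c c′))
        (solve 11 (λ E e a b c a′ b′ c′ f g k → E :* ((a :+ a′) :* (e :* e :* f) :+ (b :+ b′) :* (e :* g) :+ (c :+ c′) :* k)
          := E :* (a :* (e :* e :* f) :+ b :* (e :* g) :+ c :* k) :+ E :* (a′ :* (e :* e :* f) :+ b′ :* (e :* g) :+ c′ :* k))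
          refl (pow e n) e ⟦ a ⟧ ⟦ b ⟧ ⟦ c ⟧ ⟦ a′ ⟧ ⟦ b′ ⟧ ⟦ c′ ⟧ f1 f3 f5)

      v-four : ∀ n z → v (suc n) (four³ z) ≈ four-e * v n z
      v-four n ⟨ a , b , c ⟩ = trans (vec-cong (suc n) (*-homo (+ 4) a) (*-homo (+ 4) b) (*-homo (+ 4) c))
        (solve 8 (λ E e a b c f g k → e :* E :* (con (+ 4) :* a :* (e :* e :* f) :+ con (+ 4) :* b :* (e :* g) :+ con (+ 4) :* c :* k)
          := (e :+ e :+ e :+ e) :* (E :* (a :* (e :* e :* f) :+ b :* (e :* g) :+ c :* k)))
          refl (pow e n) e ⟦ a ⟧ ⟦ b ⟧ ⟦ c ⟧ f1 f3 f5)

      v-suc : ∀ n z → v (suc n) z ≈ e * v n z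
      v-suc n z = *-assoc _ _ _

      -- The only loss is the term with f7, which has a non-negative coefficient because the third
      -- coordinate is non-negative.
      h-v : ∀ n z → NonNeg³ z → h * v n z ≽ v (suc n) (heat (+ κ) z)
      h-v n ⟨ a , b , c ⟩ (_ , _ , r) = Cone-resp
        (trans (solve 11 (λ E e h a b c f g k l κ →
            E :* (c :* l) :=
            E :* (a :* (e :* e :* (g :+ κ :* (e :* f))) :+ b :* (e :* (k :+ con (+ 4) :* (e :* g) :+ e :* e :* f))
                  :+ c :* (l :+ con (+ 4) :* (e :* k) :+ e :* e :* g))
            :- e :* E :* ((κ :* a :+ b) :* (e :* e :* f) :+ (a :+ con (+ 4) :* b :+ c) :* (e :* g) :+ (b :+ con (+ 4) :* c) :* k))
            refl (pow e n) e h ⟦ a ⟧ ⟦ b ⟧ ⟦ c ⟧ f1 f3 f5 f7 ⟦ + κ ⟧)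
          (+-cong
            (trans (*-congˡ (+-cong (+-cong (*-congˡ (*-congˡ (sym hf1))) (*-congˡ (*-congˡ (sym hf3)))) (*-congˡ (sym hf5))))
              (solve 9 (λ E e h a b c f g k → E :* (a :* (e :* e :* (h :* f)) :+ b :* (e :* (h :* g)) :+ c :* (h :* k))
                 := h :* (E :* (a :* (e :* e :* f) :+ b :* (e :* g) :+ c :* k))) refl (pow e n) e h ⟦ a ⟧ ⟦ b ⟧ ⟦ c ⟧ f1 f3 f5))
            (-‿cong (sym (vec-cong (suc n)
              (trans (+-homo _ b) (+-congʳ (*-homo (+ κ) a)))
              (trans (+-homo _ c) (+-congʳ (trans (+-homo a _) (+-congˡ (*-homo (+ 4) b)))))
              (trans (+-homo b _) (+-congˡ (*-homo (+ 4) c))))))))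
        (Mult-e^ n (Mult-ι⁺ r Cf7))

      module Sources (initial : ∀ j → R′ (par ℕ.+ double j) 0 ≽ v j (t j)) where

        R-bound : ∀ m j → R′ (par ℕ.+ double j) m ≽ v (m ℕ.+ j) (source t j m)
        R-bound zero    j = initial j
        R-bound (suc m) j = Cone-resp
          (trans (solve 5 (λ f r s v w → f :* (r :- v) :+ (s :- w) := (f :* r :+ s) :- (f :* v :+ w)) refl four-e (R′ (par ℕ.+ double j) m) (R′ (par ℕ.+ double (suc j)) m) (v (m ℕ.+ j) (source t j m)) (v (m ℕ.+ suc j) (source t (suc j) m)))
            (+-cong (sym (trans (R-step (par ℕ.+ double j) m) (+-congˡ (reflexive (≡.cong (λ a → R′ a m) shift)))))
                    (-‿cong (sym (trans (v-+ (suc (m ℕ.+ j)) (four³ (source t j m)) (source t (suc j) m)) (+-cong (v-four (m ℕ.+ j) (source t j m))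
                       (reflexive (≡.cong (λ k → v k (source t (suc j) m)) (≡.sym (ℕₚ.+-suc m j))))))))))
          (Cone-+ (M4e (R-bound m j)) (R-bound m (suc j)))
          where
          shift : suc (suc (par ℕ.+ double j)) ≡ par ℕ.+ double (suc j)
          shift = ≡.sym (≡.trans (ℕₚ.+-suc par (suc (double j))) (≡.cong suc (ℕₚ.+-suc par (double j))))

        -- The relation k + j = i + 1 balances degrees: e^k U has degree 2k + 3 + par + 2j at m = 0,
        -- and the basis at level i has degree 2i + 5 + par. For a ≤ 1 the basis starts above the
        -- degree of U, so k = 1 is chosen and the factor e cancelled afterwards.
        U-bound : ∀ k i j u → k ℕ.+ j ≡ suc i → (∀ m → NonNeg³ (charge (+ κ) t u j m)) →
                  pow e k * U (par ℕ.+ double j) 0 ≽ v i u →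
                  ∀ m → pow e k * U (par ℕ.+ double j) m ≽ v (m ℕ.+ i) (charge (+ κ) t u j m)
        U-bound k i j u eq nn start zero    = start
        U-bound k i j u eq nn start (suc m) = Cone-resp
          (trans (solve 7 (λ h E U R v w r → (h :* (E :* U :- v) :+ (h :* v :- w)) :+ E :* (R :- r) := (E :* (h :* U :+ R)) :- (w :+ E :* r)) refl h (pow e k) (U (par ℕ.+ double j) m) (R′ (par ℕ.+ double j) m) (v (m ℕ.+ i) (charge (+ κ) t u j m)) (v (suc (m ℕ.+ i)) (heat (+ κ) (charge (+ κ) t u j m))) (v (m ℕ.+ j) (source t j m)))
            (+-cong (*-congˡ (sym (U-step (par ℕ.+ double j) m)))
                    (-‿cong (sym (trans (v-+ (suc (m ℕ.+ i)) (heat (+ κ) (charge (+ κ) t u j m)) (source t j m)) (+-congˡ (trans (reflexive (≡.cong (λ n → v n (source t j m)) exponent)) (v-pow k (m ℕ.+ j) (source t j m)))))))))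
          (Cone-+ (Cone-+ (Mult-h (U-bound k i j u eq nn start m)) (h-v (m ℕ.+ i) (charge (+ κ) t u j m) (nn m)))
                  (Mult-e^ k (R-bound m j)))
          where
          v-pow : ∀ k n z → v (k ℕ.+ n) z ≈ pow e k * v n z
          v-pow zero    n z = sym (idˡ _)
          v-pow (suc k) n z = trans (v-suc (k ℕ.+ n) z) (trans (*-congˡ (v-pow k n z)) (sym (*-assoc _ _ _)))
          exponent : suc m ℕ.+ i ≡ k ℕ.+ (m ℕ.+ j)
          exponent = ≡.trans (≡.sym (ℕₚ.+-suc m i)) (≡.trans (≡.cong (m ℕ.+_) (≡.sym eq))
            (≡.trans (≡.sym (ℕₚ.+-assoc m k j)) (≡.trans (≡.cong (ℕ._+ j) (ℕₚ.+-comm m k)) (ℕₚ.+-assoc k m j))))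

-- Integer tables for the two systems of weights.

module Charges where
  open ConeRings
  open LegProducts
  open GapInequalities
  open GoodTuples
  open ChargeBounds
  open IntegerSolver
  open import Data.Nat.Base as ℕ using (ℕ; zero; suc)
  open import Data.Integer.Base as ℤ using (ℤ; +_; -[1+_]; +≤+)
  open import Relation.Binary.PropositionalEquality as ≡ using (_≡_)
  import Data.Nat.Properties as ℕₚ
  import Data.Integer.Properties as ℤₚ
  open import Data.Product.Base using (_×_; _,_)
  open import Data.List.Base using (List; []; _∷_; map)
  open import Data.List.Relation.Unary.All using (All; []; _∷_; all?)
  open import Relation.Nullary.Decidable using (Dec; _×-dec_; toWitness)

  Rows : Set
  Rows = ℤ³ × ℤ³ × ℤ³

  pattern -1ℤ = -[1+ 0 ]

  -- Row j: the coordinates of R′ (2j) 0 and R′ (2j + 1) 0 as linear forms in the weights (w0 , w1 , w2).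
  evenRows oddRows : List Rows
  evenRows = (0³ , ⟨ + 0 , -1ℤ , + 0 ⟩ , ⟨ + 0 , + 0 , -1ℤ ⟩)
           ∷ (⟨ + 0 , -1ℤ , + 0 ⟩ , ⟨ + 0 , + 0 , -1ℤ ⟩ , 0³)
           ∷ (⟨ + 0 , + 1 , -1ℤ ⟩ , 0³ , 0³)
           ∷ (⟨ + 0 , + 0 , + 1 ⟩ , ⟨ + 0 , + 1 , + 0 ⟩ , 0³)
           ∷ (0³ , ⟨ + 0 , + 0 , + 1 ⟩ , ⟨ + 0 , + 1 , + 0 ⟩)
           ∷ (0³ , 0³ , ⟨ + 0 , + 0 , + 1 ⟩) ∷ []
  oddRows  = (⟨ + 0 , -1ℤ , + 0 ⟩ , ⟨ + 0 , + 0 , -1ℤ ⟩ , 0³)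
           ∷ (⟨ + 0 , + 0 , -1ℤ ⟩ , 0³ , 0³)
           ∷ (⟨ + 0 , + 1 , + 0 ⟩ , 0³ , 0³)
           ∷ (⟨ + 0 , + 0 , + 1 ⟩ , ⟨ + 0 , + 1 , + 0 ⟩ , 0³)
           ∷ (0³ , ⟨ + 0 , + 0 , + 1 ⟩ , ⟨ + 0 , + 1 , + 0 ⟩)
           ∷ (0³ , 0³ , ⟨ + 0 , + 0 , + 1 ⟩) ∷ []

  -- startₐ: the coordinates of U a 0, multiplied by e for a ≤ 1.
  start₀ start₁ start₂ start₃ start₄ : Rows
  start₀ = ⟨ + 1 , + 1 , + 0 ⟩ , ⟨ + 0 , + 0 , + 1 ⟩ , 0³
  start₁ = ⟨ + 1 , + 0 , + 1 ⟩ , 0³ , 0³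
  start₂ = ⟨ + 1 , -1ℤ , + 1 ⟩ , ⟨ + 1 , + 0 , + 0 ⟩ , 0³
  start₃ = ⟨ + 2 , -1ℤ , + 0 ⟩ , ⟨ + 1 , + 0 , + 0 ⟩ , 0³
  start₄ = ⟨ + 2 , + 0 , -1ℤ ⟩ , ⟨ + 3 , -1ℤ , + 0 ⟩ , ⟨ + 1 , + 0 , + 0 ⟩

  module Tables (w0 w1 w2 : ℕ) where
    lin : ℤ³ → ℤ
    lin ⟨ p , q , r ⟩ = p ℤ.* + w0 ℤ.+ q ℤ.* + w1 ℤ.+ r ℤ.* + w2

    lin³ : Rows → ℤ³
    lin³ (r , s , t) = ⟨ lin r , lin s , lin t ⟩

    even odd : List ℤ³
    even = map lin³ evenRows
    odd  = map lin³ oddRows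

  row : List Rows → ℕ → Rows
  row []       j       = 0³ , 0³ , 0³
  row (r ∷ rs) zero    = r
  row (r ∷ rs) (suc j) = row rs j

  at : List ℤ³ → ℕ → ℤ³
  at []       j       = 0³
  at (z ∷ zs) zero    = z
  at (z ∷ zs) (suc j) = at zs j

  -- The two inequalities between the weights serve the lower bound of U a 0 for a ≥ 2; the charges
  -- serve the exponents a ≤ 4, where the error term may leave the cone.
  record Admissible (w0 w1 w2 : ℕ) : Set where
    open Tables w0 w1 w2
    field
      w1≤w0    : w1 ℕ.≤ w0
      w1+w2≤2w0 : w1 ℕ.+ w2 ℕ.≤ w0 ℕ.+ w0
      charge₀ : ∀ m → NonNeg³ (charge (+ 3) (at even) (lin³ start₀) 0 m)
      charge₁ : ∀ m → NonNeg³ (charge (+ 4) (at odd) (lin³ start₁) 0 m)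
      charge₂ : ∀ m → NonNeg³ (charge (+ 3) (at even) (lin³ start₂) 1 m)
      charge₃ : ∀ m → NonNeg³ (charge (+ 4) (at odd) (lin³ start₃) 1 m)
      charge₄ : ∀ m → NonNeg³ (charge (+ 3) (at even) (lin³ start₄) 2 m)

  nonNeg³? : ∀ z → Dec (NonNeg³ z)
  nonNeg³? ⟨ a , b , c ⟩ = (+ 0 ℤₚ.≤? a) ×-dec (+ 0 ℤₚ.≤? b) ×-dec (+ 0 ℤₚ.≤? c)

  nonNeg-* : ∀ {a} n → + 0 ℤ.≤ a → + 0 ℤ.≤ + n ℤ.* a
  nonNeg-* {+ k} n (+≤+ _) = ≡.subst (+ 0 ℤ.≤_) (ℤₚ.pos-* n k) (+≤+ ℕ.z≤n)

  nonNeg-+³ : ∀ z z′ → NonNeg³ z → NonNeg³ z′ → NonNeg³ (z +³ z′)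
  nonNeg-+³ ⟨ _ , _ , _ ⟩ ⟨ _ , _ , _ ⟩ (p , q , r) (p′ , q′ , r′) = ℤₚ.+-mono-≤ p p′ , ℤₚ.+-mono-≤ q q′ , ℤₚ.+-mono-≤ r r′

  nonNeg-four : ∀ z → NonNeg³ z → NonNeg³ (four³ z)
  nonNeg-four ⟨ _ , _ , _ ⟩ (p , q , r) = nonNeg-* 4 p , nonNeg-* 4 q , nonNeg-* 4 r

  nonNeg-heat : ∀ κ z → NonNeg³ z → NonNeg³ (heat (+ κ) z)
  nonNeg-heat κ ⟨ _ , _ , _ ⟩ (p , q , r) =
    ℤₚ.+-mono-≤ (nonNeg-* κ p) q , ℤₚ.+-mono-≤ (ℤₚ.+-mono-≤ p (nonNeg-* 4 q)) r , ℤₚ.+-mono-≤ q (nonNeg-* 4 r)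

  nonNeg-0 : NonNeg³ 0³
  nonNeg-0 = +≤+ ℕ.z≤n , +≤+ ℕ.z≤n , +≤+ ℕ.z≤n

  nonNeg-at : ∀ {zs} → All NonNeg³ zs → ∀ j → NonNeg³ (at zs j)
  nonNeg-at []       j       = nonNeg-0
  nonNeg-at (p ∷ ps) zero    = p
  nonNeg-at (p ∷ ps) (suc j) = nonNeg-at ps j

  -- One time step of `source` applied to all initial values at once, so that charges can be
  -- computed forwards.
  next : List ℤ³ → List ℤ³
  next []       = []
  next (z ∷ zs) = (four³ z +³ at zs 0) ∷ next zs

  at-next : ∀ zs j → at (next zs) j ≡ four³ (at zs j) +³ at zs (suc j)
  at-next []       j       = ≡.refl
  at-next (z ∷ zs) zero    = ≡.refl
  at-next (z ∷ zs) (suc j) = at-next zs j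

  source-next : ∀ zs j m → source (at (next zs)) j m ≡ source (at zs) j (suc m)
  source-next zs j zero    = at-next zs j
  source-next zs j (suc m) = ≡.cong₂ _+³_ (≡.cong four³ (source-next zs j m)) (source-next zs (suc j) m)

  charge-next : ∀ κ zs u j m → charge κ (at (next zs)) (heat κ u +³ at zs j) j m ≡ charge κ (at zs) u j (suc m)
  charge-next κ zs u j zero    = ≡.refl
  charge-next κ zs u j (suc m) = ≡.cong₂ _+³_ (≡.cong (heat κ) (charge-next κ zs u j m)) (source-next zs j m)

  -- Once the charge and every source are non-negative they remain so.
  Survives : ℕ → ℤ → ℕ → List ℤ³ → ℤ³ → Set
  Survives zero    κ j zs u = NonNeg³ u × All NonNeg³ zs
  Survives (suc M) κ j zs u = NonNeg³ u × Survives M κ j (next zs) (heat κ u +³ at zs j)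

  survives? : ∀ M κ j zs u → Dec (Survives M κ j zs u)
  survives? zero    κ j zs u = nonNeg³? u ×-dec all? nonNeg³? zs
  survives? (suc M) κ j zs u = nonNeg³? u ×-dec survives? M κ j (next zs) (heat κ u +³ at zs j)

  charge-nonNeg : ∀ M κ j zs u → Survives M (+ κ) j zs u → ∀ m → NonNeg³ (charge (+ κ) (at zs) u j m)
  charge-nonNeg (suc M) κ j zs u (p , s) zero    = p
  charge-nonNeg (suc M) κ j zs u (p , s) (suc m) = ≡.subst NonNeg³ (charge-next (+ κ) zs u j m) (charge-nonNeg M κ j (next zs) _ s m)
  charge-nonNeg zero κ j zs u (p , ps) zero    = p
  charge-nonNeg zero κ j zs u (p , ps) (suc m) =
    nonNeg-+³ (heat (+ κ) (charge (+ κ) (at zs) u j m)) _ (nonNeg-heat κ (charge (+ κ) (at zs) u j m) (charge-nonNeg zero κ j zs u (p , ps) m)) (sources m j)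
    where
    sources : ∀ m j → NonNeg³ (source (at zs) j m)
    sources zero    j = nonNeg-at ps j
    sources (suc m) j = nonNeg-+³ (four³ (source (at zs) j m)) _ (nonNeg-four (source (at zs) j m) (sources m j)) (sources m (suc j))

  -- In each coordinate a source is 4^m times a polynomial in m whose leading coefficient comes from
  -- the last non-zero row and is positive. Hence finitely many steps decide; 10 of them are enough
  -- here, and 14 for the weights (2, 1, 3).
  admissible-110 : Admissible 1 1 0
  admissible-110 = record
    { w1≤w0 = toWitness {a? = 1 ℕₚ.≤? 1} _ ; w1+w2≤2w0 = toWitness {a? = 1 ℕₚ.≤? 2} _
    ; charge₀ = charge-nonNeg 10 3 0 even _ (toWitness {a? = survives? 10 (+ 3) 0 even (lin³ start₀)} _)
    ; charge₁ = charge-nonNeg 10 4 0 odd _ (toWitness {a? = survives? 10 (+ 4) 0 odd (lin³ start₁)} _)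
    ; charge₂ = charge-nonNeg 10 3 1 even _ (toWitness {a? = survives? 10 (+ 3) 1 even (lin³ start₂)} _)
    ; charge₃ = charge-nonNeg 10 4 1 odd _ (toWitness {a? = survives? 10 (+ 4) 1 odd (lin³ start₃)} _)
    ; charge₄ = charge-nonNeg 10 3 2 even _ (toWitness {a? = survives? 10 (+ 3) 2 even (lin³ start₄)} _) }
    where open Tables 1 1 0

  admissible-213 : Admissible 2 1 3
  admissible-213 = record
    { w1≤w0 = toWitness {a? = 1 ℕₚ.≤? 2} _ ; w1+w2≤2w0 = toWitness {a? = 4 ℕₚ.≤? 4} _
    ; charge₀ = charge-nonNeg 14 3 0 even _ (toWitness {a? = survives? 14 (+ 3) 0 even (lin³ start₀)} _)
    ; charge₁ = charge-nonNeg 14 4 0 odd _ (toWitness {a? = survives? 14 (+ 4) 0 odd (lin³ start₁)} _)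
    ; charge₂ = charge-nonNeg 14 3 1 even _ (toWitness {a? = survives? 14 (+ 3) 1 even (lin³ start₂)} _)
    ; charge₃ = charge-nonNeg 14 4 1 odd _ (toWitness {a? = survives? 14 (+ 4) 1 odd (lin³ start₃)} _)
    ; charge₄ = charge-nonNeg 14 3 2 even _ (toWitness {a? = survives? 14 (+ 3) 2 even (lin³ start₄)} _) }
    where open Tables 2 1 3

-- The inequalities for the spider without legs.

module BaseTuple where
  open ConeRings
  open LegProducts
  open GapInequalities
  open GoodTuples
  open ChargeBounds
  open Charges
  open IntegerSolver
  open import Data.Nat.Base as ℕ using (ℕ; zero; suc)
  open import Data.Integer.Base as ℤ using (ℤ; +_)
  open import Algebra.Solver.Ring.AlmostCommutativeRing using (_-Raw-AlmostCommutative⟶_)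
  open import Relation.Binary.PropositionalEquality as ≡ using (_≡_)
  import Data.Nat.Properties as ℕₚ
  import Data.Integer.Properties as ℤₚ
  open import Data.Product.Base using (_,_)
  open import Data.List.Base using (List; map)
  open import Relation.Nullary.Decidable using (yes; no)
  open import Function.Base using (_|>_)

  module BaseCase (CR : ConeRing) (w0 w1 w2 : ℕ) (adm : Admissible w0 w1 w2) where
    open Base CR w0 w1 w2 public
    open Tables w0 w1 w2
    open Admissible adm
    open _-Raw-AlmostCommutative⟶_ ι using (⟦_⟧; +-homo; *-homo; -‿homo; 0-homo)

    d : ℕ → Carrier
    d k = pow y k - pow x k

    powP : ∀ {n} → Polynomial n → ℕ → Polynomial n
    powP z zero    = con (+ 1)
    powP z (suc k) = z :* powP z k

    linC : ℤ³ → Carrier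
    linC ⟨ p , q , r ⟩ = ⟦ p ⟧ * c0 + ⟦ q ⟧ * c1 + ⟦ r ⟧ * c2

    lin-homo : ∀ r → ⟦ lin r ⟧ ≈ linC r
    lin-homo ⟨ p , q , r ⟩ = trans (+-homo _ _) (+-cong (trans (+-homo _ _) (+-cong (*-homo p _) (*-homo q _))) (*-homo r _))

    h-d : ∀ k → h * d (2 ℕ.+ k) ≈ d (4 ℕ.+ k) + ⟦ + 4 ⟧ * (e * d (2 ℕ.+ k)) + e * e * d k
    h-d k = solve 4 (λ x y p q → let e = x :* y ; p₂ = x :* (x :* p) ; q₂ = y :* (y :* q) in
      (x :* x :+ (e :+ e :+ e :+ e) :+ y :* y) :* (q₂ :- p₂)
      := (y :* (y :* q₂) :- x :* (x :* p₂)) :+ con (+ 4) :* (e :* (q₂ :- p₂)) :+ e :* e :* (q :- p))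
      refl x y (pow x k) (pow y k)

    module Parity (par κ : ℕ)
      (hf1 : h * d (1 ℕ.+ par) ≈ d (3 ℕ.+ par) + ⟦ + κ ⟧ * (e * d (1 ℕ.+ par)))
      (rows : List Rows) where
      open Track κ par (d (1 ℕ.+ par)) (d (3 ℕ.+ par)) (d (5 ℕ.+ par)) (d (7 ℕ.+ par))
        (Cone-d (1 ℕ.+ par)) (Cone-d (3 ℕ.+ par)) (Cone-d (5 ℕ.+ par)) (Cone-d (7 ℕ.+ par)) hf1
        (h-d (1 ℕ.+ par)) (h-d (3 ℕ.+ par)) (at (map lin³ rows)) public

      v-lin : ∀ n r s t → v n (lin³ (r , s , t)) ≈ vec n (linC r) (linC s) (linC t)
      v-lin n r s t = vec-cong n (lin-homo r) (lin-homo s) (lin-homo t)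

      bound : ∀ n {f g} (r : Rows) → let (r₁ , r₂ , r₃) = r in
              Cone g → g ≈ f - vec n (linC r₁) (linC r₂) (linC r₃) → f ≽ v n (lin³ r)
      bound n (r , s , t) c p = Cone-resp (trans p (+-congˡ (-‿cong (sym (v-lin n r s t))))) c

      beyond : ∀ n {f} → Cone f → f ≽ v n 0³
      beyond n {f} c = Cone-resp (solve 5 (λ f E a b g → f := f :- E :* (con (+ 0) :* a :+ con (+ 0) :* b :+ con (+ 0) :* g))
        refl f (pow e n) (e * e * d (1 ℕ.+ par)) (e * d (3 ℕ.+ par)) (d (5 ℕ.+ par))) c

    module _ {n : ℕ} (par : ℕ) (x y c0 c1 c2 : Polynomial n) where
      private
        eP = x :* y
        dP : ℕ → Polynomial n
        dP k = powP y k :- powP x k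
        linP : ℤ³ → Polynomial n
        linP ⟨ p , q , r ⟩ = con p :* c0 :+ con q :* c1 :+ con r :* c2

      remainder : ℕ → Rows → Polynomial n → Polynomial n
      remainder k (r , s , t) f = f :- powP eP k :* (linP r :* (eP :* eP :* dP (1 ℕ.+ par)) :+ linP s :* (eP :* dP (3 ℕ.+ par)) :+ linP t :* dP (5 ℕ.+ par))

      R-poly : ℕ → Polynomial n
      R-poly a = (:- (c1 :* (eP :* (y :* y :* y :* (powP x a :* con (+ 1)) :- x :* x :* x :* (powP y a :* con (+ 1))))))
        :- c2 :* (y :* y :* y :* y :* y :* (powP x a :* con (+ 1)) :- x :* x :* x :* x :* x :* (powP y a :* con (+ 1)))

      U-poly : ℕ → Polynomial n
      U-poly a = c0 :* (eP :* ((y :- x) :* (powP (x :+ y) a :* con (+ 1))))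
        :+ c1 :* (eP :* (y :* (powP x a :* con (+ 1)) :- x :* (powP y a :* con (+ 1))))
        :+ c2 :* (y :* y :* y :* (powP x a :* con (+ 1)) :- x :* x :* x :* (powP y a :* con (+ 1)))

      R-exact R-last : ℕ → ℕ → Rows → _
      R-exact a k rows = dP 0 := remainder k rows (R-poly a)
      R-last a k rows = c1 :* (eP :* (eP :* (eP :* (eP :* dP (7 ℕ.+ par))))) := remainder k rows (R-poly a)

      U-exact : ℕ → ℕ → ℕ → Rows → _
      U-exact a i k rows = dP 0 := remainder k rows (powP eP i :* U-poly a)

    d-start : ∀ {n} (κ : ℤ) (k : ℕ) (x y : Polynomial n) → _
    d-start κ k x y = (x :* x :+ (x :* y :+ x :* y :+ x :* y :+ x :* y) :+ y :* y) :* (powP y k :- powP x k)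
      := (powP y (2 ℕ.+ k) :- powP x (2 ℕ.+ k)) :+ con κ :* (x :* y :* (powP y k :- powP x k))

    -- The general rule would add e² (y^(-1) - x^(-1)) = - e d 1, which lowers the factor 4 to 3. At
    -- the even start d 0 = 0 leaves it unchanged.
    h-d₁ : h * d 1 ≈ d 3 + ⟦ + 3 ⟧ * (e * d 1)
    h-d₁ = solve 2 (d-start (+ 3) 1) refl x y

    h-d₂ : h * d 2 ≈ d 4 + ⟦ + 4 ⟧ * (e * d 2)
    h-d₂ = solve 2 (d-start (+ 4) 2) refl x y

    module Even = Parity 0 3 h-d₁ evenRows
    module Odd  = Parity 1 4 h-d₂ oddRows

    even-initial : ∀ j → R′ (double j) 0 ≽ Even.v j (at even j)
    even-initial 0 = Even.bound 0 (row evenRows 0) (Cone-d 0)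
      (solve 5 (λ x y c0 c1 c2 → R-exact 0 x y c0 c1 c2 0 0 (row evenRows 0)) refl x y c0 c1 c2)
    even-initial 1 = Even.bound 1 (row evenRows 1) (Cone-d 0)
      (solve 5 (λ x y c0 c1 c2 → R-exact 0 x y c0 c1 c2 2 1 (row evenRows 1)) refl x y c0 c1 c2)
    even-initial 2 = Even.bound 2 (row evenRows 2) (Cone-d 0)
      (solve 5 (λ x y c0 c1 c2 → R-exact 0 x y c0 c1 c2 4 2 (row evenRows 2)) refl x y c0 c1 c2)
    even-initial 3 = Even.bound 3 (row evenRows 3) (Cone-d 0)
      (solve 5 (λ x y c0 c1 c2 → R-exact 0 x y c0 c1 c2 6 3 (row evenRows 3)) refl x y c0 c1 c2)
    even-initial 4 = Even.bound 4 (row evenRows 4) (Cone-d 0)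
      (solve 5 (λ x y c0 c1 c2 → R-exact 0 x y c0 c1 c2 8 4 (row evenRows 4)) refl x y c0 c1 c2)
    -- The part c1 e⁴ d 7 lies outside the three-element basis; it is in the cone and is dropped.
    -- From the next row on everything is dropped.
    even-initial 5 = Even.bound 5 (row evenRows 5) (Mc1 (Cone-e (Cone-e (Cone-e (Cone-e (Cone-d 7))))))
      (solve 5 (λ x y c0 c1 c2 → R-last 0 x y c0 c1 c2 10 5 (row evenRows 5)) refl x y c0 c1 c2)
    even-initial (suc (suc (suc (suc (suc (suc j)))))) = Even.beyond (6 ℕ.+ j) (Cone-R (7 ℕ.+ double j) 0)

    odd-initial : ∀ j → R′ (suc (double j)) 0 ≽ Odd.v j (at odd j)
    odd-initial 0 = Odd.bound 0 (row oddRows 0) (Cone-d 0)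
      (solve 5 (λ x y c0 c1 c2 → R-exact 1 x y c0 c1 c2 1 0 (row oddRows 0)) refl x y c0 c1 c2)
    odd-initial 1 = Odd.bound 1 (row oddRows 1) (Cone-d 0)
      (solve 5 (λ x y c0 c1 c2 → R-exact 1 x y c0 c1 c2 3 1 (row oddRows 1)) refl x y c0 c1 c2)
    odd-initial 2 = Odd.bound 2 (row oddRows 2) (Cone-d 0)
      (solve 5 (λ x y c0 c1 c2 → R-exact 1 x y c0 c1 c2 5 2 (row oddRows 2)) refl x y c0 c1 c2)
    odd-initial 3 = Odd.bound 3 (row oddRows 3) (Cone-d 0)
      (solve 5 (λ x y c0 c1 c2 → R-exact 1 x y c0 c1 c2 7 3 (row oddRows 3)) refl x y c0 c1 c2)
    odd-initial 4 = Odd.bound 4 (row oddRows 4) (Cone-d 0)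
      (solve 5 (λ x y c0 c1 c2 → R-exact 1 x y c0 c1 c2 9 4 (row oddRows 4)) refl x y c0 c1 c2)
    odd-initial 5 = Odd.bound 5 (row oddRows 5) (Mc1 (Cone-e (Cone-e (Cone-e (Cone-e (Cone-d 8))))))
      (solve 5 (λ x y c0 c1 c2 → R-last 1 x y c0 c1 c2 11 5 (row oddRows 5)) refl x y c0 c1 c2)
    odd-initial (suc (suc (suc (suc (suc (suc j)))))) = Odd.beyond (6 ℕ.+ j) (Cone-R (8 ℕ.+ double j) 0)

    module EvenSources = Even.Sources even-initial
    module OddSources  = Odd.Sources odd-initial

    U-low : ∀ a → a ℕ.≤ 4 → ∀ m → Cone (U a m)
    U-low 0 _ m = Cone-cancel (Cone-resp (*-congʳ (idʳ e)) (≽-Cone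
      (EvenSources.U-bound 1 0 0 (lin³ start₀) ≡.refl charge₀
        (Even.bound 0 start₀ (Cone-d 0) (solve 5 (λ x y c0 c1 c2 → U-exact 0 x y c0 c1 c2 0 1 0 start₀) refl x y c0 c1 c2)) m)
      (Even.Cone-v (m ℕ.+ 0) {charge (+ 3) (at even) (lin³ start₀) 0 m} (charge₀ m))))
    U-low 1 _ m = Cone-cancel (Cone-resp (*-congʳ (idʳ e)) (≽-Cone
      (OddSources.U-bound 1 0 0 (lin³ start₁) ≡.refl charge₁
        (Odd.bound 0 start₁ (Cone-d 0) (solve 5 (λ x y c0 c1 c2 → U-exact 1 x y c0 c1 c2 1 1 0 start₁) refl x y c0 c1 c2)) m)
      (Odd.Cone-v (m ℕ.+ 0) {charge (+ 4) (at odd) (lin³ start₁) 0 m} (charge₁ m))))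
    U-low 2 _ m = Cone-resp (idˡ _) (≽-Cone
      (EvenSources.U-bound 0 0 1 (lin³ start₂) ≡.refl charge₂
        (Even.bound 0 start₂ (Cone-d 0) (solve 5 (λ x y c0 c1 c2 → U-exact 0 x y c0 c1 c2 2 0 0 start₂) refl x y c0 c1 c2)) m)
      (Even.Cone-v (m ℕ.+ 0) {charge (+ 3) (at even) (lin³ start₂) 1 m} (charge₂ m)))
    U-low 3 _ m = Cone-resp (idˡ _) (≽-Cone
      (OddSources.U-bound 0 0 1 (lin³ start₃) ≡.refl charge₃
        (Odd.bound 0 start₃ (Cone-d 0) (solve 5 (λ x y c0 c1 c2 → U-exact 1 x y c0 c1 c2 3 0 0 start₃) refl x y c0 c1 c2)) m)
      (Odd.Cone-v (m ℕ.+ 0) {charge (+ 4) (at odd) (lin³ start₃) 1 m} (charge₃ m)))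
    U-low 4 _ m = Cone-resp (idˡ _) (≽-Cone
      (EvenSources.U-bound 0 1 2 (lin³ start₄) ≡.refl charge₄
        (Even.bound 1 start₄ (Cone-d 0) (solve 5 (λ x y c0 c1 c2 → U-exact 0 x y c0 c1 c2 4 0 1 start₄) refl x y c0 c1 c2)) m)
      (Even.Cone-v (m ℕ.+ 1) {charge (+ 3) (at even) (lin³ start₄) 2 m} (charge₄ m)))
    U-low (suc (suc (suc (suc (suc _))))) (ℕ.s≤s (ℕ.s≤s (ℕ.s≤s (ℕ.s≤s ())))) _

    Mδ : Mult (c0 - c1)
    Mδ = Mult-resp (trans (solve 2 (λ p q → p := p :+ q :- q) refl ⟦ + (w0 ℕ.∸ w1) ⟧ c1)
           (+-congʳ (trans (sym (+-homo _ _)) (reflexive (≡.cong (λ n → ⟦ + n ⟧) (ℕₚ.m∸n+n≡m w1≤w0))))))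
           (Mult-ι (w0 ℕ.∸ w1))

    Mγ : Mult (c0 + c0 - (c1 + c2))
    Mγ = Mult-resp (trans (solve 2 (λ p q → p := p :+ q :- q) refl ⟦ + (w0 ℕ.+ w0 ℕ.∸ (w1 ℕ.+ w2)) ⟧ (c1 + c2))
           (+-congʳ (trans (+-congˡ (sym (+-homo _ _))) (trans (sym (+-homo _ _))
             (trans (reflexive (≡.cong (λ n → ⟦ + n ⟧) (ℕₚ.m∸n+n≡m w1+w2≤2w0))) (+-homo _ _))))))
           (Mult-ι (w0 ℕ.+ w0 ℕ.∸ (w1 ℕ.+ w2)))

    V-d : ∀ k → V * d (suc k) ≈ d (suc (suc k)) + e * d k
    V-d k = solve 4 (λ x y p q → (x :+ y) :* (y :* q :- x :* p) := y :* (y :* q) :- x :* (x :* p) :+ x :* y :* (q :- p))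
      refl x y (pow x k) (pow y k)

    -- Equality holds at c = 0. Each further factor V sends d (k + 1) to d (k + 2) + e d k, and the
    -- second summands are surplus.
    V^-d1 : ∀ c → pow V (4 ℕ.+ c) * d1 ≽ d (5 ℕ.+ c) + (⟦ + 3 ⟧ * (e * d (3 ℕ.+ c)) + ⟦ + 2 ⟧ * (e * e * d (1 ℕ.+ c)))
    V^-d1 zero = Cone-resp (solve 2 (λ x y → let dP = λ k → powP y k :- powP x k ; e = x :* y in
        dP 0 := powP (x :+ y) 4 :* (y :- x) :- (dP 5 :+ (con (+ 3) :* (e :* dP 3) :+ con (+ 2) :* (e :* e :* dP 1)))) refl x y) (Cone-d 0)
    V^-d1 (suc c) = Cone-resp (solve 5 (λ x y v p q → let dP = λ k → mulP k y q :- mulP k x p ; e = x :* y ; V = x :+ y in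
        V :* (v :* (y :- x) :- (dP 5 :+ (con (+ 3) :* (e :* dP 3) :+ con (+ 2) :* (e :* e :* dP 1))))
          :+ (e :* dP 4 :+ con (+ 3) :* (e :* (e :* dP 2)) :+ con (+ 2) :* (e :* (e :* (e :* dP 0))))
        := V :* v :* (y :- x) :- (dP 6 :+ (con (+ 3) :* (e :* dP 4) :+ con (+ 2) :* (e :* e :* dP 2))))
        refl x y (pow V (4 ℕ.+ c)) (pow x c) (pow y c))
      (Cone-+ (Cone-V (V^-d1 c)) (Cone-+ (Cone-+ (Cone-e (Cone-d (4 ℕ.+ c))) (Mult-ι 3 (Cone-e (Cone-e (Cone-d (2 ℕ.+ c))))))
         (Mult-ι 2 (Cone-e (Cone-e (Cone-e (Cone-d c)))))))
      where
      mulP : ∀ {n} → ℕ → Polynomial n → Polynomial n → Polynomial n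
      mulP zero    z p = p
      mulP (suc k) z p = z :* mulP k z p

    -- Retains what will pay for the subtracted terms of `B` when b is close to a. The remaining
    -- coefficients are c0 - c1 and 2 c0 - c1 - c2, the latter possibly increased by a weight; they
    -- are the origin of the two conditions on the weights.
    U₀-large : ∀ c → U (2 ℕ.+ c) 0 ≽ c1 * (e * d (3 ℕ.+ c)) + c2 * (e * e * d (1 ℕ.+ c))
    U₀-large 0 = Cone-resp (solve 5 (λ x y c0 c1 c2 → let dP = λ k → powP y k :- powP x k ; e = x :* y in
        (c0 :- c1) :* (e :* dP 3) :+ (c0 :- c1) :* (e :* (e :* dP 1))
        := U-poly 0 x y c0 c1 c2 2 :- (c1 :* (e :* dP 3) :+ c2 :* (e :* e :* dP 1))) refl x y c0 c1 c2)
      (Cone-+ (Mδ (Cone-e (Cone-d 3))) (Mδ (Cone-e (Cone-e (Cone-d 1)))))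
    U₀-large 1 = Cone-resp (solve 5 (λ x y c0 c1 c2 → let dP = λ k → powP y k :- powP x k ; e = x :* y in
        (c0 :- c1) :* (e :* dP 4) :+ (c0 :+ c0 :- (c1 :+ c2)) :* (e :* (e :* dP 2))
        := U-poly 0 x y c0 c1 c2 3 :- (c1 :* (e :* dP 4) :+ c2 :* (e :* e :* dP 2))) refl x y c0 c1 c2)
      (Cone-+ (Mδ (Cone-e (Cone-d 4))) (Mγ (Cone-e (Cone-e (Cone-d 2)))))
    U₀-large (suc (suc c)) = Cone-resp (solve 8 (λ x y c0 c1 c2 v p q →
        let X1 = x :* p ; X3 = x :* (x :* X1) ; X4 = x :* X3 ; X5 = x :* X4 ; Y1 = y :* q ; Y3 = y :* (y :* Y1) ; Y4 = y :* Y3 ; Y5 = y :* Y4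
            e = x :* y ; d5 = Y5 :- X5 ; d3 = Y3 :- X3 ; d1 = Y1 :- X1 in
        c0 :* (e :* (v :* (y :- x) :- (d5 :+ (con (+ 3) :* (e :* d3) :+ con (+ 2) :* (e :* e :* d1)))))
          :+ ((c0 :- c1) :* (e :* d5) :+ ((c0 :+ c0 :- (c1 :+ c2)) :+ c0) :* (e :* (e :* d3)) :+ ((c0 :+ c0 :- (c1 :+ c2)) :+ c1) :* (e :* (e :* (e :* d1))))
        := (c0 :* (e :* ((y :- x) :* (v :* con (+ 1)))) :+ c1 :* (e :* (y :* (X4 :* con (+ 1)) :- x :* (Y4 :* con (+ 1))))
            :+ c2 :* (y :* y :* y :* (X4 :* con (+ 1)) :- x :* x :* x :* (Y4 :* con (+ 1))))
           :- (c1 :* (e :* d5) :+ c2 :* (e :* e :* d3))) refl x y c0 c1 c2 (pow V (4 ℕ.+ c)) (pow x c) (pow y c))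
      (Cone-+ (Mc0 (Cone-e (V^-d1 c)))
        (Cone-+ (Cone-+ (Mδ (Cone-e (Cone-d (5 ℕ.+ c)))) ((Mγ ⊞ Mc0) (Cone-e (Cone-e (Cone-d (3 ℕ.+ c))))))
          ((Mγ ⊞ Mc1) (Cone-e (Cone-e (Cone-e (Cone-d (1 ℕ.+ c))))))))

    U-high : ∀ c m → Cone (U (5 ℕ.+ c) m)
    U-high c zero    = ≽-Cone (U₀-large (3 ℕ.+ c))
      (Cone-+ (Mc1 (Cone-e (Cone-d (6 ℕ.+ c)))) (Mc2 (Cone-resp (sym (*-assoc _ _ _)) (Cone-e (Cone-e (Cone-d (4 ℕ.+ c)))))))
    U-high c (suc m) = Cone-resp (sym (U-step (5 ℕ.+ c) m)) (Cone-+ (Mult-h (U-high c m)) (Cone-R c m))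

    Cone-U : ∀ a m → Cone (U a m)
    Cone-U a m with a ℕₚ.≤? 4
    ... | yes a≤4 = U-low a a≤4 m
    ... | no a≰4  = ≡.subst (λ n → Cone (U n m)) (ℕₚ.m+[n∸m]≡n (ℕₚ.≰⇒> a≰4)) (U-high (a ℕ.∸ 5) m)

    W : ℕ → ℕ → Carrier
    W a j = pow y j * pow x a - pow x j * pow y a

    W-suc : ∀ a j → W (suc a) (suc j) ≈ e * W a j
    W-suc a j = solve 6 (λ x y p q r s → y :* s :* (x :* p) :- x :* r :* (y :* q) := x :* y :* (s :* p :- r :* q))
      refl x y (pow x a) (pow y a) (pow x j) (pow y j)

    W-neg : ∀ a j → - W a j ≈ W j a
    W-neg a j = solve 4 (λ p q r s → :- (s :* p :- r :* q) := q :* r :- p :* s) refl (pow x a) (pow y a) (pow x j) (pow y j)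

    Cone-W : ∀ a j → a ℕ.≤ j → Cone (W a j)
    Cone-W _ j ℕ.z≤n = Cone-resp (sym (+-cong (idʳ _) (-‿cong (idʳ _)))) (Cone-d j)
    Cone-W (suc a) (suc j) (ℕ.s≤s p) = Cone-resp (sym (W-suc a j)) (Cone-e (Cone-W a j p))

    Cone-W⁻ : ∀ a j → j ℕ.≤ a → Cone (- W a j)
    Cone-W⁻ a j p = Cone-resp (sym (W-neg a j)) (Cone-W j a p)

    ≽-trans : ∀ {f g k} → f ≽ g → g ≽ k → f ≽ k
    ≽-trans {f} {g} {k} p q = Cone-resp (solve 3 (λ f g k → (f :- g) :+ (g :- k) := f :- k) refl f g k) (Cone-+ p q)

    ≽-mono : ∀ {n f g} → Mult n → f ≽ g → n * f ≽ n * g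
    ≽-mono {n} {f} {g} M p = Cone-resp (solve 3 (λ n f g → n :* (f :- g) := n :* f :- n :* g) refl n f g) (M p)

    ≽-resp : ∀ {f f′ g g′} → f ≈ f′ → g ≈ g′ → f ≽ g → f′ ≽ g′
    ≽-resp p q = Cone-resp (+-cong p (-‿cong q))

    ≽-+ : ∀ {f g k} → Cone k → f ≽ g → f + k ≽ g
    ≽-+ {f} {g} {k} c p = Cone-resp (solve 3 (λ f g k → (f :- g) :+ k := f :+ k :- g) refl f g k) (Cone-+ p c)

    -- Of V d (j + 1) = d (j + 2) + e d j only the second summand is kept. After c steps this is e^c
    -- d (j - c), which equals W c j.
    V^d≽W : ∀ c j → c ℕ.≤ j → pow V c * d j ≽ W c j
    V^d≽W _ j ℕ.z≤n = Cone-resp (solve 2 (λ a b → con (+ 0) := con (+ 1) :* (a :- b) :- (a :* con (+ 1) :- b :* con (+ 1))) refl (pow y j) (pow x j))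
      (Cone-resp (sym (0-homo)) Cone-0)
    V^d≽W (suc c) (suc j) (ℕ.s≤s p) = ≽-resp
      (trans (solve 4 (λ v e a b → e :* (v :* b) :+ v :* a := v :* (a :+ e :* b)) refl (pow V c) e (d (suc (suc j))) (d j))
        (trans (*-congˡ (sym (V-d j))) (solve 3 (λ V v a → v :* (V :* a) := V :* v :* a) refl V (pow V c) (d (suc j)))))
      (sym (W-suc c j))
      (≽-+ (Mult-V^ c (Cone-d (suc (suc j)))) (≽-mono Cone-e (V^d≽W c j p)))

    -- g1 for the spider without legs, up to reordering.
    B : ℕ → ℕ → Carrier
    B a b = pow V b * U a 0 - c1 * (e * W a (1 ℕ.+ b)) - c2 * W a (3 ℕ.+ b)

    -- From V W a j = W a (j + 1) + W (a + 1) j, whose second summand is left over.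
    B-step : ∀ a b → B a (suc b) ≈ V * B a b + (c1 * (e * W (suc a) (1 ℕ.+ b)) + c2 * W (suc a) (3 ℕ.+ b))
    B-step a b = solve 10 (λ x y c1 c2 v u p q r s →
      let w = λ p q r s → s :* p :- r :* q ; e = x :* y ; x3 = λ r → x :* (x :* (x :* r)) ; y3 = λ s → y :* (y :* (y :* s)) in
      (x :+ y) :* v :* u :- c1 :* (e :* w p q (x :* (x :* r)) (y :* (y :* s))) :- c2 :* w p q (x :* x3 r) (y :* y3 s)
      := (x :+ y) :* (v :* u :- c1 :* (e :* w p q (x :* r) (y :* s)) :- c2 :* w p q (x3 r) (y3 s))
         :+ (c1 :* (e :* w (x :* p) (y :* q) (x :* r) (y :* s)) :+ c2 :* w (x :* p) (y :* q) (x3 r) (y3 s)))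
      refl x y c1 c2 (pow V b) (U a 0) (pow x a) (pow y a) (pow x b) (pow y b)

    B-grow : ∀ a b → a ℕ.≤ b → Cone (B a b) → Cone (B a (suc b))
    B-grow a b p c = Cone-resp (sym (B-step a b)) (Cone-+ (Cone-V c)
      (Cone-+ (Mc1 (Cone-e (Cone-W (suc a) (1 ℕ.+ b) (ℕ.s≤s p)))) (Mc2 (Cone-W (suc a) (3 ℕ.+ b) (ℕ.s≤s (ℕₚ.≤-trans p (ℕₚ.m≤n+m _ 2)))))))

    -- At b = 0 the difference V^b - y^b vanishes and only the term weighted by c0 survives.
    B-zero : ∀ a → Cone (B a 0)
    B-zero a = Cone-resp (solve 8 (λ x y c0 c1 c2 v p q →
        let e = x :* y ; w = λ r s → s :* p :- r :* q in
        c0 :* (e :* (v :* (y :- x))) :=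
        con (+ 1) :* (c0 :* (e :* ((y :- x) :* (v :* con (+ 1)))) :+ c1 :* (e :* (y :* (p :* con (+ 1)) :- x :* (q :* con (+ 1))))
            :+ c2 :* (y :* y :* y :* (p :* con (+ 1)) :- x :* x :* x :* (q :* con (+ 1))))
        :- c1 :* (e :* w (powP x 1) (powP y 1)) :- c2 :* w (powP x 3) (powP y 3))
      refl x y c0 c1 c2 (pow V a) (pow x a) (pow y a))
      (Mc0 (Cone-e (Mult-V^ a Cone-d1)))

    B-one : Cone (B 1 1)
    B-one = Cone-resp (solve 5 (λ x y c0 c1 c2 → let e = x :* y ; dP = λ k → powP y k :- powP x k
                                                     w = λ j → powP y j :* powP x 1 :- powP x j :* powP y 1 in
        c0 :* (e :* dP 3) :+ ((c0 :- c1) :+ c2) :* (e :* (e :* dP 1))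
        := powP (x :+ y) 1 :* U-poly 0 x y c0 c1 c2 1 :- c1 :* (e :* w 2) :- c2 :* w 4) refl x y c0 c1 c2)
      (Cone-+ (Mc0 (Cone-e (Cone-d 3))) ((Mδ ⊞ Mc2) (Cone-e (Cone-e (Cone-d 1)))))

    B-far : ∀ a b → 3 ℕ.+ b ℕ.≤ a → Cone (B a b)
    B-far a b p = Cone-resp (solve 6 (λ u c1 c2 e w w′ → u :+ (c1 :* (e :* (:- w)) :+ c2 :* (:- w′)) := u :- c1 :* (e :* w) :- c2 :* w′)
        refl (pow V b * U a 0) c1 c2 e (W a (1 ℕ.+ b)) (W a (3 ℕ.+ b)))
      (Cone-+ (Mult-V^ b (Cone-U a 0)) (Cone-+ (Mc1 (Cone-e (Cone-W⁻ a (1 ℕ.+ b) (ℕₚ.≤-trans (ℕₚ.m≤n+m (1 ℕ.+ b) 2) p)))) (Mc2 (Cone-W⁻ a (3 ℕ.+ b) p))))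

    -- Writing W (2 + c) (3 + b) as e² W c (1 + b) splits the claim, by `U₀-large`, into one
    -- inequality for each of c1 and c2.
    B-near : ∀ c b → pow V b * d (3 ℕ.+ c) ≽ W (2 ℕ.+ c) (1 ℕ.+ b) → pow V b * d (1 ℕ.+ c) ≽ W c (1 ℕ.+ b) → Cone (B (2 ℕ.+ c) b)
    B-near c b p q = Cone-resp
      (trans (solve 8 (λ c1 c2 e v f g w z → c1 :* (e :* (v :* f :- w)) :+ c2 :* (e :* (e :* (v :* g :- z)))
          := v :* (c1 :* (e :* f) :+ c2 :* (e :* e :* g)) :- c1 :* (e :* w) :- c2 :* (e :* (e :* z)))
          refl c1 c2 e (pow V b) (d (3 ℕ.+ c)) (d (1 ℕ.+ c)) (W (2 ℕ.+ c) (1 ℕ.+ b)) (W c (1 ℕ.+ b)))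
        (+-congˡ (-‿cong (*-congˡ (trans (*-congˡ (sym (W-suc c (1 ℕ.+ b)))) (sym (W-suc (suc c) (2 ℕ.+ b))))))))
      (Cone-+ (Mc1 (Cone-e p)) (Mc2 (Cone-e (Cone-e q))))
      |> λ base → Cone-resp
        (solve 5 (λ v u l w z → v :* (u :- l) :+ (v :* l :- w :- z) := v :* u :- w :- z)
          refl (pow V b) (U (2 ℕ.+ c) 0) (c1 * (e * d (3 ℕ.+ c)) + c2 * (e * e * d (1 ℕ.+ c))) (c1 * (e * W (2 ℕ.+ c) (1 ℕ.+ b))) (c2 * W (2 ℕ.+ c) (3 ℕ.+ b)))
        (Cone-+ (Mult-V^ b (U₀-large c)) base)

    V^d-raise : ∀ b j → pow V (suc b) * d (suc j) ≽ pow V b * d (suc (suc j))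
    V^d-raise b j = Cone-resp (trans (trans (solve 3 (λ v a b → v :* b := v :* (a :+ b) :- v :* a) refl (pow V b) (d (suc (suc j))) (e * d j))
        (+-congʳ (*-congˡ (sym (V-d j))))) (+-congʳ (solve 3 (λ V v a → v :* (V :* a) := V :* v :* a) refl V (pow V b) (d (suc j)))))
      (Mult-V^ b (Cone-e (Cone-d j)))

    -- For a = c + 2: when b < c the subtracted terms have the favourable sign, at b = c, c + 1, c +
    -- 2 the lower bound of U pays for them, and from b = a onwards each step in b adds terms of the
    -- cone.
    Cone-B : ∀ a b → Cone (B a b)
    Cone-B zero    zero    = B-zero 0
    Cone-B zero    (suc b) = B-grow 0 b ℕ.z≤n (Cone-B 0 b)
    Cone-B 1       zero    = B-zero 1
    Cone-B 1       1       = B-one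
    Cone-B 1       (suc (suc b)) = B-grow 1 (suc b) (ℕ.s≤s ℕ.z≤n) (Cone-B 1 (suc b))
    Cone-B (suc (suc c)) b with b ℕₚ.<? c
    ... | yes b<c = B-far (2 ℕ.+ c) b (ℕ.s≤s (ℕ.s≤s b<c))
    ... | no b≮c = ≡.subst (λ n → Cone (B (2 ℕ.+ c) n)) (ℕₚ.m∸n+n≡m (ℕₚ.≮⇒≥ b≮c)) (from (b ℕ.∸ c))
      where
      from : ∀ k → Cone (B (2 ℕ.+ c) (k ℕ.+ c))
      from 0 = B-near c c (Cone-+ (Mult-V^ c (Cone-d (3 ℕ.+ c))) (Cone-W⁻ (2 ℕ.+ c) (1 ℕ.+ c) (ℕₚ.n≤1+n _))) (V^d≽W c (1 ℕ.+ c) (ℕₚ.n≤1+n _))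
      from 1 = B-near c (1 ℕ.+ c) (Cone-+ (Mult-V^ (1 ℕ.+ c) (Cone-d (3 ℕ.+ c))) (Cone-W⁻ (2 ℕ.+ c) (2 ℕ.+ c) ℕₚ.≤-refl))
        (≽-trans (V^d-raise c c) (V^d≽W c (2 ℕ.+ c) (ℕₚ.m≤n+m c 2)))
      from 2 = B-near c (2 ℕ.+ c) (V^d≽W (2 ℕ.+ c) (3 ℕ.+ c) (ℕₚ.n≤1+n _))
        (≽-trans (V^d-raise (1 ℕ.+ c) c) (≽-trans (V^d-raise c (1 ℕ.+ c)) (V^d≽W c (3 ℕ.+ c) (ℕₚ.m≤n+m c 3))))
      from (suc (suc (suc k))) = B-grow (2 ℕ.+ c) (2 ℕ.+ k ℕ.+ c) (ℕ.s≤s (ℕ.s≤s (ℕₚ.m≤n+m c k))) (from (suc (suc k)))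

    good-base : Good one one one one one
    good-base = record
      { gx = Mult-one
      ; g0 = λ a m → Cone-resp (Φ-cong (sym (idʳ _)) (sym (idʳ _)) (sym (idʳ _))) (Cone-U a m)
      ; g1 = λ a b → Cone-resp (solve 11 (λ x y c0 c1 c2 u v p q r s →
          let e = x :* y ; o = con (+ 1) ; w = λ r s → s :* p :- r :* q in
          v :* (c0 :* (e :* ((y :- x) :* (u :* o))) :+ c1 :* (e :* (y :* (p :* o) :- x :* (q :* o)))
                :+ c2 :* (y :* y :* y :* (p :* o) :- x :* x :* x :* (q :* o)))
            :- c1 :* (e :* w (x :* r) (y :* s)) :- c2 :* w (x :* (x :* (x :* r))) (y :* (y :* (y :* s)))
          := c0 :* (e :* ((y :- x) :* (u :* v :* o)))
             :+ c1 :* (e :* (y :* (p :* (v :* o :- s :* o)) :- x :* (q :* (v :* o :- r :* o))))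
             :+ c2 :* (y :* y :* y :* (p :* (v :* o :- s :* o)) :- x :* x :* x :* (q :* (v :* o :- r :* o))))
          refl x y c0 c1 c2 (pow V a) (pow V b) (pow x a) (pow y a) (pow x b) (pow y b)) (Cone-B a b)
      ; fg = λ k → Cone-resp (sym (+-cong (idʳ _) (-‿cong (idʳ _)))) (Cone-d k) }

-- Series in two variables and the cone of alternating ones.

module BivariateSeries where
  open FormalPowerSeries
  open IntegerSolver
  open ConeRings
  open import Level using (0ℓ)
  open import Algebra.Bundles using (CommutativeRing)
  open import Algebra.Solver.Ring.AlmostCommutativeRing
    using (fromCommutativeRing; _-Raw-AlmostCommutative⟶_; -raw-almostCommutative⟶)
  open import Data.Nat.Base as ℕ using (ℕ; zero; suc)
  import Data.Nat.Properties as ℕₚ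
  open import Data.Integer.Base hiding (suc; pred; pos; positive)
  open import Data.Integer.Properties
  open import Data.Sum.Base using (inj₁; inj₂)
  open import Relation.Binary.PropositionalEquality

  ℤ-ring : CommutativeRing 0ℓ 0ℓ
  ℤ-ring = +-*-commutativeRing

  module S₁ = PowerSeries ℤ-ring
  module S₂ = PowerSeries S₁.seriesRing

  ℤ⟦x⟧ ℤ⟦x,y⟧ : CommutativeRing 0ℓ 0ℓ
  ℤ⟦x⟧ = S₁.seriesRing
  ℤ⟦x,y⟧ = S₂.seriesRing

  module R₁ = CommutativeRing ℤ⟦x⟧
  module R₂ = CommutativeRing ℤ⟦x,y⟧

  ι₁ : ℤ-raw -Raw-AlmostCommutative⟶ fromCommutativeRing ℤ⟦x⟧
  ι₁ = S₁.extend (-raw-almostCommutative⟶ (fromCommutativeRing ℤ-ring))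

  ι₂ : ℤ-raw -Raw-AlmostCommutative⟶ fromCommutativeRing ℤ⟦x,y⟧
  ι₂ = S₂.extend ι₁

  open Powers ℤ⟦x,y⟧ ι₂ using (pow)

  -- f j i is the coefficient of yʲ xⁱ.
  Series₂ : Set
  Series₂ = ℕ → ℕ → ℤ

  X₂ Y₂ : Series₂
  X₂ = S₂.C S₁.X
  Y₂ = S₂.X

  x-zero : ∀ f j → (X₂ R₂.* f) j 0 ≡ 0ℤ
  x-zero f j = trans (S₂.C-⊛ S₁.X f j 0) (S₁.X-⊛-zero (f j))

  x-suc : ∀ f j i → (X₂ R₂.* f) j (suc i) ≡ f j i
  x-suc f j i = trans (S₂.C-⊛ S₁.X f j (suc i)) (S₁.X-⊛-suc (f j) i)

  y-zero : ∀ f i → (Y₂ R₂.* f) 0 i ≡ 0ℤ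
  y-zero f i = S₂.X-⊛-zero f i

  y-suc : ∀ f j i → (Y₂ R₂.* f) (suc j) i ≡ f j i
  y-suc f j i = S₂.X-⊛-suc f j i

  e-suc : ∀ f j i → ((X₂ R₂.* Y₂) R₂.* f) (suc j) (suc i) ≡ f j i
  e-suc f j i = trans (R₂.*-assoc X₂ Y₂ f (suc j) (suc i)) (trans (x-suc (Y₂ R₂.* f) (suc j) i) (y-suc f j i))

  -- Above the diagonal, the coefficients of f(x) g(y) - g(x) f(y) are the 2 × 2 minors of the
  -- coefficient sequences of f and g; positivity there is a family of minor inequalities.
  record Alternating⁺ (f : Series₂) : Set where
    constructor alternating
    field
      alt : ∀ i j → f j i ≡ - f i j
      pos : ∀ i j → i ℕ.< j → 0ℤ ≤ f j i

    diag : ∀ i → f i i ≡ 0ℤ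
    diag i = self-neg (f i i) (alt i i)
      where
      self-neg : ∀ a → a ≡ - a → a ≡ 0ℤ
      self-neg +0       _  = refl
      self-neg +[1+ _ ] ()
      self-neg -[1+ _ ] ()

    pos′ : ∀ i j → i ℕ.≤ j → 0ℤ ≤ f j i
    pos′ i j i≤j with ℕₚ.m≤n⇒m<n∨m≡n i≤j
    ... | inj₁ i<j  = pos i j i<j
    ... | inj₂ refl = ≤-reflexive (sym (diag i))
  open Alternating⁺

  0≤+ : ∀ {a b} → 0ℤ ≤ a → 0ℤ ≤ b → 0ℤ ≤ a + b
  0≤+ p q = +-mono-≤ p q

  private
    alt-resp : ∀ {f g} → f R₂.≈ g → Alternating⁺ f → Alternating⁺ g
    alt-resp p c = alternating
      (λ i j → trans (sym (p j i)) (trans (alt c i j) (cong -_ (p i j))))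
      (λ i j i<j → subst (0ℤ ≤_) (p j i) (pos c i j i<j))

    alt-+ : ∀ {f g} → Alternating⁺ f → Alternating⁺ g → Alternating⁺ (f R₂.+ g)
    alt-+ {f} {g} c c′ = alternating
      (λ i j → trans (cong₂ _+_ (alt c i j) (alt c′ i j)) (sym (neg-distrib-+ (f i j) (g i j))))
      (λ i j i<j → 0≤+ (pos c i j i<j) (pos c′ i j i<j))

    transpose-x : ∀ {f g : Series₂} → (∀ i j → f j i ≡ - g i j) → ∀ i j → (X₂ R₂.* f) j i ≡ - (Y₂ R₂.* g) i j
    transpose-x {f} {g} p zero    j = trans (x-zero f j) (sym (cong -_ (y-zero g j)))
    transpose-x {f} {g} p (suc i) j = trans (x-suc f j i) (trans (p i j) (sym (cong -_ (y-suc g i j))))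

    transpose-y : ∀ {f g : Series₂} → (∀ i j → f j i ≡ - g i j) → ∀ i j → (Y₂ R₂.* f) j i ≡ - (X₂ R₂.* g) i j
    transpose-y {f} {g} p i zero    = trans (y-zero f i) (sym (cong -_ (x-zero g i)))
    transpose-y {f} {g} p i (suc j) = trans (y-suc f j i) (trans (p i j) (sym (cong -_ (x-suc g i j))))

    -- The factor y leads from (i, j) to (i, j - 1), which may lie on the diagonal; there
    -- alternation forces the coefficient to be 0.
    alt-V : ∀ {f} → Alternating⁺ f → Alternating⁺ ((X₂ R₂.+ Y₂) R₂.* f)
    alt-V {f} c = alt-resp (R₂.sym (R₂.distribʳ f X₂ Y₂)) (alternating
      (λ i j → trans (cong₂ _+_ (transpose-x {f} (alt c) i j) (transpose-y {f} (alt c) i j))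
         (trans (sym (neg-distrib-+ ((Y₂ R₂.* f) i j) ((X₂ R₂.* f) i j))) (cong -_ (+-comm ((Y₂ R₂.* f) i j) _))))
      (λ i j i<j → 0≤+ (x-part i j i<j) (y-part i j i<j)))
      where
      x-part : ∀ i j → i ℕ.< j → 0ℤ ≤ (X₂ R₂.* f) j i
      x-part zero    j _   = ≤-reflexive (sym (x-zero f j))
      x-part (suc i) j i<j = subst (0ℤ ≤_) (sym (x-suc f j i)) (pos c i j (ℕₚ.<-trans (ℕₚ.n<1+n i) i<j))
      y-part : ∀ i j → i ℕ.< j → 0ℤ ≤ (Y₂ R₂.* f) j i
      y-part i (suc j) i<j = subst (0ℤ ≤_) (sym (y-suc f j i)) (pos′ c i j (ℕ.s≤s⁻¹ i<j))

    alt-e : ∀ {f} → Alternating⁺ f → Alternating⁺ ((X₂ R₂.* Y₂) R₂.* f)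
    alt-e {f} c = alternating anti positive
      where
      anti : ∀ i j → ((X₂ R₂.* Y₂) R₂.* f) j i ≡ - ((X₂ R₂.* Y₂) R₂.* f) i j
      anti i j = trans (R₂.*-assoc X₂ Y₂ f j i) (trans (transpose-x {Y₂ R₂.* f} (transpose-y {f} (alt c)) i j)
        (cong -_ (R₂.trans (R₂.sym (R₂.*-assoc Y₂ X₂ f)) (R₂.*-congʳ {f} (R₂.*-comm Y₂ X₂)) i j)))
      positive : ∀ i j → i ℕ.< j → 0ℤ ≤ ((X₂ R₂.* Y₂) R₂.* f) j i
      positive zero    j       _         = ≤-reflexive (sym (trans (R₂.*-assoc X₂ Y₂ f j 0) (x-zero (Y₂ R₂.* f) j)))
      positive (suc i) (suc j) (ℕ.s≤s p) = subst (0ℤ ≤_) (sym (e-suc f j i)) (pos c i j p)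

    pow-transpose : ∀ k i j → pow Y₂ k j i ≡ pow X₂ k i j
    pow-transpose zero    zero    zero    = refl
    pow-transpose zero    zero    (suc j) = refl
    pow-transpose zero    (suc i) zero    = refl
    pow-transpose zero    (suc i) (suc j) = refl
    pow-transpose (suc k) i zero    = trans (y-zero (pow Y₂ k) i) (sym (x-zero (pow X₂ k) i))
    pow-transpose (suc k) i (suc j) = trans (y-suc (pow Y₂ k) j i) (trans (pow-transpose k i j) (sym (x-suc (pow X₂ k) i j)))

    pow-x-high : ∀ k j i → pow X₂ k (suc j) i ≡ 0ℤ
    pow-x-high zero    j i       = refl
    pow-x-high (suc k) j zero    = x-zero (pow X₂ k) (suc j)
    pow-x-high (suc k) j (suc i) = trans (x-suc (pow X₂ k) (suc j) i) (pow-x-high k j i)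

    pow-x-nonNeg : ∀ k j i → 0ℤ ≤ pow X₂ k j i
    pow-x-nonNeg k       (suc j) i       = ≤-reflexive (sym (pow-x-high k j i))
    pow-x-nonNeg zero    zero    zero    = +≤+ ℕ.z≤n
    pow-x-nonNeg zero    zero    (suc i) = +≤+ ℕ.z≤n
    pow-x-nonNeg (suc k) zero    zero    = ≤-reflexive (sym (x-zero (pow X₂ k) 0))
    pow-x-nonNeg (suc k) zero    (suc i) = subst (0ℤ ≤_) (sym (x-suc (pow X₂ k) 0 i)) (pow-x-nonNeg k 0 i)

    alt-d : ∀ k → Alternating⁺ (pow Y₂ k R₂.- pow X₂ k)
    alt-d k = alternating
      (λ i j → trans (cong₂ (λ a b → a - b) (pow-transpose k i j) (sym (pow-transpose k j i))) (flip-difference (pow X₂ k i j) (pow Y₂ k i j)))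
      (λ { i (suc j) _ → 0≤+ (subst (0ℤ ≤_) (sym (pow-transpose k i (suc j))) (pow-x-nonNeg k i (suc j)))
                             (≤-reflexive (sym (cong -_ (pow-x-high k j i)))) })
      where
      flip-difference : ∀ a b → a - b ≡ - (b - a)
      flip-difference a b = sym (trans (neg-distrib-+ b (- a)) (trans (cong (λ c → - b + c) (neg-involutive a)) (+-comm (- b) a)))

  bivariate : ConeRing
  bivariate = record
    { R = ℤ⟦x,y⟧ ; ι = ι₂ ; x = X₂ ; y = Y₂ ; Cone = Alternating⁺
    ; Cone-resp = alt-resp ; Cone-+ = alt-+ ; Cone-V = alt-V ; Cone-e = alt-e ; Cone-d = alt-d
    ; Cone-cancel = λ {f} c → alternating
        (λ i j → trans (sym (e-suc f j i)) (trans (alt c (suc i) (suc j)) (cong -_ (e-suc f i j))))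
        (λ i j i<j → subst (0ℤ ≤_) (e-suc f j i) (pos c (suc i) (suc j) (ℕ.s≤s i<j))) }

-- The polynomials of a spider, in one variable and in each of two.

module SpiderSeries where
  open FormalPowerSeries
  open IntegerSolver
  open ConeRings
  open LegProducts
  open GapInequalities
  open GoodTuples
  open ChargeBounds
  open Charges
  open BaseTuple
  open BivariateSeries
  open import Level using (0ℓ)
  open import Algebra.Bundles using (CommutativeRing)
  open import Data.Nat.Base as ℕ using (ℕ; zero; suc)
  import Data.Nat.Properties as ℕₚ
  open import Data.List.Base using (List; []; _∷_)
  import Data.Integer.Base as ℤ
  open ℤ using (ℤ; +_; 0ℤ; +≤+)
  import Data.Integer.Properties as ℤₚ
  open import Relation.Binary.PropositionalEquality as ≡ using (_≡_)

  -- Leg n of a spider is the leg on n + 1 vertices.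
  module SpiderPolynomials (R : CommutativeRing 0ℓ 0ℓ) (z : CommutativeRing.Carrier R) where
    open CommutativeRing R

    -- The solution with initial values 0, 0, 1 of the recurrence satisfied by the domination
    -- polynomials of paths; all leg polynomials are combinations of its terms.
    γ : ℕ → Carrier
    γ 0 = 0#
    γ 1 = 0#
    γ 2 = 1#
    γ (suc (suc (suc n))) = z * (γ (suc (suc n)) + γ (suc n) + γ n)

    legA legE legO : ℕ → Carrier
    legA n = γ (3 ℕ.+ n) + γ (2 ℕ.+ n)
    legE n = z * (γ (1 ℕ.+ n) + γ n)
    legO n = z * (γ (2 ℕ.+ n) + γ (1 ℕ.+ n))

    -- `gap` is G - H built without subtraction: either the endpoint of the first leg is chosen, or
    -- it is not and that of another leg is.
    F G H gap : List ℕ → Carrier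
    F []       = 1#
    F (n ∷ ns) = legA n * F ns
    G []       = 1#
    G (n ∷ ns) = G ns * (legE n + legO n)
    H []       = 1#
    H (n ∷ ns) = H ns * legE n
    gap []       = 0#
    gap (n ∷ ns) = gap ns * legE n + G ns * legO n

  record RingMap (R S : CommutativeRing 0ℓ 0ℓ) : Set where
    private
      module R = CommutativeRing R
      module S = CommutativeRing S
    field
      φ   : R.Carrier → S.Carrier
      φ-+ : ∀ a b → φ (a R.+ b) S.≈ φ a S.+ φ b
      φ-* : ∀ a b → φ (a R.* b) S.≈ φ a S.* φ b
      φ-0 : φ R.0# S.≈ S.0#
      φ-1 : φ R.1# S.≈ S.1#

  module Naturality (R S : CommutativeRing 0ℓ 0ℓ) (f : RingMap R S)
    (z : CommutativeRing.Carrier R) (w : CommutativeRing.Carrier S) (φ-z : CommutativeRing._≈_ S (RingMap.φ f z) w) where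
    private
      module R = CommutativeRing R
      module S = CommutativeRing S
      open RingMap f
      module P = SpiderPolynomials R z
      module Q = SpiderPolynomials S w

    infixl 6 _[+]_
    infixl 7 _[*]_
    _[+]_ : ∀ {a b c d} → φ a S.≈ c → φ b S.≈ d → φ (a R.+ b) S.≈ c S.+ d
    p [+] q = S.trans (φ-+ _ _) (S.+-cong p q)
    _[*]_ : ∀ {a b c d} → φ a S.≈ c → φ b S.≈ d → φ (a R.* b) S.≈ c S.* d
    p [*] q = S.trans (φ-* _ _) (S.*-cong p q)

    φ-γ : ∀ n → φ (P.γ n) S.≈ Q.γ n
    φ-γ 0 = φ-0
    φ-γ 1 = φ-0
    φ-γ 2 = φ-1
    φ-γ (suc (suc (suc n))) = φ-z [*] (φ-γ (suc (suc n)) [+] φ-γ (suc n) [+] φ-γ n)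

    φ-E : ∀ n → φ (P.legE n) S.≈ Q.legE n
    φ-E n = φ-z [*] (φ-γ (1 ℕ.+ n) [+] φ-γ n)
    φ-O : ∀ n → φ (P.legO n) S.≈ Q.legO n
    φ-O n = φ-z [*] (φ-γ (2 ℕ.+ n) [+] φ-γ (1 ℕ.+ n))

    φ-F : ∀ ns → φ (P.F ns) S.≈ Q.F ns
    φ-F []       = φ-1
    φ-F (n ∷ ns) = (φ-γ (3 ℕ.+ n) [+] φ-γ (2 ℕ.+ n)) [*] φ-F ns
    φ-G : ∀ ns → φ (P.G ns) S.≈ Q.G ns
    φ-G []       = φ-1
    φ-G (n ∷ ns) = φ-G ns [*] (φ-E n [+] φ-O n)
    φ-H : ∀ ns → φ (P.H ns) S.≈ Q.H ns
    φ-H []       = φ-1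
    φ-H (n ∷ ns) = φ-H ns [*] φ-E n
    φ-gap : ∀ ns → φ (P.gap ns) S.≈ Q.gap ns
    φ-gap []       = φ-0
    φ-gap (n ∷ ns) = φ-gap ns [*] φ-E n [+] φ-G ns [*] φ-O n

  inx iny : (ℕ → ℤ) → Series₂
  inx = S₂.C
  iny u j = S₁.C (u j)

  iny-* : ∀ u v → iny (u R₁.* v) R₂.≈ iny u R₂.* iny v
  iny-* u v zero    = S₁.C-* (u 0) (v 0)
  iny-* u v (suc n) = R₁.trans (S₁.C-+ (u 0 ℤ.* v (suc n)) _) (R₁.+-cong (S₁.C-* (u 0) (v (suc n))) (iny-* (λ k → u (suc k)) v n))

  -- Through this factorisation, membership in the cone turns into inequalities between coefficients
  -- of series in one variable.
  coefficient : ∀ u v i j → (inx u R₂.* iny v) j i ≡ u i ℤ.* v j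
  coefficient u v i j = ≡.trans (S₂.C-⊛ u (iny v) j i) (≡.trans (S₁.⊛-comm u (S₁.C (v j)) i)
    (≡.trans (S₁.C-⊛ (v j) u i) (ℤₚ.*-comm (v j) (u i))))

  scalar : ∀ c f j i → (S₂.C (S₁.C c) R₂.* f) j i ≡ c ℤ.* f j i
  scalar c f j i = ≡.trans (S₂.C-⊛ (S₁.C c) f j i) (S₁.C-⊛ c (f j) i)

  module Px = SpiderPolynomials ℤ⟦x,y⟧ X₂
  module Py = SpiderPolynomials ℤ⟦x,y⟧ Y₂
  module P₁ = SpiderPolynomials ℤ⟦x⟧ S₁.X
  inx-map iny-map : RingMap ℤ⟦x⟧ ℤ⟦x,y⟧
  inx-map = record { φ = inx ; φ-+ = S₂.C-+ ; φ-* = S₂.C-* ; φ-0 = λ { zero _ → ≡.refl ; (suc _) _ → ≡.refl } ; φ-1 = R₂.refl {R₂.1#} }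
  iny-map = record
    { φ = iny ; φ-+ = λ u v j → S₁.C-+ (u j) (v j) ; φ-* = iny-*
    ; φ-0 = λ { _ zero → ≡.refl ; _ (suc _) → ≡.refl }
    ; φ-1 = λ { zero _ → ≡.refl ; (suc _) zero → ≡.refl ; (suc _) (suc _) → ≡.refl } }

  inx-X : inx S₁.X R₂.≈ X₂
  inx-X = R₂.refl {X₂}

  iny-X : iny S₁.X R₂.≈ Y₂
  iny-X zero          zero    = ≡.refl
  iny-X zero          (suc _) = ≡.refl
  iny-X (suc zero)    _       = ≡.refl
  iny-X (suc (suc _)) zero    = ≡.refl
  iny-X (suc (suc _)) (suc _) = ≡.refl

  module Nx = Naturality ℤ⟦x⟧ ℤ⟦x,y⟧ inx-map S₁.X X₂ inx-X
  module Ny = Naturality ℤ⟦x⟧ ℤ⟦x,y⟧ iny-map S₁.X Y₂ iny-X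

  open Gap bivariate using (Pairing; pairing₀; module Step; LegKernel; leaf-kernel; module Long; GapKernel; gap-kernel; GapCones; gap-step; gap-base)

  pairing : ∀ n → Pairing (Px.γ (2 ℕ.+ n)) (Px.γ (1 ℕ.+ n)) (Px.γ n) (Py.γ (2 ℕ.+ n)) (Py.γ (1 ℕ.+ n)) (Py.γ n)
  pairing zero    = pairing₀
  pairing (suc n) = Step.step (pairing n)

  -- A leg with at least two vertices uses the pairing one index below its own, since `Long` applies
  -- the recurrence once more.
  leg-kernel : ∀ n → LegKernel (Px.legA n) (Py.legA n) (Px.legE n R₂.+ Px.legO n) (Py.legE n R₂.+ Py.legO n) (Px.legE n) (Py.legE n)
  leg-kernel zero    = leaf-kernel
  leg-kernel (suc n) = Long.kernel (pairing n)

  gap-cones : ∀ ns → GapCones (Px.G ns) (Py.G ns) (Px.H ns) (Py.H ns) (Px.gap ns) (Py.gap ns)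
  gap-cones []       = gap-base
  gap-cones (n ∷ ns) = gap-step (gap-kernel (pairing n)) (gap-cones ns)

  module Goodness (w0 w1 w2 : ℕ) (adm : Admissible w0 w1 w2) where
    open BaseCase bivariate w0 w1 w2 adm using (c0; c1; c2; Φ; Φ-cong; Good; Good-resp; good-base; good-step) public
    open IntSolver ℤ⟦x,y⟧ ι₂

    good : ∀ ns → Good (Px.F ns R₂.* Py.F ns) (Px.G ns R₂.* Py.F ns) (Px.F ns R₂.* Py.G ns)
                       (Px.H ns R₂.* Py.F ns) (Px.F ns R₂.* Py.H ns)
    good []       = Good-resp u u u u u good-base
      where
      u : R₂.1# R₂.≈ R₂.1# R₂.* R₂.1#
      u = R₂.sym (R₂.*-identityˡ R₂.1#)
    good (n ∷ ns) = Good-resp (both (Px.legA n) (Py.legA n) (Px.F ns) (Py.F ns))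
      (left (Px.legE n R₂.+ Px.legO n) (Py.legA n) (Px.G ns) (Py.F ns))
      (right (Px.legA n) (Py.legE n R₂.+ Py.legO n) (Px.F ns) (Py.G ns))
      (left (Px.legE n) (Py.legA n) (Px.H ns) (Py.F ns)) (right (Px.legA n) (Py.legE n) (Px.F ns) (Py.H ns))
      (good-step (leg-kernel n) (good ns))
      where
      both : ∀ a b f g → a R₂.* b R₂.* (f R₂.* g) R₂.≈ (a R₂.* f) R₂.* (b R₂.* g)
      both = solve 4 (λ a b f g → a :* b :* (f :* g) := (a :* f) :* (b :* g)) R₂.refl
      left : ∀ a b f g → a R₂.* b R₂.* (f R₂.* g) R₂.≈ (f R₂.* a) R₂.* (b R₂.* g)
      left = solve 4 (λ a b f g → a :* b :* (f :* g) := (f :* a) :* (b :* g)) R₂.refl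
      right : ∀ a b f g → a R₂.* b R₂.* (f R₂.* g) R₂.≈ (a R₂.* f) R₂.* (g R₂.* b)
      right = solve 4 (λ a b f g → a :* b :* (f :* g) := (a :* f) :* (g :* b)) R₂.refl

-- A criterion for the unimodality of x F + g.

module UnimodalityCriterion where
  open import Data.Nat.Base as ℕ using (ℕ; zero; suc)
  import Data.Nat.Properties as ℕₚ
  open import Data.Product.Base using (_×_; _,_; ∃-syntax)
  open import Data.Sum.Base using (_⊎_; inj₁; inj₂)
  open import Data.Empty using (⊥-elim)
  open import Data.Integer.Base hiding (suc; pred; pos; positive; Positive)
  open import Data.Integer.Properties
  open import Data.Integer.Solver
  open import Relation.Nullary.Decidable using (yes; no)
  open import Relation.Binary.PropositionalEquality
  open +-*-Solver

  UnimodalUpTo : ℕ → (ℕ → ℤ) → Set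
  UnimodalUpTo n P = ∃[ k ] (∀ i → i ℕ.< k → P i ≤ P (suc i)) × (∀ i → k ℕ.≤ i → i ℕ.< n → P (suc i) ≤ P i)

  UnimodalUpTo-resp : ∀ {n P Q} → (∀ i → P i ≡ Q i) → UnimodalUpTo n P → UnimodalUpTo n Q
  UnimodalUpTo-resp eq (k , up , down) =
    k , (λ i i<k → subst₂ _≤_ (eq i) (eq (suc i)) (up i i<k)) , (λ i k≤i i<n → subst₂ _≤_ (eq (suc i)) (eq i) (down i k≤i i<n))

  first-descent : ∀ (P : ℕ → ℤ) n →
    (∀ i → i ℕ.< n → P i ≤ P (suc i)) ⊎ (∃[ k ] k ℕ.< n × P (suc k) < P k × (∀ i → i ℕ.< k → P i ≤ P (suc i)))
  first-descent P zero    = inj₁ λ _ ()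
  first-descent P (suc n) with first-descent P n
  ... | inj₂ (k , k<n , rest) = inj₂ (k , ℕₚ.m<n⇒m<1+n k<n , rest)
  ... | inj₁ up with P (suc n) <? P n
  ...   | yes down = inj₂ (n , ℕₚ.n<1+n n , down , up)
  ...   | no ¬down = inj₁ λ i i<1+n → case (ℕₚ.m≤n⇒m<n∨m≡n (ℕ.s≤s⁻¹ i<1+n))
    where
    case : ∀ {i} → i ℕ.< n ⊎ i ≡ n → P i ≤ P (suc i)
    case (inj₁ i<n)  = up _ i<n
    case (inj₂ refl) = ≮⇒≥ ¬down

  0≤-+ : ∀ {a b} → 0ℤ ≤ a → 0ℤ ≤ b → 0ℤ ≤ a + b
  0≤-+ p q = +-mono-≤ p q

  0≤-* : ∀ {a b} → 0ℤ ≤ a → 0ℤ ≤ b → 0ℤ ≤ a * b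
  0≤-* {+ a} {+ b} _ _ = subst (0ℤ ≤_) (pos-* a b) (+≤+ ℕ.z≤n)

  0≤-cancel : ∀ {a b} → 0ℤ < a → 0ℤ ≤ a * b → 0ℤ ≤ b
  0≤-cancel {+[1+ n ]} {b} _ p = *-cancelˡ-≤-pos 0ℤ b +[1+ n ] (subst (_≤ +[1+ n ] * b) (sym (*-zeroʳ +[1+ n ])) p)
  0≤-cancel {+0} (+<+ ())

  -- p is F with two zeros in front, so that p k stands for the coefficient of index k − 2.
  record Profile (p g : ℕ → ℤ) : Set where
    field
      p≥0  : ∀ k → 0ℤ ≤ p k
      g≥0  : ∀ k → 0ℤ ≤ g k
      tp₂  : ∀ i j → i ℕ.≤ j → 0ℤ ≤ p (suc i) * p j - p i * p (suc j)
      g-lc : ∀ k → 0ℤ ≤ g (1 ℕ.+ k) * g (1 ℕ.+ k) - g k * g (2 ℕ.+ k)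
      rise : ∀ k → p (2 ℕ.+ k) ≤ p (3 ℕ.+ k) → g k ≤ g (1 ℕ.+ k)
      g≤p  : ∀ k → g k ≤ p (2 ℕ.+ k)
      h₁   : ∀ k → 0ℤ ≤ p (2 ℕ.+ k) * p (2 ℕ.+ k) - p (1 ℕ.+ k) * p (3 ℕ.+ k) + (g k * p (2 ℕ.+ k) - p (1 ℕ.+ k) * g (1 ℕ.+ k))
      h₂   : ∀ k → 0ℤ ≤ + 2 * (p (2 ℕ.+ k) * p (2 ℕ.+ k) - p (1 ℕ.+ k) * p (3 ℕ.+ k)) + (g k * p (2 ℕ.+ k) - p (1 ℕ.+ k) * g (1 ℕ.+ k))
                        + + 3 * (g (1 ℕ.+ k) * p (1 ℕ.+ k) - p k * g (2 ℕ.+ k))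
      slow : ∀ k → 0ℤ ≤ + 2 * p (2 ℕ.+ k) - + 4 * p (1 ℕ.+ k) + + 3 * p k

  module _ {p g : ℕ → ℤ} (prof : Profile p g) where
    open Profile prof

    P : ℕ → ℤ
    P k = p (1 ℕ.+ k) + g k

    -- In unpadded indices: F has a descent no later than the step from i - 1 to i.
    Late : ℕ → Set
    Late i = ∃[ m ] m ℕ.< 2 ℕ.+ i × p (suc m) < p m

    -- By `tp₂` the ratio of consecutive terms at j is at most the one at m, which is below 1.
    p-descends : ∀ m j → m ℕ.≤ j → p (suc m) < p m → p (suc j) ≤ p j
    p-descends m j m≤j d = 0≤i-j⇒j≤i (0≤-cancel (≤-<-trans (p≥0 (suc m)) d)
      (subst (0ℤ ≤_) (solve 4 (λ a b c d → (b :* c :- a :* d) :+ (a :- b) :* c := a :* (c :- d)) refl (p m) (p (suc m)) (p j) (p (suc j)))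
        (0≤-+ (tp₂ m j m≤j) (0≤-* (i≤j⇒0≤j-i (<⇒≤ d)) (p≥0 j)))))

    late-drop : ∀ i → Late i → ∀ j → 1 ℕ.+ i ℕ.≤ j → p (suc j) ≤ p j
    late-drop i (m , m<2+i , d) j 1+i≤j = p-descends m j (ℕₚ.≤-trans (ℕ.s≤s⁻¹ m<2+i) 1+i≤j) d

    -- If the descent lies before m = i + 1, already p (1 + i) ≤ p i. If it is at i + 1 itself,
    -- adding twice that descent to `slow` gives the claim.
    late-slow : ∀ i → Late i → 0ℤ ≤ + 3 * p i - + 2 * p (1 ℕ.+ i)
    late-slow i (m , m<2+i , d) with ℕₚ.m≤n⇒m<n∨m≡n (ℕ.s≤s⁻¹ m<2+i)
    ... | inj₁ m<1+i = subst (0ℤ ≤_) (solve 2 (λ a b → con (+ 3) :* (a :- b) :+ b := con (+ 3) :* a :- con (+ 2) :* b) refl (p i) (p (1 ℕ.+ i)))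
          (0≤-+ (0≤-* {+ 3} (+≤+ ℕ.z≤n) (i≤j⇒0≤j-i (p-descends m i (ℕ.s≤s⁻¹ m<1+i) d))) (p≥0 (1 ℕ.+ i)))
    ... | inj₂ refl  = subst (0ℤ ≤_) (solve 3 (λ a b c → (con (+ 2) :* c :- con (+ 4) :* b :+ con (+ 3) :* a) :+ con (+ 2) :* (b :- c) := con (+ 3) :* a :- con (+ 2) :* b)
            refl (p i) (p (1 ℕ.+ i)) (p (2 ℕ.+ i)))
          (0≤-+ (slow i) (0≤-* {+ 2} (+≤+ ℕ.z≤n) (i≤j⇒0≤j-i (<⇒≤ d))))

    g-falls : ∀ k → g (1 ℕ.+ k) ≤ g k → 0ℤ < g k → g (2 ℕ.+ k) ≤ g (1 ℕ.+ k)
    g-falls k d 0<g = 0≤i-j⇒j≤i (0≤-cancel 0<g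
      (subst (0ℤ ≤_) (solve 3 (λ a b c → (b :* b :- a :* c) :+ (a :- b) :* b := a :* (b :- c)) refl (g k) (g (1 ℕ.+ k)) (g (2 ℕ.+ k)))
        (0≤-+ (g-lc k) (0≤-* (i≤j⇒0≤j-i d) (g≥0 (1 ℕ.+ k))))))

    -- If g grows by a factor at least 3/2, the inequality h₂ decides; otherwise h₁ and the log-concavity of g do.
    continues : ∀ i → Late i → P (1 ℕ.+ i) ≤ P i → P (2 ℕ.+ i) ≤ P (1 ℕ.+ i)
    continues i late down with 0ℤ <? p (1 ℕ.+ i)
    -- Past the mode, a zero of F makes all later coefficients of F vanish, and those of g with
    -- them, because g ≤ F.
    ... | no p₁≤0 = ≤-trans (+-mono-≤ (late-drop i late (2 ℕ.+ i) (ℕₚ.n≤1+n _))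
                      (≤-trans (g≤p (2 ℕ.+ i)) (≤-trans (late-drop i late (3 ℕ.+ i) (ℕₚ.m≤n+m _ 2)) (≤-trans (late-drop i late (2 ℕ.+ i) (ℕₚ.n≤1+n _))
                        (≤-trans (late-drop i late (1 ℕ.+ i) ℕₚ.≤-refl) (≮⇒≥ p₁≤0))))))
                      (≤-trans (≤-reflexive (+-identityʳ (p (2 ℕ.+ i))))
                        (≤-trans (late-drop i late (1 ℕ.+ i) ℕₚ.≤-refl) (≤-trans (≮⇒≥ p₁≤0) (0≤-+ (p≥0 (2 ℕ.+ i)) (g≥0 (1 ℕ.+ i))))))
    ... | yes 0<f₀ with + 3 * g i ≤? + 2 * g (1 ℕ.+ i)
    ...   | yes steep = 0≤i-j⇒j≤i (0≤-cancel 0<f₀ (0≤-cancel {+ 2} (+<+ (ℕ.s≤s ℕ.z≤n)) (subst (0ℤ ≤_)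
              (solve 7 (λ e a b c u v w →
                 (con (+ 2) :* (b :* b :- a :* c) :+ (u :* b :- a :* v) :+ con (+ 3) :* (v :* a :- e :* w))
                 :+ w :* (con (+ 3) :* e :- con (+ 2) :* a) :+ con (+ 2) :* b :* ((a :+ u) :- (b :+ v)) :+ b :* (con (+ 2) :* v :- con (+ 3) :* u)
                 := con (+ 2) :* (a :* ((b :+ v) :- (c :+ w)))) refl
                 (p i) (p (1 ℕ.+ i)) (p (2 ℕ.+ i)) (p (3 ℕ.+ i)) (g i) (g (1 ℕ.+ i)) (g (2 ℕ.+ i)))
              (0≤-+ (0≤-+ (0≤-+ (h₂ i) (0≤-* (g≥0 (2 ℕ.+ i)) (late-slow i late)))
                (0≤-* (0≤-* {+ 2} (+≤+ ℕ.z≤n) (p≥0 (2 ℕ.+ i))) (i≤j⇒0≤j-i down)))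
                (0≤-* (p≥0 (2 ℕ.+ i)) (i≤j⇒0≤j-i steep))))))
    ...   | no ¬steep with g (1 ℕ.+ i) ≤? g i
    ...     | yes fall = +-mono-≤ (late-drop i late (2 ℕ.+ i) (ℕₚ.n≤1+n _)) (g-falls i fall 0<g)
      where
      0<g : 0ℤ < g i
      0<g = *-cancelˡ-<-nonNeg {0ℤ} {g i} (+ 3) (≤-<-trans (0≤-* {+ 2} (+≤+ ℕ.z≤n) (g≥0 (1 ℕ.+ i))) (≰⇒> ¬steep))
    ...     | no climb = 0≤i-j⇒j≤i (0≤-cancel 0<f₀ (0≤-cancel 0<g (subst (0ℤ ≤_)
              (solve 6 (λ a b c u v w →
                 u :* ((b :* b :- a :* c) :+ (u :* b :- a :* v)) :+ u :* b :* ((a :+ u) :- (b :+ v)) :+ a :* (v :* v :- u :* w)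
                 :+ (con (+ 2) :* u :- v) :* (a :* (v :- u) :+ (a :- b) :* u)
                 := u :* (a :* ((b :+ v) :- (c :+ w)))) refl
                 (p (1 ℕ.+ i)) (p (2 ℕ.+ i)) (p (3 ℕ.+ i)) (g i) (g (1 ℕ.+ i)) (g (2 ℕ.+ i)))
              (0≤-+ (0≤-+ (0≤-+ (0≤-* (g≥0 i) (h₁ i)) (0≤-* (0≤-* (g≥0 i) (p≥0 (2 ℕ.+ i))) (i≤j⇒0≤j-i down)))
                (0≤-* (p≥0 (1 ℕ.+ i)) (g-lc i)))
                (0≤-* gentle (0≤-+ (0≤-* (p≥0 (1 ℕ.+ i)) (i≤j⇒0≤j-i (<⇒≤ (≰⇒> climb))))
                                   (0≤-* (i≤j⇒0≤j-i (late-drop i late (1 ℕ.+ i) ℕₚ.≤-refl)) (g≥0 i))))))))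
      where
      0<g : 0ℤ < g i
      0<g = *-cancelˡ-<-nonNeg {0ℤ} {g i} (+ 3) (≤-<-trans (0≤-* {+ 2} (+≤+ ℕ.z≤n) (g≥0 (1 ℕ.+ i))) (≰⇒> ¬steep))
      gentle : 0ℤ ≤ + 2 * g i - g (1 ℕ.+ i)
      gentle = 0≤-cancel {+ 2} (+<+ (ℕ.s≤s ℕ.z≤n)) (subst (0ℤ ≤_)
        (solve 2 (λ u v → (con (+ 3) :* u :- con (+ 2) :* v) :+ u := con (+ 2) :* (con (+ 2) :* u :- v)) refl (g i) (g (1 ℕ.+ i)))
        (0≤-+ (i≤j⇒0≤j-i (<⇒≤ (≰⇒> ¬steep))) (g≥0 i)))

    descends : ∀ k → Late k → P (1 ℕ.+ k) ≤ P k → ∀ i → k ℕ.≤ i → P (1 ℕ.+ i) ≤ P i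
    descends k late down i k≤i with ℕₚ.m≤n⇒m<n∨m≡n k≤i
    ... | inj₂ refl = down
    descends k (m , m<2+k , d) down (suc i) k≤i | inj₁ k<i =
      continues i (m , ℕₚ.<-≤-trans m<2+k (ℕ.s≤s (ℕ.s≤s (ℕ.s≤s⁻¹ k<i))) , d) (descends k (m , m<2+k , d) down i (ℕ.s≤s⁻¹ k<i))

    unimodal : ∀ n → UnimodalUpTo n P
    unimodal n with first-descent P n
    ... | inj₁ up = n , up , λ i n≤i i<n → ⊥-elim (ℕₚ.<⇒≱ i<n n≤i)
    ... | inj₂ (k , _ , down , up) = k , up , λ i k≤i _ → after i k≤i
      where
      after : ∀ i → k ℕ.≤ i → P (1 ℕ.+ i) ≤ P i
      after with first-descent p (2 ℕ.+ k)
      ... | inj₂ (m , m<2+k , d , _) = descends k (m , m<2+k , d) (<⇒≤ down)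
      -- The descent is then due to g alone. By `rise`, F falls at the step from k to k + 1, so from
      -- k + 1 on the situation is late.
      ... | inj₁ p-up = λ i k≤i → from i (ℕₚ.m≤n⇒m<n∨m≡n k≤i)
        where
        g-down : g (1 ℕ.+ k) < g k
        g-down = ≰⇒> λ g-up → <⇒≱ down (+-mono-≤ (p-up (1 ℕ.+ k) (ℕₚ.n<1+n _)) g-up)
        p-down : p (3 ℕ.+ k) < p (2 ℕ.+ k)
        p-down = ≰⇒> λ p-up → <⇒≱ g-down (rise k p-up)
        from : ∀ i → k ℕ.< i ⊎ k ≡ i → P (1 ℕ.+ i) ≤ P i
        from i (inj₂ refl) = <⇒≤ down
        from i (inj₁ k<i)  = descends (1 ℕ.+ k) (2 ℕ.+ k , ℕₚ.n<1+n _ , p-down)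
          (+-mono-≤ (<⇒≤ p-down) (g-falls k (<⇒≤ g-down) (≤-<-trans (g≥0 (1 ℕ.+ k)) g-down))) i k<i

-- Coefficient inequalities read off from the cone.

module SpiderMinors where
  open FormalPowerSeries
  open IntegerSolver
  open ConeRings
  open GapInequalities
  open Charges
  open BaseTuple
  open BivariateSeries
  open SpiderSeries
  open import Data.Nat.Base as ℕ using (ℕ; suc)
  import Data.Nat.Properties as ℕₚ
  open import Data.List.Base using (List)
  open import Data.Integer.Base using (ℤ; +_; 0ℤ; _+_; _*_; _-_; -_; _≤_)
  open import Data.Integer.Properties
  open import Relation.Binary.PropositionalEquality

  open IntSolver ℤ⟦x,y⟧ ι₂

  module Good₁₁₀ = Goodness 1 1 0 admissible-110
  open P₁ public using () renaming (F to F; G to G; H to H; gap to gap)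

  shift : (ℕ → ℤ) → ℕ → ℤ
  shift u = S₁.X R₁.* u

  shift-suc : ∀ u n → shift u (suc n) ≡ u n
  shift-suc = S₁.X-⊛-suc

  padded : List ℕ → ℕ → ℤ
  padded ns = shift (shift (F ns))

  padded-F : ∀ ns k → padded ns (2 ℕ.+ k) ≡ F ns k
  padded-F ns k = trans (shift-suc (shift (F ns)) (suc k)) (shift-suc (F ns) k)

  inx-shift : ∀ {u v} → inx u R₂.≈ v → inx (shift u) R₂.≈ X₂ R₂.* v
  inx-shift {u} p = R₂.trans (S₂.C-* S₁.X u) (R₂.*-congˡ p)

  iny-shift : ∀ {u v} → iny u R₂.≈ v → iny (shift u) R₂.≈ Y₂ R₂.* v
  iny-shift {u} p = R₂.trans (iny-* S₁.X u) (R₂.*-cong iny-X p)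

  product-coefficient : ∀ {u v f g} → inx u R₂.≈ f → iny v R₂.≈ g → ∀ i j → (f R₂.* g) j i ≡ u i * v j
  product-coefficient {u} {v} p q i j = trans (R₂.*-cong (R₂.sym p) (R₂.sym q) j i) (coefficient u v i j)

  minor : ∀ {u v u′ v′ f g f′ g′} → inx u R₂.≈ f → iny v R₂.≈ g → inx u′ R₂.≈ f′ → iny v′ R₂.≈ g′ →
          Alternating⁺ (f R₂.* g R₂.- f′ R₂.* g′) → ∀ k → 0ℤ ≤ u k * v (suc k) - u′ k * v′ (suc k)
  minor p q p′ q′ c k = subst (0ℤ ≤_)
    (cong₂ (λ a b → a - b) (product-coefficient p q k (suc k)) (product-coefficient p′ q′ k (suc k)))
    (Alternating⁺.pos c k (suc k) (ℕₚ.n<1+n k))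

  FG-minor : ∀ ns k → 0ℤ ≤ F ns k * G ns (suc k) - G ns k * F ns (suc k)
  FG-minor ns = minor (Nx.φ-F ns) (Ny.φ-G ns) (Nx.φ-G ns) (Ny.φ-F ns)
    (ConeRing.Cone-resp bivariate {R₂.1# R₂.* fg R₂.- R₂.1# R₂.* gf} {fg R₂.- gf}
      (R₂.+-cong (R₂.*-identityˡ fg) (R₂.-‿cong (R₂.*-identityˡ gf)))
      (Good₁₁₀.Good.fg (Good₁₁₀.good ns) 0))
    where
    fg gf : Series₂
    fg = Px.F ns R₂.* Py.G ns
    gf = Px.G ns R₂.* Py.F ns

  G-gap-minor : ∀ ns k → 0ℤ ≤ G ns k * gap ns (suc k) - gap ns k * G ns (suc k)
  G-gap-minor ns = minor (Nx.φ-G ns) (Ny.φ-gap ns) (Nx.φ-gap ns) (Ny.φ-G ns) (Gap.GapCones.Gg₀ (gap-cones ns))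


  -- These are the coefficients of (y - x) f(x) f(y) at x^(k+1) y^(k+2).
  log-concave : ∀ {u f g} → inx u R₂.≈ f → iny u R₂.≈ g → Alternating⁺ ((Y₂ R₂.- X₂) R₂.* (f R₂.* g)) →
                ∀ k → 0ℤ ≤ u (suc k) * u (suc k) - u k * u (2 ℕ.+ k)
  log-concave {u} {f} {g} p q c k = subst (0ℤ ≤_)
    (cong₂ (λ a b → u (suc k) * a - b * u (2 ℕ.+ k)) (shift-suc u (suc k)) (shift-suc u k))
    (minor p (iny-shift q) (inx-shift p) q (ConeRing.Cone-resp bivariate
      (solve 4 (λ x y f g → (y :- x) :* (f :* g) := f :* (y :* g) :- x :* f :* g) R₂.refl X₂ Y₂ f g) c) (suc k))

  gap-log-concave : ∀ ns k → 0ℤ ≤ gap ns (suc k) * gap ns (suc k) - gap ns k * gap ns (2 ℕ.+ k)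
  gap-log-concave ns = log-concave (Nx.φ-gap ns) (Ny.φ-gap ns) (Gap.GapCones.gg (gap-cones ns))

  -- F(x) F(y) is a multiplier, so its product with y - x is in the cone; two factors x y turn it
  -- into the same expression for the padded series. All pairs i ≤ j are needed, as neighbouring
  -- minors alone allow internal zeros.
  padded-minor : ∀ ns i j → i ℕ.≤ j → 0ℤ ≤ padded ns (suc i) * padded ns j - padded ns i * padded ns (suc j)
  padded-minor ns i j i≤j = subst (0ℤ ≤_)
    (cong₂ (λ a b → a - b)
      (trans (product-coefficient px (iny-shift py) (suc i) (suc j)) (cong (padded ns (suc i) *_) (shift-suc (padded ns) j)))
      (trans (product-coefficient (inx-shift px) py (suc i) (suc j)) (cong (_* padded ns (suc j)) (shift-suc (padded ns) i))))
    (Alternating⁺.pos′ (ConeRing.Cone-resp bivariate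
      (solve 4 (λ x y f g → let F = x :* (x :* f) ; G = y :* (y :* g) in (x :* y) :* ((x :* y) :* (f :* g :* (y :- x))) := F :* (y :* G) :- (x :* F) :* G) R₂.refl X₂ Y₂ (Px.F ns) (Py.F ns))
      (ConeRing.Cone-e bivariate (ConeRing.Cone-e bivariate (Good₁₁₀.Good.gx (Good₁₁₀.good ns) {Y₂ R₂.- X₂} Cone-d1)))) (suc i) (suc j) (ℕ.s≤s i≤j))
    where
    open ConeRings.Cones bivariate using (Cone-d1)
    px : inx (padded ns) R₂.≈ X₂ R₂.* (X₂ R₂.* Px.F ns)
    px = inx-shift (inx-shift (Nx.φ-F ns))
    py : iny (padded ns) R₂.≈ Y₂ R₂.* (Y₂ R₂.* Py.F ns)
    py = iny-shift (iny-shift (Ny.φ-F ns))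

  module Weighted-inequality (w0 w1 w2 : ℕ) (adm : Admissible w0 w1 w2) where
    open Goodness w0 w1 w2 adm

    -- This is `g1` at a = b = 0. A factor x y turns its terms into products of padded series, and
    -- the coefficient at x^(k+2) y^(k+3) is taken.
    weighted : ∀ ns k → let p = padded ns ; g = gap ns in
      0ℤ ≤ + w0 * (p (2 ℕ.+ k) * p (2 ℕ.+ k) - p (1 ℕ.+ k) * p (3 ℕ.+ k))
           + + w1 * (g k * p (2 ℕ.+ k) - p (1 ℕ.+ k) * g (1 ℕ.+ k))
           + + w2 * (g (1 ℕ.+ k) * p (1 ℕ.+ k) - p k * g (2 ℕ.+ k))
    weighted ns k = subst (0ℤ ≤_)
      (cong₂ _+_ (cong₂ _+_
          (trans (scalar (+ w0) T0 (3 ℕ.+ k) (2 ℕ.+ k)) (cong (+ w0 *_) (cong₂ _-_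
            (trans (product-coefficient px (iny-shift py) (2 ℕ.+ k) (3 ℕ.+ k)) (cong (p (2 ℕ.+ k) *_) (shift-suc p (2 ℕ.+ k))))
            (trans (product-coefficient (inx-shift px) py (2 ℕ.+ k) (3 ℕ.+ k)) (cong (_* p (3 ℕ.+ k)) (shift-suc p (1 ℕ.+ k)))))))
          (trans (scalar (+ w1) T1 (3 ℕ.+ k) (2 ℕ.+ k)) (cong (+ w1 *_) (cong₂ _-_
            (trans (product-coefficient (inx-shift (inx-shift gx)) (iny-shift py) (2 ℕ.+ k) (3 ℕ.+ k))
               (cong₂ _*_ (shift² g k) (shift-suc p (2 ℕ.+ k))))
            (trans (product-coefficient (inx-shift px) (iny-shift (iny-shift gy)) (2 ℕ.+ k) (3 ℕ.+ k))
               (cong₂ _*_ (shift-suc p (1 ℕ.+ k)) (shift² g (1 ℕ.+ k))))))))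
        (trans (scalar (+ w2) T2 (3 ℕ.+ k) (2 ℕ.+ k)) (cong (+ w2 *_) (cong₂ _-_
            (trans (product-coefficient (inx-shift gx) (iny-shift (iny-shift py)) (2 ℕ.+ k) (3 ℕ.+ k))
               (cong₂ _*_ (shift-suc g (1 ℕ.+ k)) (shift² p (1 ℕ.+ k))))
            (trans (product-coefficient (inx-shift (inx-shift px)) (iny-shift gy) (2 ℕ.+ k) (3 ℕ.+ k))
               (cong₂ _*_ (shift² p k) (shift-suc g (2 ℕ.+ k))))))))
      (Alternating⁺.pos cone (2 ℕ.+ k) (3 ℕ.+ k) (ℕₚ.n<1+n _))
      where
      p g : ℕ → ℤ
      p = padded ns
      g = gap ns
      shift² : ∀ u n → shift (shift u) (2 ℕ.+ n) ≡ u n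
      shift² u n = trans (shift-suc (shift u) (suc n)) (shift-suc u n)
      fx fy : Series₂
      fx = X₂ R₂.* (X₂ R₂.* Px.F ns)
      fy = Y₂ R₂.* (Y₂ R₂.* Py.F ns)
      px : inx p R₂.≈ fx
      px = inx-shift (inx-shift (Nx.φ-F ns))
      py : iny p R₂.≈ fy
      py = iny-shift (iny-shift (Ny.φ-F ns))
      gx : inx g R₂.≈ Px.gap ns
      gx = Nx.φ-gap ns
      gy : iny g R₂.≈ Py.gap ns
      gy = Ny.φ-gap ns
      T0 T1 T2 : Series₂
      T0 = fx R₂.* (Y₂ R₂.* fy) R₂.- (X₂ R₂.* fx) R₂.* fy
      T1 = (X₂ R₂.* (X₂ R₂.* Px.gap ns)) R₂.* (Y₂ R₂.* fy) R₂.- (X₂ R₂.* fx) R₂.* (Y₂ R₂.* (Y₂ R₂.* Py.gap ns))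
      T2 = (X₂ R₂.* Px.gap ns) R₂.* (Y₂ R₂.* (Y₂ R₂.* fy)) R₂.- (X₂ R₂.* (X₂ R₂.* fx)) R₂.* (Y₂ R₂.* Py.gap ns)
      gap-times : ∀ {A B C} D → A R₂.≈ C R₂.+ B → R₂.1# R₂.* (R₂.1# R₂.* (A R₂.* D) R₂.- R₂.1# R₂.* (B R₂.* D)) R₂.≈ C R₂.* D
      gap-times {A} {B} {C} D q = R₂.trans (R₂.*-identityˡ _) (R₂.trans (R₂.+-cong (R₂.trans (R₂.*-identityˡ _) (R₂.*-congʳ q)) (R₂.-‿cong (R₂.*-identityˡ _)))
        (solve 3 (λ B C D → (C :+ B) :* D :- B :* D := C :* D) R₂.refl B C D))
      cone : Alternating⁺ (c0 R₂.* T0 R₂.+ c1 R₂.* T1 R₂.+ c2 R₂.* T2)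
      cone = ConeRing.Cone-resp bivariate
        (solve 9 (λ x y c0 c1 c2 f f′ g g′ → let fx = x :* (x :* f) ; fy = y :* (y :* f′) in
          (x :* y) :* (c0 :* (x :* y :* ((y :- x) :* (f :* f′))) :+ c1 :* (x :* y :* (y :* (g :* f′) :- x :* (g′ :* f)))
                       :+ c2 :* (y :* y :* y :* (g :* f′) :- x :* x :* x :* (g′ :* f)))
          := c0 :* (fx :* (y :* fy) :- (x :* fx) :* fy)
             :+ c1 :* ((x :* (x :* g)) :* (y :* fy) :- (x :* fx) :* (y :* (y :* g′)))
             :+ c2 :* ((x :* g) :* (y :* (y :* fy)) :- (x :* (x :* fx)) :* (y :* g′)))
          R₂.refl X₂ Y₂ c0 c1 c2 (Px.F ns) (Py.F ns) (Px.gap ns) (Py.gap ns))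
        (ConeRing.Cone-e bivariate (ConeRing.Cone-resp bivariate
          (Φ-cong (R₂.trans (R₂.*-congʳ (R₂.*-identityˡ _)) (R₂.*-identityˡ _))
            (gap-times (Py.F ns) (Gap.GapCones.sumx (gap-cones ns)))
            (R₂.trans (R₂.*-congˡ (R₂.+-cong (R₂.*-congˡ (R₂.*-comm _ _)) (R₂.-‿cong (R₂.*-congˡ (R₂.*-comm _ _))))) (gap-times (Px.F ns) (Gap.GapCones.sumy (gap-cones ns)))))
          (Good.g1 (good ns) 0 0)))

-- Coefficientwise comparison of g, G and F.

module Coefficientwise where
  open FormalPowerSeries
  open IntegerSolver
  open ConeRings
  open GapInequalities
  open Charges
  open BaseTuple
  open BivariateSeries
  open SpiderSeries
  open UnimodalityCriterion using (0≤-*)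
  open import Data.Nat.Base as ℕ using (ℕ; zero; suc)
  import Data.Nat.Properties as ℕₚ
  open import Data.List.Base using ([]; _∷_)
  open import Data.Integer.Base using (ℤ; +_; 0ℤ; +≤+; _+_; _*_; _-_; -_; _≤_)
  open import Data.Integer.Properties
  open import Relation.Binary.PropositionalEquality

  open P₁ using () renaming (F to F; G to G; H to H; gap to gap)
  open IntSolver ℤ⟦x⟧ ι₁

  NonNeg : (ℕ → ℤ) → Set
  NonNeg u = ∀ n → 0ℤ ≤ u n

  infixl 6 _⟨+⟩_
  infixl 7 _⟨*⟩_
  _⟨+⟩_ : ∀ {u v} → NonNeg u → NonNeg v → NonNeg (u R₁.+ v)
  (p ⟨+⟩ q) n = +-mono-≤ (p n) (q n)

  _⟨*⟩_ : ∀ {u v} → NonNeg u → NonNeg v → NonNeg (u R₁.* v)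
  (p ⟨*⟩ q) zero    = 0≤-* (p 0) (q 0)
  (p ⟨*⟩ q) (suc n) = +-mono-≤ (0≤-* (p 0) (q (suc n))) (((λ k → p (suc k)) ⟨*⟩ q) n)

  NonNeg-resp : ∀ {u v} → u R₁.≈ v → NonNeg u → NonNeg v
  NonNeg-resp p q n = subst (0ℤ ≤_) (p n) (q n)

  series-nonNeg-0 : NonNeg R₁.0#
  series-nonNeg-0 n = +≤+ ℕ.z≤n
  series-nonNeg-1 : NonNeg R₁.1#
  series-nonNeg-1 zero    = +≤+ ℕ.z≤n
  series-nonNeg-1 (suc n) = +≤+ ℕ.z≤n
  nonNeg-X : NonNeg S₁.X
  nonNeg-X zero          = +≤+ ℕ.z≤n
  nonNeg-X (suc zero)    = +≤+ ℕ.z≤n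
  nonNeg-X (suc (suc n)) = +≤+ ℕ.z≤n

  γ-nonNeg : ∀ n → NonNeg (P₁.γ n)
  γ-nonNeg 0 = series-nonNeg-0
  γ-nonNeg 1 = series-nonNeg-0
  γ-nonNeg 2 = series-nonNeg-1
  γ-nonNeg (suc (suc (suc n))) = nonNeg-X ⟨*⟩ (γ-nonNeg (suc (suc n)) ⟨+⟩ γ-nonNeg (suc n) ⟨+⟩ γ-nonNeg n)

  legA-nonNeg : ∀ n → NonNeg (P₁.legA n)
  legA-nonNeg n = γ-nonNeg (3 ℕ.+ n) ⟨+⟩ γ-nonNeg (2 ℕ.+ n)
  legE-nonNeg : ∀ n → NonNeg (P₁.legE n)
  legE-nonNeg n = nonNeg-X ⟨*⟩ (γ-nonNeg (1 ℕ.+ n) ⟨+⟩ γ-nonNeg n)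
  legO-nonNeg : ∀ n → NonNeg (P₁.legO n)
  legO-nonNeg n = nonNeg-X ⟨*⟩ (γ-nonNeg (2 ℕ.+ n) ⟨+⟩ γ-nonNeg (1 ℕ.+ n))

  F-nonNeg : ∀ ns → NonNeg (F ns)
  F-nonNeg []       = series-nonNeg-1
  F-nonNeg (n ∷ ns) = legA-nonNeg n ⟨*⟩ F-nonNeg ns
  G-nonNeg : ∀ ns → NonNeg (G ns)
  G-nonNeg []       = series-nonNeg-1
  G-nonNeg (n ∷ ns) = G-nonNeg ns ⟨*⟩ (legE-nonNeg n ⟨+⟩ legO-nonNeg n)
  H-nonNeg : ∀ ns → NonNeg (H ns)
  H-nonNeg []       = series-nonNeg-1
  H-nonNeg (n ∷ ns) = H-nonNeg ns ⟨*⟩ legE-nonNeg n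
  gap-nonNeg : ∀ ns → NonNeg (gap ns)
  gap-nonNeg []       = series-nonNeg-0
  gap-nonNeg (n ∷ ns) = gap-nonNeg ns ⟨*⟩ legE-nonNeg n ⟨+⟩ G-nonNeg ns ⟨*⟩ legO-nonNeg n

  infix 4 _≤ˢ_
  _≤ˢ_ : (u v : ℕ → ℤ) → Set
  u ≤ˢ v = NonNeg (v R₁.- u)

  ≤ˢ⇒≤ : ∀ u v → u ≤ˢ v → ∀ n → u n ≤ v n
  ≤ˢ⇒≤ u v p n = 0≤i-j⇒j≤i (p n)


  -- A - D equals γ (2 + n) - x γ (1 + n), and for n ≥ 1 the recurrence makes this x (γ n + γ (n -
  -- 1)).
  D≤A : ∀ n → P₁.legE n R₁.+ P₁.legO n ≤ˢ P₁.legA n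
  D≤A n = NonNeg-resp (lemma S₁.X (P₁.γ (2 ℕ.+ n)) (P₁.γ (1 ℕ.+ n)) (P₁.γ n)) (slack n)
    where
    lemma : ∀ x a b c → a R₁.- x R₁.* b R₁.≈ (x R₁.* (a R₁.+ b R₁.+ c) R₁.+ a) R₁.- (x R₁.* (b R₁.+ c) R₁.+ x R₁.* (a R₁.+ b))
    lemma = solve 4 (λ x a b c → a :- x :* b := (x :* (a :+ b :+ c) :+ a) :- (x :* (b :+ c) :+ x :* (a :+ b))) R₁.refl
    slack : ∀ n → NonNeg (P₁.γ (2 ℕ.+ n) R₁.- S₁.X R₁.* P₁.γ (1 ℕ.+ n))
    slack zero n = subst (0ℤ ≤_) (sym (trans (cong (λ a → R₁.1# n - a) (R₁.zeroʳ S₁.X n)) (+-identityʳ (R₁.1# n)))) (series-nonNeg-1 n)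
    slack (suc n) = NonNeg-resp (solve 4 (λ x a b c → x :* (b :+ c) := x :* (a :+ b :+ c) :- x :* a) R₁.refl
      S₁.X (P₁.γ (2 ℕ.+ n)) (P₁.γ (1 ℕ.+ n)) (P₁.γ n)) (nonNeg-X ⟨*⟩ (γ-nonNeg (1 ℕ.+ n) ⟨+⟩ γ-nonNeg n))

  G≤F : ∀ ns → G ns ≤ˢ F ns
  G≤F []       n = ≤-reflexive (sym (+-inverseʳ (R₁.1# n)))
  G≤F (n ∷ ns) = NonNeg-resp (solve 4 (λ a d f g → (a :- d) :* f :+ (f :- g) :* d := a :* f :- g :* d)
      R₁.refl (P₁.legA n) (P₁.legE n R₁.+ P₁.legO n) (F ns) (G ns))
    (D≤A n ⟨*⟩ F-nonNeg ns ⟨+⟩ G≤F ns ⟨*⟩ (legE-nonNeg n ⟨+⟩ legO-nonNeg n))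

  G-split : ∀ ns → G ns R₁.≈ gap ns R₁.+ H ns
  G-split []       = λ n → sym (+-identityˡ (R₁.1# n))
  G-split (n ∷ ns) = R₁.trans (R₁.*-congʳ {E R₁.+ O} {G ns} {g R₁.+ h} (G-split ns)) (R₁.trans
    (solve 4 (λ g h e o → (g :+ h) :* (e :+ o) := g :* e :+ (g :+ h) :* o :+ h :* e) R₁.refl g h E O)
    (λ k → cong (λ c → (g R₁.* E) k + c + (h R₁.* E) k) (R₁.*-congʳ {O} {g R₁.+ h} {G ns} (R₁.sym {G ns} {g R₁.+ h} (G-split ns)) k)))
    where
    g h E O : ℕ → ℤ
    g = gap ns
    h = H ns
    E = P₁.legE n
    O = P₁.legO n

  gap≤G : ∀ ns → gap ns ≤ˢ G ns
  gap≤G ns n = subst (0ℤ ≤_) (trans (cancel (gap ns n) (H ns n)) (cong (_- gap ns n) (sym (G-split ns n)))) (H-nonNeg ns n)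
    where
    cancel : ∀ a b → b ≡ a + b - a
    cancel a b = sym (trans (cong (_- a) (+-comm a b)) (trans (+-assoc b a (- a)) (trans (cong (λ c → b + c) (+-inverseʳ a)) (+-identityʳ b))))

-- The hypotheses of the criterion for spiders with slowly varying F.

module SpiderProfile where
  open FormalPowerSeries
  open IntegerSolver
  open ConeRings
  open Charges
  open BivariateSeries
  open SpiderSeries
  open SpiderMinors
  open Coefficientwise
  open UnimodalityCriterion
  open import Data.Nat.Base as ℕ using (ℕ; suc)
  import Data.Nat.Properties as ℕₚ
  open import Data.List.Base using (List)
  open import Data.Integer.Base using (ℤ; +_; 0ℤ; 1ℤ; _+_; _*_; _-_; -_; _≤_)
  open import Data.Integer.Properties
  open import Data.Integer.Solver
  open import Relation.Nullary.Decidable using (yes; no)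
  open import Relation.Binary.PropositionalEquality
  open +-*-Solver

  Slow : (ℕ → ℤ) → Set
  Slow u = ∀ k → 0ℤ ≤ + 2 * u k - + 4 * shift u k + + 3 * shift (shift u) k

  module Inequality₂₁₃ = Weighted-inequality 2 1 3 admissible-213
  module Inequality₁₁₀ = Weighted-inequality 1 1 0 admissible-110

  -- The minor says that the ratio of (c, d) to (a, b) does not decrease, so d / c ≥ b / a ≥ 1. When
  -- a is not positive, c ≤ a settles the matter.
  carry : ∀ {a b c d} → 0ℤ ≤ a * d - c * b → 0ℤ ≤ c → c ≤ a → a ≤ b → 0ℤ ≤ d → c ≤ d
  carry {a} {b} {c} {d} minor 0≤c c≤a a≤b 0≤d with 0ℤ <? a
  ... | yes 0<a = 0≤i-j⇒j≤i (0≤-cancel 0<a (subst (0ℤ ≤_) (solve 4 (λ a b c d → (a :* d :- c :* b) :+ c :* (b :- a) := a :* (d :- c)) refl a b c d)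
         (0≤-+ minor (0≤-* 0≤c (i≤j⇒0≤j-i a≤b)))))
  ... | no 0≮a  = ≤-trans c≤a (≤-trans (≮⇒≥ 0≮a) 0≤d)

  shift-nonNeg : ∀ {u} → NonNeg u → NonNeg (shift u)
  shift-nonNeg p = nonNeg-X ⟨*⟩ p

  profile : ∀ ns → Slow (F ns) → Profile (padded ns) (gap ns)
  profile ns slow = record
    { p≥0 = shift-nonNeg (shift-nonNeg (F-nonNeg ns))
    ; g≥0 = gap-nonNeg ns
    ; tp₂ = padded-minor ns
    ; g-lc = gap-log-concave ns
    -- The increase passes from F to G and then from G to g.
    ; rise = λ k F-up → carry {G ns k} {G ns (suc k)} (G-gap-minor ns k) (gap-nonNeg ns k) (≤ˢ⇒≤ (gap ns) (G ns) (gap≤G ns) k)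
        (carry {F ns k} {F ns (suc k)} (FG-minor ns k) (G-nonNeg ns k) (≤ˢ⇒≤ (G ns) (F ns) (G≤F ns) k) (subst₂ _≤_ (padded-F ns k) (padded-F ns (suc k)) F-up) (G-nonNeg ns (suc k)))
        (gap-nonNeg ns (suc k))
    ; g≤p = λ k → ≤-trans (≤ˢ⇒≤ (gap ns) (G ns) (gap≤G ns) k) (≤-trans (≤ˢ⇒≤ (G ns) (F ns) (G≤F ns) k) (≤-reflexive (sym (padded-F ns k))))
    ; h₁ = λ k → subst (0ℤ ≤_) (solve 3 (λ a b c → con 1ℤ :* a :+ con 1ℤ :* b :+ con 0ℤ :* c := a :+ b) refl
        (p (2 ℕ.+ k) * p (2 ℕ.+ k) - p (1 ℕ.+ k) * p (3 ℕ.+ k)) (g k * p (2 ℕ.+ k) - p (1 ℕ.+ k) * g (1 ℕ.+ k)) (g (1 ℕ.+ k) * p (1 ℕ.+ k) - p k * g (2 ℕ.+ k)))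
        (Inequality₁₁₀.weighted ns k)
    ; h₂ = λ k → subst (0ℤ ≤_) (solve 3 (λ a b c → con (+ 2) :* a :+ con 1ℤ :* b :+ con (+ 3) :* c := con (+ 2) :* a :+ b :+ con (+ 3) :* c) refl
        (p (2 ℕ.+ k) * p (2 ℕ.+ k) - p (1 ℕ.+ k) * p (3 ℕ.+ k)) (g k * p (2 ℕ.+ k) - p (1 ℕ.+ k) * g (1 ℕ.+ k)) (g (1 ℕ.+ k) * p (1 ℕ.+ k) - p k * g (2 ℕ.+ k)))
        (Inequality₂₁₃.weighted ns k)
    ; slow = λ k → subst (0ℤ ≤_) (reorder k) (slow k) }
    where
    p g : ℕ → ℤ
    p = padded ns
    g = gap ns
    reorder : ∀ k → + 2 * F ns k - + 4 * shift (F ns) k + + 3 * padded ns k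
              ≡ + 2 * padded ns (2 ℕ.+ k) - + 4 * padded ns (1 ℕ.+ k) + + 3 * padded ns k
    reorder k = cong₂ (λ a b → + 2 * a - + 4 * b + + 3 * padded ns k) (sym (padded-F ns k)) (sym (shift-suc (shift (F ns)) k))

  counts : List ℕ → ℕ → ℤ
  counts ns k = shift (F ns) k + gap ns k

  slow-unimodal : ∀ ns → Slow (F ns) → ∀ n → UnimodalUpTo n (counts ns)
  slow-unimodal ns slow n = UnimodalUpTo-resp (λ k → cong (_+ gap ns k) (shift-suc (shift (F ns)) k)) (unimodal (profile ns slow) n)

-- Slow spiders, and the finite search through the others.

module ExceptionalSpiders where
  open FormalPowerSeries
  open import Defs using (nth)
  open BivariateSeries
  open SpiderSeries
  open SpiderMinors
  open Coefficientwise
  open UnimodalityCriterion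
  open SpiderProfile
  open import Data.Nat.Base as ℕ using (ℕ; zero; suc)
  import Data.Nat.Properties as ℕₚ
  open import Data.Bool.Base using (Bool; true; false; _∧_; _∨_; T)
  open import Data.Bool.Properties using (T-∧; T-∨)
  open IntegerSolver
  open import Data.List.Base using (List; []; _∷_; _ʳ++_; reverse)
  open import Data.List.Sort ℕₚ.≤-decTotalOrder using (sort; sort-↗; sort-↭)
  open import Data.List.Relation.Unary.Linked using (Linked; []; _∷_)
  open import Data.List.Relation.Binary.Permutation.Propositional as ↭ using (_↭_; prep; swap)
  open import Data.List.Relation.Binary.Permutation.Propositional.Properties using (↭-reverse)
  open import Algebra.Bundles using (CommutativeRing)
  open import Algebra.Properties.CommutativeSemigroup R₁.*-commutativeSemigroup using (x∙yz≈y∙xz; xy∙z≈xz∙y)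
  open import Algebra.Properties.Group (CommutativeRing.+-group ℤ-ring) using (∙-cancelʳ)
  open import Data.Product.Base using (_×_; _,_; proj₁; proj₂; ∃-syntax)
  open import Data.Sum.Base using (_⊎_; inj₁; inj₂; [_,_]′)
  open import Data.Unit.Base using (⊤; tt)
  open import Data.Integer.Base using (ℤ; +_; 0ℤ; +≤+; _+_; _*_; _-_; -_; _≤_)
  open import Data.Integer.Properties
  open import Function.Bundles using (Equivalence)
  open import Relation.Binary.PropositionalEquality

  ⟦_⟧ : List ℕ → ℕ → ℤ
  ⟦ as ⟧ n = + nth as n

  infixl 6 _⊹_
  _⊹_ : List ℕ → List ℕ → List ℕ
  []       ⊹ bs       = bs
  (a ∷ as) ⊹ []       = a ∷ as
  (a ∷ as) ⊹ (b ∷ bs) = a ℕ.+ b ∷ as ⊹ bs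

  ⊹-sound : ∀ as bs → ⟦ as ⊹ bs ⟧ R₁.≈ ⟦ as ⟧ R₁.+ ⟦ bs ⟧
  ⊹-sound []       bs       n       = refl
  ⊹-sound (a ∷ as) []       n       = sym (+-identityʳ (⟦ a ∷ as ⟧ n))
  ⊹-sound (a ∷ as) (b ∷ bs) zero    = refl
  ⊹-sound (a ∷ as) (b ∷ bs) (suc n) = ⊹-sound as bs n

  0∷-sound : ∀ as → ⟦ 0 ∷ as ⟧ R₁.≈ shift ⟦ as ⟧
  0∷-sound as zero    = sym (S₁.X-⊛-zero ⟦ as ⟧)
  0∷-sound as (suc n) = sym (S₁.X-⊛-suc ⟦ as ⟧ n)

  infix 4 _↦_
  _↦_ : List ℕ → (ℕ → ℤ) → Set
  as ↦ u = ⟦ as ⟧ R₁.≈ u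

  0∷ˢ : ∀ {as u} → as ↦ u → 0 ∷ as ↦ shift u
  0∷ˢ {as} p = R₁.trans (0∷-sound as) (R₁.*-congˡ {S₁.X} p)

  data Window : Set where
    window : (a b c : List ℕ) → Window

  advance : Window → Window
  advance (window a b c) = window (0 ∷ (a ⊹ b ⊹ c)) a b

  advanceBy : ℕ → Window → Window
  advanceBy zero    w = w
  advanceBy (suc n) w = advanceBy n (advance w)

  timesA timesE timesO : Window → List ℕ
  timesA (window a b c) = (0 ∷ (a ⊹ b ⊹ c)) ⊹ a
  timesE (window a b c) = 0 ∷ (b ⊹ c)
  timesO (window a b c) = 0 ∷ (a ⊹ b)

  -- A window on u holds the products of u with three consecutive terms of the leg recurrence.
  Shows : Window → (ℕ → ℤ) → ℕ → Set
  Shows (window a b c) u n = a ↦ P₁.γ (2 ℕ.+ n) R₁.* u × b ↦ P₁.γ (1 ℕ.+ n) R₁.* u × c ↦ P₁.γ n R₁.* u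

  sum-sound : ∀ {a b u v w} → a ↦ u R₁.* w → b ↦ v R₁.* w → a ⊹ b ↦ (u R₁.+ v) R₁.* w
  sum-sound {a} {b} {u} {v} {w} p q = R₁.trans (⊹-sound a b) (R₁.trans (R₁.+-cong p q) (R₁.sym (R₁.distribʳ w u v)))

  shift-sound : ∀ {a u w} → a ↦ u R₁.* w → 0 ∷ a ↦ shift u R₁.* w
  shift-sound {a} {u} {w} p = R₁.trans (0∷-sound a) (R₁.trans (R₁.*-congˡ {S₁.X} p) (R₁.sym (R₁.*-assoc S₁.X u w)))

  advance-sound : ∀ w {u n} → Shows w u n → Shows (advance w) u (suc n)
  advance-sound (window a b c) {u} {n} (p , q , r) =
    shift-sound {a ⊹ b ⊹ c} (sum-sound {a ⊹ b} {c} (sum-sound {a} {b} {P₁.γ (2 ℕ.+ n)} {P₁.γ (1 ℕ.+ n)} p q) r) , p , q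

  advanceBy-sound : ∀ k w {u n} → Shows w u n → Shows (advanceBy k w) u (k ℕ.+ n)
  advanceBy-sound zero    w s = s
  advanceBy-sound (suc k) w {u} {n} s = subst (Shows (advanceBy k (advance w)) u) (ℕₚ.+-suc k n) (advanceBy-sound k (advance w) (advance-sound w s))

  start-sound : ∀ {f u} → f ↦ u → ∀ n → Shows (advanceBy n (window f [] [])) u n
  start-sound {f} {u} p n = subst (Shows (advanceBy n (window f [] [])) u) (ℕₚ.+-identityʳ n)
    (advanceBy-sound n (window f [] []) (R₁.trans p (R₁.sym (R₁.*-identityˡ u)) , R₁.sym (R₁.zeroˡ u) , R₁.sym (R₁.zeroˡ u)))

  timesA-sound : ∀ w {u n} → Shows w u n → timesA w ↦ P₁.legA n R₁.* u
  timesA-sound w@(window a b c) {u} {n} s = sum-sound {0 ∷ (a ⊹ b ⊹ c)} {a} {P₁.γ (3 ℕ.+ n)} {P₁.γ (2 ℕ.+ n)} (proj₁ (advance-sound w {u} {n} s)) (proj₁ s)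

  timesE-sound : ∀ w {u n} → Shows w u n → timesE w ↦ P₁.legE n R₁.* u
  timesE-sound (window a b c) {u} {n} (p , q , r) = shift-sound {b ⊹ c} (sum-sound {b} {c} {P₁.γ (1 ℕ.+ n)} {P₁.γ n} q r)

  timesO-sound : ∀ w {u n} → Shows w u n → timesO w ↦ P₁.legO n R₁.* u
  timesO-sound (window a b c) {u} {n} (p , q , r) = shift-sound {a ⊹ b} (sum-sound {a} {b} {P₁.γ (2 ℕ.+ n)} {P₁.γ (1 ℕ.+ n)} p q)

  -- The two-element clause is the condition just above the degree, where the next coefficient is 0.
  -- The zeros put in front by `slow?` stand for the coefficients of negative index.
  slow-from : List ℕ → Bool
  slow-from (a ∷ b ∷ [])     = 4 ℕ.* b ℕ.≤ᵇ 3 ℕ.* a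
  slow-from (a ∷ b ∷ c ∷ as) = (4 ℕ.* b ℕ.≤ᵇ 2 ℕ.* c ℕ.+ 3 ℕ.* a) ∧ slow-from (b ∷ c ∷ as)
  slow-from _                = true

  slow? : List ℕ → Bool
  slow? as = slow-from (0 ∷ 0 ∷ as)

  slow-from-sound : ∀ a b as → T (slow-from (a ∷ b ∷ as)) → ∀ k → 4 ℕ.* nth (b ∷ as) k ℕ.≤ 2 ℕ.* nth as k ℕ.+ 3 ℕ.* nth (a ∷ b ∷ as) k
  slow-from-sound a b []       t zero    = ℕₚ.≤ᵇ⇒≤ (4 ℕ.* b) (3 ℕ.* a) t
  slow-from-sound a b []       t (suc k) = ℕ.z≤n
  slow-from-sound a b (c ∷ as) t zero    = ℕₚ.≤ᵇ⇒≤ (4 ℕ.* b) (2 ℕ.* c ℕ.+ 3 ℕ.* a) (proj₁ (Equivalence.to T-∧ t))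
  slow-from-sound a b (c ∷ as) t (suc k) = slow-from-sound b c as (proj₂ (Equivalence.to (T-∧ {4 ℕ.* b ℕ.≤ᵇ 2 ℕ.* c ℕ.+ 3 ℕ.* a}) t)) k

  slow-sound : ∀ as {u} → as ↦ u → T (slow? as) → Slow u
  slow-sound as {u} p t k = subst (0ℤ ≤_) rewriting (i≤j⇒0≤j-i (+≤+ (slow-from-sound 0 0 as t k)))
    where
    s₁ : ⟦ 0 ∷ as ⟧ k ≡ shift u k
    s₁ = 0∷ˢ {as} p k
    s₂ : ⟦ 0 ∷ 0 ∷ as ⟧ k ≡ shift (shift u) k
    s₂ = 0∷ˢ {0 ∷ as} (0∷ˢ {as} p) k
    rewriting : + (2 ℕ.* nth as k ℕ.+ 3 ℕ.* nth (0 ∷ 0 ∷ as) k) - + (4 ℕ.* nth (0 ∷ as) k)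
                ≡ + 2 * u k - + 4 * shift u k + + 3 * shift (shift u) k
    rewriting = trans (cong₂ _-_
        (trans (pos-+ (2 ℕ.* nth as k) _) (cong₂ _+_ (trans (pos-* 2 (nth as k)) (cong (+ 2 *_) (p k))) (trans (pos-* 3 (nth (0 ∷ 0 ∷ as) k)) (cong (+ 3 *_) s₂))))
        (trans (pos-* 4 (nth (0 ∷ as) k)) (cong (+ 4 *_) s₁)))
      (exchange (+ 2 * u k) (+ 3 * shift (shift u) k) (- (+ 4 * shift u k)))
      where
      exchange : ∀ a b c → a + b + c ≡ a + c + b
      exchange a b c = trans (+-assoc a b c) (trans (cong (λ z → a + z) (+-comm b c)) (sym (+-assoc a c b)))

  falling? rising? : List ℕ → Bool
  falling? (a ∷ b ∷ as) = (b ℕ.≤ᵇ a) ∧ falling? (b ∷ as)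
  falling? _            = true
  rising? (a ∷ b ∷ as)  = ((a ℕ.≤ᵇ b) ∧ rising? (b ∷ as)) ∨ falling? (a ∷ b ∷ as)
  rising? _             = true

  falling-sound : ∀ as → T (falling? as) → ∀ i → nth as (suc i) ℕ.≤ nth as i
  falling-sound []           t i       = ℕ.z≤n
  falling-sound (a ∷ [])     t i       = ℕ.z≤n
  falling-sound (a ∷ b ∷ as) t zero    = ℕₚ.≤ᵇ⇒≤ b a (proj₁ (Equivalence.to T-∧ t))
  falling-sound (a ∷ b ∷ as) t (suc i) = falling-sound (b ∷ as) (proj₂ (Equivalence.to (T-∧ {b ℕ.≤ᵇ a}) t)) i

  Peak : List ℕ → Set
  Peak as = ∃[ k ] (∀ i → i ℕ.< k → nth as i ℕ.≤ nth as (suc i)) × (∀ i → k ℕ.≤ i → nth as (suc i) ℕ.≤ nth as i)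

  falling-peak : ∀ as → T (falling? as) → Peak as
  falling-peak as t = 0 , (λ _ ()) , λ i _ → falling-sound as t i

  rising-peak : ∀ as → T (rising? as) → Peak as
  rising-peak []           t = falling-peak [] t
  rising-peak (a ∷ [])     t = falling-peak (a ∷ []) t
  rising-peak (a ∷ b ∷ as) t = [ (λ rise → let (p , q) = Equivalence.to (T-∧ {a ℕ.≤ᵇ b}) rise in extend (ℕₚ.≤ᵇ⇒≤ a b p) (rising-peak (b ∷ as) q))
                               , falling-peak (a ∷ b ∷ as) ]′ (Equivalence.to (T-∨ {(a ℕ.≤ᵇ b) ∧ rising? (b ∷ as)}) t)
    where
    extend : a ℕ.≤ b → Peak (b ∷ as) → Peak (a ∷ b ∷ as)
    extend a≤b (k , up , down) = suc k , (λ { zero _ → a≤b ; (suc i) (ℕ.s≤s i<k) → up i i<k }) , (λ { (suc i) (ℕ.s≤s k≤i) → down i k≤i })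

  rising-sound : ∀ as → T (rising? as) → ∀ n → UnimodalUpTo n ⟦ as ⟧
  rising-sound as t n = let (k , up , down) = rising-peak as t in k , (λ i i<k → +≤+ (up i i<k)) , (λ i k≤i _ → +≤+ (down i k≤i))

  -- Searches the sorted lists of legs from n to 16 on top of a spider with polynomials f, g and d (for F, G and gap),
  -- stopping at slow ones: slowness is inherited by supersets.
  explore  : (fuel c n : ℕ) (f g d : List ℕ) → Bool
  branches : (fuel c n : ℕ) (f g d : Window) → Bool
  explore zero       c n f g d = false
  explore (suc fuel) c n f g d = slow? f ∨ (rising? ((0 ∷ f) ⊹ d) ∧
    branches fuel c n (advanceBy n (window f [] [])) (advanceBy n (window g [] [])) (advanceBy n (window d [] [])))
  -- In the search n is 17 here: any further leg has at least 18 vertices and makes the spider slow.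
  branches fuel zero    n f g d = true
  branches fuel (suc c) n f g d = explore fuel (suc c) n (timesA f) (timesE g ⊹ timesO g) (timesE d ⊹ timesO g)
    ∧ branches fuel c (suc n) (advance f) (advance g) (advance d)

  Slow-resp : ∀ {u v} → u R₁.≈ v → Slow u → Slow v
  Slow-resp {u} {v} p s k = subst (0ℤ ≤_)
    (cong₂ _+_ (cong₂ (λ a b → + 2 * a - + 4 * b) (p k) (R₁.*-congˡ {S₁.X} p k)) (cong (+ 3 *_) (R₁.*-congˡ {S₁.X} (R₁.*-congˡ {S₁.X} p) k))) (s k)

  -- Slowness of u is non-negativity of (2 - 4 x + 3 x²) u, hence it is additive and survives
  -- multiplication by non-negative series.
  weight : ℕ → ℤ
  weight = S₁.C (+ 2) R₁.- S₁.C (+ 4) R₁.* S₁.X R₁.+ S₁.C (+ 3) R₁.* (S₁.X R₁.* S₁.X)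

  module _ where
    open IntSolver ℤ⟦x⟧ ι₁

    weigh : ∀ u k → (weight R₁.* u) k ≡ + 2 * u k - + 4 * shift u k + + 3 * shift (shift u) k
    weigh u k = trans
      (solve 2 (λ x u → (con (+ 2) :- con (+ 4) :* x :+ con (+ 3) :* (x :* x)) :* u
          := con (+ 2) :* u :- con (+ 4) :* (x :* u) :+ con (+ 3) :* (x :* (x :* u))) R₁.refl S₁.X u k)
      (cong₂ _+_ (cong₂ _-_ (S₁.C-⊛ (+ 2) u k) (S₁.C-⊛ (+ 4) (shift u) k)) (S₁.C-⊛ (+ 3) (shift (shift u)) k))

    slow-multiple : ∀ v u → NonNeg v → Slow u → Slow (v R₁.* u)
    slow-multiple v u p s k = subst (0ℤ ≤_)
      (trans (solve 3 (λ w v u → v :* (w :* u) := w :* (v :* u)) R₁.refl weight v u k) (weigh (v R₁.* u) k))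
      ((p ⟨*⟩ λ j → subst (0ℤ ≤_) (sym (weigh u j)) (s j)) k)

    slow-sum : ∀ u v → Slow u → Slow v → Slow (u R₁.+ v)
    slow-sum u v s t k = subst (0ℤ ≤_)
      (trans (sym (cong₂ _+_ (weigh u k) (weigh v k))) (trans (sym (R₁.distribˡ weight u v k)) (weigh (u R₁.+ v) k)))
      (0≤-+ (s k) (t k))

    -- A inherits the recurrence of γ, being a sum of two of its terms.
    slow-recurrence : ∀ n → Slow (P₁.legA n) → Slow (P₁.legA (1 ℕ.+ n)) → Slow (P₁.legA (2 ℕ.+ n)) → Slow (P₁.legA (3 ℕ.+ n))
    slow-recurrence n s₀ s₁ s₂ = Slow-resp
      (solve 5 (λ x p q r s → x :* ((p :+ q) :+ (q :+ r) :+ (r :+ s)) := x :* (p :+ q :+ r) :+ x :* (q :+ r :+ s)) R₁.refl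
        S₁.X (P₁.γ (5 ℕ.+ n)) (P₁.γ (4 ℕ.+ n)) (P₁.γ (3 ℕ.+ n)) (P₁.γ (2 ℕ.+ n)))
      (slow-multiple S₁.X (P₁.legA (2 ℕ.+ n) R₁.+ P₁.legA (1 ℕ.+ n) R₁.+ P₁.legA n) nonNeg-X
        (slow-sum (P₁.legA (2 ℕ.+ n) R₁.+ P₁.legA (1 ℕ.+ n)) (P₁.legA n) (slow-sum (P₁.legA (2 ℕ.+ n)) (P₁.legA (1 ℕ.+ n)) s₂ s₁) s₀))

  1↦ : 1 ∷ [] ↦ R₁.1#
  1↦ zero    = refl
  1↦ (suc n) = refl

  slow-long : ∀ n → Slow (P₁.legA (17 ℕ.+ n))
  slow-long n = proj₁ (three n)
    where
    base : ∀ n → T (slow? (timesA (advanceBy n (window (1 ∷ []) [] [])))) → Slow (P₁.legA n)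
    base n t = Slow-resp (R₁.*-identityʳ (P₁.legA n))
      (slow-sound (timesA (advanceBy n (window (1 ∷ []) [] [])))
        (timesA-sound (advanceBy n (window (1 ∷ []) [] [])) {R₁.1#} {n} (start-sound {1 ∷ []} 1↦ n)) t)
    three : ∀ n → Slow (P₁.legA (17 ℕ.+ n)) × Slow (P₁.legA (18 ℕ.+ n)) × Slow (P₁.legA (19 ℕ.+ n))
    -- The recurrence reaches back three terms, hence three evaluated cases; index 17 is the leg on
    -- 18 vertices.
    three zero    = base 17 tt , base 18 tt , base 19 tt
    three (suc n) = let (s₀ , s₁ , s₂) = three n in s₁ , s₂ , slow-recurrence (17 ℕ.+ n) s₀ s₁ s₂

  slow-extend : ∀ ns ms → Slow (F ms) → Slow (F (ns ʳ++ ms))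
  slow-extend []       ms s = s
  slow-extend (n ∷ ns) ms s = slow-extend ns (n ∷ ms) (slow-multiple (P₁.legA n) (F ms) (legA-nonNeg n) s)

  Settled : List ℕ → Set
  Settled ns = Slow (F ns) ⊎ (∀ n → UnimodalUpTo n (counts ns))

  Ascending : ℕ → List ℕ → Set
  Ascending n []       = ⊤
  Ascending n (m ∷ ms) = n ℕ.≤ m × Ascending m ms

  slow-attach : ∀ m ms → 17 ℕ.≤ m → Slow (F (m ∷ ms))
  slow-attach m ms 17≤m = Slow-resp (R₁.*-comm (F ms) (P₁.legA m))
    (slow-multiple (F ms) (P₁.legA m) (F-nonNeg ms) (subst (λ n → Slow (P₁.legA n)) (ℕₚ.m+[n∸m]≡n 17≤m) (slow-long (m ℕ.∸ 17))))

  explore-sound : ∀ fuel c n ms {f g d} → T (explore fuel c n f g d) → c ℕ.+ n ≡ 17 →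
    f ↦ F ms → g ↦ G ms → d ↦ gap ms → ∀ ns → Ascending n ns → Settled (ns ʳ++ ms)
  branches-sound : ∀ fuel c n ms {f g d} → T (branches fuel c n f g d) → c ℕ.+ n ≡ 17 →
    Shows f (F ms) n → Shows g (G ms) n → Shows d (gap ms) n → ∀ m ns → n ℕ.≤ m → Ascending m ns → Settled (ns ʳ++ (m ∷ ms))
  explore-sound (suc fuel) c n ms {f} {g} {d} t eq f↦ g↦ d↦ ns asc =
    [ (λ s → inj₁ (slow-extend ns ms (slow-sound f f↦ s)))
    , (λ r → let (up , rest) = Equivalence.to (T-∧ {rising? ((0 ∷ f) ⊹ d)}) r in further up rest ns asc) ]′
    (Equivalence.to (T-∨ {slow? f}) t)
    where
    further : T (rising? ((0 ∷ f) ⊹ d)) →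
      T (branches fuel c n (advanceBy n (window f [] [])) (advanceBy n (window g [] [])) (advanceBy n (window d [] []))) →
      ∀ ns → Ascending n ns → Settled (ns ʳ++ ms)
    further up rest []       _           = inj₂ λ k → UnimodalUpTo-resp
      (λ i → trans (⊹-sound (0 ∷ f) d i) (cong₂ _+_ (R₁.trans (0∷-sound f) (R₁.*-congˡ {S₁.X} f↦) i) (d↦ i)))
      (rising-sound ((0 ∷ f) ⊹ d) up k)
    further up rest (m ∷ ns) (n≤m , asc) = branches-sound fuel c n ms rest eq
      (start-sound {f} f↦ n) (start-sound {g} g↦ n) (start-sound {d} d↦ n) m ns n≤m asc
  branches-sound fuel zero    n ms t refl _ _ _ m ns 17≤m asc = inj₁ (slow-extend ns (m ∷ ms) (slow-attach m ms 17≤m))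
  branches-sound fuel (suc c) n ms {f} {g} {d} t eq f↦ g↦ d↦ m ns n≤m asc with ℕₚ.m≤n⇒m<n∨m≡n n≤m
  ... | inj₂ refl = explore-sound fuel (suc c) n (n ∷ ms) (proj₁ (Equivalence.to T-∧ t)) eq
    (timesA-sound f {F ms} {n} f↦)
    (R₁.trans (sum-sound {timesE g} {timesO g} {P₁.legE n} {P₁.legO n} (timesE-sound g {G ms} {n} g↦) (timesO-sound g {G ms} {n} g↦)) (R₁.*-comm (P₁.legE n R₁.+ P₁.legO n) (G ms)))
    (R₁.trans (⊹-sound (timesE d) (timesO g)) (R₁.+-cong
      (R₁.trans (timesE-sound d {gap ms} {n} d↦) (R₁.*-comm (P₁.legE n) (gap ms))) (R₁.trans (timesO-sound g {G ms} {n} g↦) (R₁.*-comm (P₁.legO n) (G ms)))))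
    ns asc
  ... | inj₁ n<m = branches-sound fuel c (suc n) ms (proj₂ (Equivalence.to (T-∧ {explore fuel (suc c) n (timesA f) (timesE g ⊹ timesO g) (timesE d ⊹ timesO g)}) t))
    (trans (ℕₚ.+-suc c n) eq) (advance-sound f {F ms} {n} f↦) (advance-sound g {G ms} {n} g↦) (advance-sound d {gap ms} {n} d↦) m ns n<m asc

  -- Here the search is evaluated. Exhausted fuel counts as failure, so success with fuel 12 also
  -- shows that a spider which is not slow has at most ten legs. The order is reversed because each
  -- new leg is put in front.
  ascending-settled : ∀ ns → Ascending 0 ns → Settled (reverse ns)
  ascending-settled = explore-sound 12 17 0 [] {1 ∷ []} {1 ∷ []} {[]} tt refl 1↦ 1↦ (λ _ → refl)

  F-↭ : ∀ {ms ns} → ms ↭ ns → F ms R₁.≈ F ns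
  F-↭ ↭.refl = R₁.refl
  F-↭ (prep n p) = R₁.*-congˡ {P₁.legA n} (F-↭ p)
  F-↭ {_} {_ ∷ _ ∷ ns} (swap m n p) = R₁.trans (R₁.*-congˡ {P₁.legA m} (R₁.*-congˡ {P₁.legA n} (F-↭ p)))
    (x∙yz≈y∙xz (P₁.legA m) (P₁.legA n) (F ns))
  F-↭ (↭.trans p q) = R₁.trans (F-↭ p) (F-↭ q)

  G-↭ : ∀ {ms ns} → ms ↭ ns → G ms R₁.≈ G ns
  G-↭ ↭.refl = R₁.refl
  G-↭ (prep n p) = R₁.*-congʳ {P₁.legE n R₁.+ P₁.legO n} (G-↭ p)
  G-↭ {_} {_ ∷ _ ∷ ns} (swap m n p) = R₁.trans (R₁.*-congʳ {P₁.legE m R₁.+ P₁.legO m} (R₁.*-congʳ {P₁.legE n R₁.+ P₁.legO n} (G-↭ p)))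
    (xy∙z≈xz∙y (G ns) (P₁.legE n R₁.+ P₁.legO n) (P₁.legE m R₁.+ P₁.legO m))
  G-↭ (↭.trans p q) = R₁.trans (G-↭ p) (G-↭ q)

  H-↭ : ∀ {ms ns} → ms ↭ ns → H ms R₁.≈ H ns
  H-↭ ↭.refl = R₁.refl
  H-↭ (prep n p) = R₁.*-congʳ {P₁.legE n} (H-↭ p)
  H-↭ {_} {_ ∷ _ ∷ ns} (swap m n p) = R₁.trans (R₁.*-congʳ {P₁.legE m} (R₁.*-congʳ {P₁.legE n} (H-↭ p)))
    (xy∙z≈xz∙y (H ns) (P₁.legE n) (P₁.legE m))
  H-↭ (↭.trans p q) = R₁.trans (H-↭ p) (H-↭ q)

  -- `gap` is not a product, but G and H are, and it is their difference.
  gap-↭ : ∀ {ms ns} → ms ↭ ns → gap ms R₁.≈ gap ns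
  gap-↭ {ms} {ns} p k = ∙-cancelʳ (H ns k) (gap ms k) (gap ns k) (trans (cong (λ c → gap ms k + c) (sym (H-↭ p k)))
    (trans (sym (G-split ms k)) (trans (G-↭ p k) (G-split ns k))))

  spider-unimodal : ∀ ns n → UnimodalUpTo n (counts ns)
  spider-unimodal ns n = conclude (ascending-settled (sort ns) (ascend (sort ns) (sort-↗ ns)))
    where
    ascend-from : ∀ m ms → Linked ℕ._≤_ (m ∷ ms) → Ascending m ms
    ascend-from m []        _       = tt
    ascend-from m (m′ ∷ ms) (p ∷ l) = p , ascend-from m′ ms l
    ascend : ∀ ms → Linked ℕ._≤_ ms → Ascending 0 ms
    ascend []       _ = tt
    ascend (m ∷ ms) l = ℕ.z≤n , ascend-from m ms l
    perm : reverse (sort ns) ↭ ns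
    perm = ↭.trans (↭-reverse (sort ns)) (sort-↭ ns)
    conclude : Settled (reverse (sort ns)) → UnimodalUpTo n (counts ns)
    conclude (inj₁ s) = slow-unimodal ns (Slow-resp (F-↭ perm) s) n
    conclude (inj₂ u) = UnimodalUpTo-resp (λ k → cong₂ _+_ (R₁.*-congˡ {S₁.X} (F-↭ perm) k) (gap-↭ perm k)) (u n)

-- Domination in a spider as a condition on each leg.

module DominatingSubsets where
  open import Defs
  open import Data.Nat.Base
  open import Data.Nat.Properties
  open import Data.Bool.Base using (Bool; true; false; _∧_; _∨_; T)
  open import Data.Bool.Properties using (T-∧; T-∨)
  open import Data.Fin.Base as Fin using (Fin; toℕ; fromℕ<)
  open import Data.Fin.Properties using (toℕ<n; toℕ-fromℕ<)
  open import Data.Vec.Base as Vec using (Vec; []; _∷_; lookup; toList; tabulate)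
  open import Data.List.Base using (List; []; _∷_)
  open import Data.Nat.ListAction using (sum)
  open import Data.Bool.ListAction using (any; all)
  open import Data.Product.Base using (_×_; _,_; proj₁; proj₂; ∃-syntax)
  open import Data.Sum.Base using (_⊎_; inj₁; inj₂; [_,_]′)
  open import Data.Empty using (⊥-elim)
  open import Data.Unit.Base using (tt)
  open import Function.Base using (_∘_; id)
  open import Function.Bundles using (Equivalence; _⇔_; mk⇔)
  open import Relation.Nullary.Decidable using (yes; no)
  open import Relation.Binary.PropositionalEquality
  open Equivalence using (to; from)

  at : ∀ {n} → Vec Bool n → ℕ → Bool
  at []       i       = false
  at (b ∷ bs) zero    = b
  at (b ∷ bs) (suc i) = at bs i

  front : ∀ l {m} → Vec Bool (l + m) → Vec Bool l
  front zero    bs       = []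
  front (suc l) (b ∷ bs) = b ∷ front l bs

  back : ∀ l {m} → Vec Bool (l + m) → Vec Bool m
  back zero    bs       = bs
  back (suc l) (b ∷ bs) = back l bs

  at-front : ∀ l {m} (bs : Vec Bool (l + m)) i → i < l → at (front l bs) i ≡ at bs i
  at-front (suc l) (b ∷ bs) zero    _       = refl
  at-front (suc l) (b ∷ bs) (suc i) (s≤s p) = at-front l bs i p

  at-back : ∀ l {m} (bs : Vec Bool (l + m)) i → at (back l bs) i ≡ at bs (l + i)
  at-back zero    bs       i = refl
  at-back (suc l) (b ∷ bs) i = at-back l bs i

  at-< : ∀ {n} (bs : Vec Bool n) i → T (at bs i) → i < n
  at-< (b ∷ bs) zero    t = s≤s z≤n
  at-< (b ∷ bs) (suc i) t = s≤s (at-< bs i t)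

  -- The flag records whether the preceding vertex is chosen: the centre for the first vertex,
  -- afterwards the previous vertex of the leg.
  pathOK : Bool → ∀ {l} → Vec Bool l → Bool
  pathOK p []       = true
  pathOK p (b ∷ bs) = (b ∨ p ∨ at bs 0) ∧ pathOK b bs

  legsOK : Bool → (ls : List ℕ) → Vec Bool (sum ls) → Bool
  legsOK c []       bs = true
  legsOK c (l ∷ ls) bs = pathOK c (front l bs) ∧ legsOK c ls (back l bs)

  endpoints : (ls : List ℕ) → Vec Bool (sum ls) → Bool
  endpoints []       bs = false
  endpoints (l ∷ ls) bs = at (front l bs) 0 ∨ endpoints ls (back l bs)

  spiderOK : (ls : List ℕ) → Vec Bool (spiderSize ls) → Bool
  spiderOK ls (c ∷ bs) = (c ∨ endpoints ls bs) ∧ legsOK c ls bs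

  -- The edge test as an inductive family, so that case analysis fixes the labels. Edges point away
  -- from the centre, and domination has to consult both directions.
  data Edge : List ℕ → ℕ → ℕ → ℕ → Set where
    centre : ∀ {l ls o} → 0 < l → Edge (l ∷ ls) o 0 o
    path   : ∀ {l ls o u} → o ≤ u → suc u < o + l → Edge (l ∷ ls) o u (suc u)
    later  : ∀ {l ls o u v} → Edge ls (o + l) u v → Edge (l ∷ ls) o u v

  edge⇒ : ∀ ls o u v → T (spiderEdgeℕ ls o u v) → Edge ls o u v
  edge⇒ (l ∷ ls) o u v t with to (T-∨ {(0 <ᵇ l) ∧ (u ≡ᵇ 0) ∧ (v ≡ᵇ o)}) t
  ... | inj₁ c = let (0<l , c′) = to (T-∧ {0 <ᵇ l}) c ; (u≡0 , v≡o) = to (T-∧ {u ≡ᵇ 0}) c′ in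
    subst₂ (Edge (l ∷ ls) o) (sym (≡ᵇ⇒≡ u 0 u≡0)) (sym (≡ᵇ⇒≡ v o v≡o)) (centre (<ᵇ⇒< 0 l 0<l))
  ... | inj₂ t′ with to (T-∨ {((o ≤ᵇ u) ∧ (u <ᵇ o + l)) ∧ ((o ≤ᵇ v) ∧ (v <ᵇ o + l)) ∧ (v ≡ᵇ suc u)}) t′
  ...   | inj₂ r = later (edge⇒ ls (o + l) u v r)
  ...   | inj₁ p = let (inu , p′) = to (T-∧ {(o ≤ᵇ u) ∧ (u <ᵇ o + l)}) p
                       (inv , v≡) = to (T-∧ {(o ≤ᵇ v) ∧ (v <ᵇ o + l)}) p′
                       v≡1+u = ≡ᵇ⇒≡ v (suc u) v≡ in
    subst (Edge (l ∷ ls) o u) (sym v≡1+u) (path (≤ᵇ⇒≤ o u (proj₁ (to (T-∧ {o ≤ᵇ u}) inu)))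
      (subst (_< o + l) v≡1+u (<ᵇ⇒< v (o + l) (proj₂ (to (T-∧ {o ≤ᵇ v}) inv)))))

  ⇒edge : ∀ {ls o u v} → Edge ls o u v → T (spiderEdgeℕ ls o u v)
  ⇒edge {l ∷ ls} {o} (centre 0<l) = from (T-∨ {(0 <ᵇ l) ∧ (o ≡ᵇ o)}) (inj₁ (from (T-∧ {0 <ᵇ l}) (<⇒<ᵇ 0<l , ≡⇒≡ᵇ o o refl)))
  ⇒edge {l ∷ ls} {o} {u} (path o≤u u<) = from (T-∨ {(0 <ᵇ l) ∧ (u ≡ᵇ 0) ∧ (suc u ≡ᵇ o)}) (inj₂ (from (T-∨ {((o ≤ᵇ u) ∧ (u <ᵇ o + l)) ∧ ((o ≤ᵇ suc u) ∧ (suc u <ᵇ o + l)) ∧ (u ≡ᵇ u)}) (inj₁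
    (from (T-∧ {(o ≤ᵇ u) ∧ (u <ᵇ o + l)})
      (from (T-∧ {o ≤ᵇ u}) (≤⇒≤ᵇ o≤u , <⇒<ᵇ (<-trans (n<1+n u) u<)) , from (T-∧ {(o ≤ᵇ suc u) ∧ (suc u <ᵇ o + l)})
        (from (T-∧ {o ≤ᵇ suc u}) (≤⇒≤ᵇ (m≤n⇒m≤1+n o≤u) , <⇒<ᵇ u<) , ≡⇒≡ᵇ u u refl))))))
  ⇒edge {l ∷ ls} {o} {u} {v} (later e) = from (T-∨ {(0 <ᵇ l) ∧ (u ≡ᵇ 0) ∧ (v ≡ᵇ o)}) (inj₂
    (from (T-∨ {((o ≤ᵇ u) ∧ (u <ᵇ o + l)) ∧ ((o ≤ᵇ v) ∧ (v <ᵇ o + l)) ∧ (v ≡ᵇ suc u)}) (inj₂ (⇒edge e))))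

  target-≥ : ∀ {ls o u v} → Edge ls o u v → o ≤ v
  target-≥ (centre _)          = ≤-refl
  target-≥ (path o≤u _)        = m≤n⇒m≤1+n o≤u
  target-≥ {l ∷ _} {o} (later e) = ≤-trans (m≤m+n o l) (target-≥ e)

  source-≥ : ∀ {ls o u v} → Edge ls o u v → 0 < u → o ≤ u
  source-≥ (path o≤u _)        _   = o≤u
  source-≥ {l ∷ _} {o} (later e) 0<u = ≤-trans (m≤m+n o l) (source-≥ e 0<u)

  module _ (μ : ℕ → Bool) where
    Dominated : (ls : List ℕ) (o k : ℕ) → Set
    Dominated ls o k = T (μ k) ⊎ ∃[ j ] T (μ j) × (Edge ls o k j ⊎ Edge ls o j k)

    -- Membership is kept as a function of global labels while the legs are split off as vectors;
    -- this ties the two descriptions together at offset o.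
    Matches : ∀ {m} → ℕ → Vec Bool m → Set
    Matches {m} o bs = ∀ i → i < m → μ (o + i) ≡ at bs i

    LegsDominated : List ℕ → ℕ → Set
    LegsDominated ls o = ∀ k → o ≤ k → k < o + sum ls → Dominated ls o k

    matches-front : ∀ o l {m} (bs : Vec Bool (l + m)) → Matches o bs → Matches o (front l bs)
    matches-front o l bs M i i<l = trans (M i (<-≤-trans i<l (m≤m+n l _))) (sym (at-front l bs i i<l))

    matches-back : ∀ o l {m} (bs : Vec Bool (l + m)) → Matches o bs → Matches (o + l) (back l bs)
    matches-back o l bs M i i<m = trans (cong μ (+-assoc o l i)) (trans (M (l + i) (+-monoʳ-< l i<m)) (sym (at-back l bs i)))

    at⇒μ : ∀ {m} {o} (bs : Vec Bool m) → Matches o bs → ∀ i → T (at bs i) → T (μ (o + i))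
    at⇒μ bs M i t = subst T (sym (M i (at-< bs i t))) t

    Local : Bool → ∀ {l} → Vec Bool l → ℕ → Set
    Local p bs i = T (at bs i ∨ at (p ∷ bs) i ∨ at bs (suc i))

    pathOK⇔ : ∀ p {l} (bs : Vec Bool l) → T (pathOK p bs) ⇔ (∀ i → i < l → Local p bs i)
    pathOK⇔ p bs = mk⇔ (there p bs) (back′ p bs)
      where
      there : ∀ p {l} (bs : Vec Bool l) → T (pathOK p bs) → ∀ i → i < l → Local p bs i
      there p (b ∷ bs) t zero    _         = proj₁ (to (T-∧ {b ∨ p ∨ at bs 0}) t)
      there p (b ∷ bs) t (suc i) (s≤s i<l) = there b bs (proj₂ (to (T-∧ {b ∨ p ∨ at bs 0}) t)) i i<l
      back′ : ∀ p {l} (bs : Vec Bool l) → (∀ i → i < l → Local p bs i) → T (pathOK p bs)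
      back′ p []       f = tt
      back′ p (b ∷ bs) f = from (T-∧ {b ∨ p ∨ at bs 0}) (f 0 (s≤s z≤n) , back′ b bs (λ i i<l → f (suc i) (s≤s i<l)))

    local⇒dominated : ∀ {l ls o} (bs : Vec Bool l) → Matches o bs → ∀ i → i < l → Local (μ 0) bs i → Dominated (l ∷ ls) o (o + i)
    local⇒dominated {l} {ls} {o} bs M i i<l t with to (T-∨ {at bs i}) t
    ... | inj₁ here = inj₁ (at⇒μ bs M i here)
    ... | inj₂ t′ with to (T-∨ {at (μ 0 ∷ bs) i}) t′
    ...   | inj₂ next = inj₂ (suc (o + i) , subst (T ∘ μ) (+-suc o i) (at⇒μ bs M (suc i) next) ,
              inj₁ (path (m≤m+n o i) (subst (_< o + l) (+-suc o i) (+-monoʳ-< o (at-< bs (suc i) next)))))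
    local⇒dominated {l} {ls} {o} bs M zero    i<l t | inj₂ t′ | inj₁ prev =
      inj₂ (0 , prev , inj₂ (subst (Edge (l ∷ ls) o 0) (sym (+-identityʳ o)) (centre i<l)))
    local⇒dominated {l} {ls} {o} bs M (suc i) i<l t | inj₂ t′ | inj₁ prev =
      inj₂ (o + i , at⇒μ bs M i prev , inj₂ (subst (Edge (l ∷ ls) o (o + i)) (sym (+-suc o i))
        (path (m≤m+n o i) (subst (_< o + l) (+-suc o i) (+-monoʳ-< o i<l)))))

    -- A neighbour inside the leg is adjacent in the vector. Edges of later legs end beyond the leg,
    -- and start there or at the centre, whose label 0 lies outside the leg by 0 < o.
    dominated⇒local : ∀ {l ls o} → 0 < o → (bs : Vec Bool l) → Matches o bs → ∀ i → i < l → Dominated (l ∷ ls) o (o + i) → Local (μ 0) bs i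
    dominated⇒local {l} {ls} {o} 0<o bs M i i<l (inj₁ t) = from (T-∨ {at bs i}) (inj₁ (subst T (M i i<l) t))
    dominated⇒local {l} {ls} {o} 0<o bs M i i<l (inj₂ (j , t , inj₁ e)) = from (T-∨ {at bs i}) (inj₂ (from (T-∨ {at (μ 0 ∷ bs) i}) (inj₂ (out e refl t))))
      where
      out : ∀ {k j′} → Edge (l ∷ ls) o k j′ → k ≡ o + i → T (μ j′) → T (at bs (suc i))
      out (centre _) eq t = ⊥-elim (<⇒≢ (<-≤-trans 0<o (m≤m+n o i)) eq)
      out (path _ u<) refl t = subst T (M (suc i) 1+i<l) (subst (T ∘ μ) (sym (+-suc o i)) t)
        where
        1+i<l : suc i < l
        1+i<l = +-cancelˡ-< o (suc i) l (subst (_< o + l) (sym (+-suc o i)) u<)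
      out (later e) refl t = ⊥-elim (<⇒≱ (+-monoʳ-< o i<l) (source-≥ e (<-≤-trans 0<o (m≤m+n o i))))
    dominated⇒local {l} {ls} {o} 0<o bs M i i<l (inj₂ (j , t , inj₂ e)) = from (T-∨ {at bs i}) (inj₂ (from (T-∨ {at (μ 0 ∷ bs) i}) (inj₁ (into e refl t))))
      where
      into : ∀ {j k} → Edge (l ∷ ls) o j k → k ≡ o + i → T (μ j) → T (at (μ 0 ∷ bs) i)
      into (centre _) eq t = subst (T ∘ at (μ 0 ∷ bs)) (+-cancelˡ-≡ o 0 i (trans (+-identityʳ o) eq)) t
      into {j} (path o≤j _) eq t = subst (T ∘ at (μ 0 ∷ bs)) 1+d≡i (subst T (M d d<l) (subst (T ∘ μ) (sym (m+[n∸m]≡n o≤j)) t))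
        where
        d : ℕ
        d = j ∸ o
        1+d≡i : suc d ≡ i
        1+d≡i = +-cancelˡ-≡ o (suc d) i (trans (+-suc o d) (trans (cong suc (m+[n∸m]≡n o≤j)) eq))
        d<l : d < l
        d<l = <-trans (subst (d <_) 1+d≡i (n<1+n d)) i<l
      into (later e) refl t = ⊥-elim (<⇒≱ (+-monoʳ-< o i<l) (target-≥ e))

    dominated-later : ∀ {l ls o k} → Dominated ls (o + l) k → Dominated (l ∷ ls) o k
    dominated-later (inj₁ t) = inj₁ t
    dominated-later (inj₂ (j , t , inj₁ e)) = inj₂ (j , t , inj₁ (later e))
    dominated-later (inj₂ (j , t , inj₂ e)) = inj₂ (j , t , inj₂ (later e))

    dominated-beyond : ∀ {l ls o k} → 0 < o → o + l ≤ k → Dominated (l ∷ ls) o k → Dominated ls (o + l) k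
    dominated-beyond 0<o far (inj₁ t) = inj₁ t
    dominated-beyond {l} {ls} {o} 0<o far (inj₂ (j , t , inj₁ e)) = inj₂ (j , t , inj₁ (out e far))
      where
      out : ∀ {k j} → Edge (l ∷ ls) o k j → o + l ≤ k → Edge ls (o + l) k j
      out (centre _)  far = ⊥-elim (<⇒≱ (<-≤-trans 0<o (m≤m+n o l)) far)
      out (path _ u<) far = ⊥-elim (<⇒≱ (<-trans (n<1+n _) u<) far)
      out (later e)   far = e
    dominated-beyond {l} {ls} {o} 0<o far (inj₂ (j , t , inj₂ e)) = inj₂ (j , t , inj₂ (into e far))
      where
      into : ∀ {j k} → Edge (l ∷ ls) o j k → o + l ≤ k → Edge ls (o + l) j k
      into (centre 0<l) far = ⊥-elim (<⇒≱ (m<m+n o 0<l) far)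
      into (path _ u<)  far = ⊥-elim (<⇒≱ u< far)
      into (later e)    far = e

    legsOK⇔ : ∀ ls o (bs : Vec Bool (sum ls)) → 0 < o → Matches o bs → T (legsOK (μ 0) ls bs) ⇔ LegsDominated ls o
    legsOK⇔ [] o bs 0<o M = mk⇔ (λ _ k o≤k k< → ⊥-elim (<⇒≱ (subst (k <_) (+-identityʳ o) k<) o≤k)) (λ _ → tt)
    legsOK⇔ (l ∷ ls) o bs 0<o M = mk⇔ there back′
      where
      ih : T (legsOK (μ 0) ls (back l bs)) ⇔ LegsDominated ls (o + l)
      ih = legsOK⇔ ls (o + l) (back l bs) (<-≤-trans 0<o (m≤m+n o l)) (matches-back o l bs M)
      there : T (legsOK (μ 0) (l ∷ ls) bs) → LegsDominated (l ∷ ls) o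
      there t k o≤k k< with k <? o + l
      ... | no far  = dominated-later (to ih (proj₂ (to (T-∧ {pathOK (μ 0) (front l bs)}) t)) k (≮⇒≥ far)
                        (subst (k <_) (sym (+-assoc o l (sum ls))) k<))
      ... | yes near = subst (Dominated (l ∷ ls) o) (m+[n∸m]≡n o≤k) (local⇒dominated (front l bs) (matches-front o l bs M) (k ∸ o) i<l
                        (to (pathOK⇔ (μ 0) (front l bs)) (proj₁ (to (T-∧ {pathOK (μ 0) (front l bs)}) t)) (k ∸ o) i<l))
        where
        i<l : k ∸ o < l
        i<l = +-cancelˡ-< o (k ∸ o) l (subst (_< o + l) (sym (m+[n∸m]≡n o≤k)) near)
      back′ : LegsDominated (l ∷ ls) o → T (legsOK (μ 0) (l ∷ ls) bs)
      back′ f = from (T-∧ {pathOK (μ 0) (front l bs)})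
        ( from (pathOK⇔ (μ 0) (front l bs)) (λ i i<l → dominated⇒local 0<o (front l bs) (matches-front o l bs M) i i<l
            (f (o + i) (m≤m+n o i) (+-monoʳ-< o (<-≤-trans i<l (m≤m+n l (sum ls))))))
        , from ih (λ k o+l≤k k< → dominated-beyond 0<o o+l≤k (f k (≤-trans (m≤m+n o l) o+l≤k) (subst (k <_) (+-assoc o l (sum ls)) k<))) )

    endpoints⇔ : ∀ ls o (bs : Vec Bool (sum ls)) → 0 < o → Matches o bs → T (endpoints ls bs) ⇔ (∃[ j ] T (μ j) × Edge ls o 0 j)
    endpoints⇔ [] o bs 0<o M = mk⇔ (λ ()) (λ { (_ , _ , ()) })
    endpoints⇔ (l ∷ ls) o bs 0<o M = mk⇔
      (λ t → [ (λ first → o , subst (T ∘ μ) (+-identityʳ o) (at⇒μ (front l bs) (matches-front o l bs M) 0 first) , centre (at-< (front l bs) 0 first))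
             , (λ rest → let (j , t , e) = to ih rest in j , t , later e) ]′ (to (T-∨ {at (front l bs) 0}) t))
      (λ { (j , t , centre 0<l) → from (T-∨ {at (front l bs) 0}) (inj₁ (subst T (matches-front o l bs M 0 0<l) (subst (T ∘ μ) (sym (+-identityʳ o)) t)))
         ; (j , t , later e)    → from (T-∨ {at (front l bs) 0}) (inj₂ (from ih (j , t , e)))
         ; (_ , _ , path o≤0 _) → ⊥-elim (<⇒≱ 0<o o≤0) })
      where
      ih : T (endpoints ls (back l bs)) ⇔ (∃[ j ] T (μ j) × Edge ls (o + l) 0 j)
      ih = endpoints⇔ ls (o + l) (back l bs) (<-≤-trans 0<o (m≤m+n o l)) (matches-back o l bs M)

  all-tabulate : ∀ {A : Set} {n} (p : A → Bool) (f : Fin n → A) → T (all p (toList (tabulate f))) ⇔ (∀ i → T (p (f i)))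
  all-tabulate {n = zero}  p f = mk⇔ (λ _ ()) (λ _ → tt)
  all-tabulate {n = suc n} p f = mk⇔
    (λ t → λ { Fin.zero → proj₁ (to (T-∧ {p (f Fin.zero)}) t) ; (Fin.suc i) → to (all-tabulate p (f ∘ Fin.suc)) (proj₂ (to (T-∧ {p (f Fin.zero)}) t)) i })
    (λ h → from (T-∧ {p (f Fin.zero)}) (h Fin.zero , from (all-tabulate p (f ∘ Fin.suc)) (h ∘ Fin.suc)))

  any-tabulate : ∀ {A : Set} {n} (p : A → Bool) (f : Fin n → A) → T (any p (toList (tabulate f))) ⇔ (∃[ i ] T (p (f i)))
  any-tabulate {n = zero}  p f = mk⇔ (λ ()) (λ ())
  any-tabulate {n = suc n} p f = mk⇔
    (λ t → [ (λ h → Fin.zero , h) , (λ h → let (i , r) = to (any-tabulate p (f ∘ Fin.suc)) h in Fin.suc i , r) ]′ (to (T-∨ {p (f Fin.zero)}) t))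
    (λ { (Fin.zero , h) → from (T-∨ {p (f Fin.zero)}) (inj₁ h)
       ; (Fin.suc i , h) → from (T-∨ {p (f Fin.zero)}) (inj₂ (from (any-tabulate p (f ∘ Fin.suc)) (i , h))) })

  lookup-at : ∀ {n} (bs : Vec Bool n) v → lookup bs v ≡ at bs (toℕ v)
  lookup-at (b ∷ bs) Fin.zero    = refl
  lookup-at (b ∷ bs) (Fin.suc v) = lookup-at bs v

  spider-dominating : ∀ ls (U : Vec Bool (spiderSize ls)) → T (isDominating (spider ls) U) ⇔ (∀ k → k < spiderSize ls → Dominated (at U) ls 1 k)
  spider-dominating ls U = mk⇔ there back′
    where
    near : Fin (spiderSize ls) → Fin (spiderSize ls) → Bool
    near v u = lookup U u ∧ spider ls v u
    ok : Fin (spiderSize ls) → Bool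
    ok v = lookup U v ∨ any (near v) (vertices (spiderSize ls))
    there : T (isDominating (spider ls) U) → ∀ k → k < spiderSize ls → Dominated (at U) ls 1 k
    there t k k< = subst (Dominated (at U) ls 1) (toℕ-fromℕ< k<) (case (to (T-∨ {lookup U v}) (to (all-tabulate ok id) t v)))
      where
      v : Fin (spiderSize ls)
      v = fromℕ< k<
      case : T (lookup U v) ⊎ T (any (near v) (vertices (spiderSize ls))) → Dominated (at U) ls 1 (toℕ v)
      case (inj₁ t) = inj₁ (subst T (lookup-at U v) t)
      case (inj₂ t) = let (u , r) = to (any-tabulate (near v) id) t ; (here , adj) = to (T-∧ {lookup U u}) r in
        inj₂ (toℕ u , subst T (lookup-at U u) here , [ inj₁ ∘ edge⇒ ls 1 _ _ , inj₂ ∘ edge⇒ ls 1 _ _ ]′ (to (T-∨ {spiderEdgeℕ ls 1 (toℕ v) (toℕ u)}) adj))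
    back′ : (∀ k → k < spiderSize ls → Dominated (at U) ls 1 k) → T (isDominating (spider ls) U)
    back′ h = from (all-tabulate ok id) λ v → case v (h (toℕ v) (toℕ<n v))
      where
      case : ∀ v → Dominated (at U) ls 1 (toℕ v) → T (ok v)
      case v (inj₁ t) = from (T-∨ {lookup U v}) (inj₁ (subst T (sym (lookup-at U v)) t))
      case v (inj₂ (j , t , e)) = from (T-∨ {lookup U v}) (inj₂ (from (any-tabulate (near v) id) (u , from (T-∧ {lookup U u})
        (subst T (sym (trans (lookup-at U u) (cong (at U) u≡j))) t ,
         subst (λ i → T (spiderEdgeℕ ls 1 (toℕ v) i ∨ spiderEdgeℕ ls 1 i (toℕ v))) (sym u≡j)
           (from (T-∨ {spiderEdgeℕ ls 1 (toℕ v) j}) ([ inj₁ ∘ ⇒edge , inj₂ ∘ ⇒edge ]′ e))))))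
        where
        u : Fin (spiderSize ls)
        u = fromℕ< (at-< U j t)
        u≡j : toℕ u ≡ j
        u≡j = toℕ-fromℕ< (at-< U j t)

  spiderOK⇔ : ∀ ls (U : Vec Bool (spiderSize ls)) → T (spiderOK ls U) ⇔ (∀ k → k < spiderSize ls → Dominated (at U) ls 1 k)
  spiderOK⇔ ls U@(c ∷ bs) = mk⇔ there back′
    where
    M : Matches (at U) 1 bs
    M i _ = refl
    there : T (spiderOK ls U) → ∀ k → k < spiderSize ls → Dominated (at U) ls 1 k
    there t zero    _  = [ inj₁ , (λ h → let (j , t , e) = to (endpoints⇔ (at U) ls 1 bs (s≤s z≤n) M) h in inj₂ (j , t , inj₁ e)) ]′
      (to (T-∨ {c}) (proj₁ (to (T-∧ {c ∨ endpoints ls bs}) t)))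
    there t (suc k) k< = to (legsOK⇔ (at U) ls 1 bs (s≤s z≤n) M) (proj₂ (to (T-∧ {c ∨ endpoints ls bs}) t)) (suc k) (s≤s z≤n) k<
    back′ : (∀ k → k < spiderSize ls → Dominated (at U) ls 1 k) → T (spiderOK ls U)
    back′ h = from (T-∧ {c ∨ endpoints ls bs}) (centre-ok (h 0 (s≤s z≤n)) , from (legsOK⇔ (at U) ls 1 bs (s≤s z≤n) M) (λ k _ k< → h k k<))
      where
      centre-ok : Dominated (at U) ls 1 0 → T (c ∨ endpoints ls bs)
      centre-ok (inj₁ t) = from (T-∨ {c}) (inj₁ t)
      centre-ok (inj₂ (j , t , inj₁ e)) = from (T-∨ {c}) (inj₂ (from (endpoints⇔ (at U) ls 1 bs (s≤s z≤n) M) (j , t , e)))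
      centre-ok (inj₂ (j , t , inj₂ e)) = ⊥-elim (<⇒≱ (s≤s z≤n) (target-≥ e))

  isDominating≡spiderOK : ∀ ls U → isDominating (spider ls) U ≡ spiderOK ls U
  isDominating≡spiderOK ls U = T-injective (to (spiderOK⇔′) ∘ to (spider-dominating ls U)) (from (spider-dominating ls U) ∘ to (spiderOK⇔ ls U))
    where
    spiderOK⇔′ : (∀ k → k < spiderSize ls → Dominated (at U) ls 1 k) ⇔ T (spiderOK ls U)
    spiderOK⇔′ = mk⇔ (from (spiderOK⇔ ls U)) (to (spiderOK⇔ ls U))
    T-injective : ∀ {a b} → (T a → T b) → (T b → T a) → a ≡ b
    T-injective {false} {false} f g = refl
    T-injective {false} {true}  f g = ⊥-elim (g tt)
    T-injective {true}  {false} f g = ⊥-elim (f tt)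
    T-injective {true}  {true}  f g = refl

-- Generating functions of dominating sets, and the conclusion.

module DominationCounts where
  open FormalPowerSeries
  open IntegerSolver
  open import Defs
  open BivariateSeries
  open SpiderSeries
  open SpiderMinors using (F; G; gap; shift)
  open SpiderProfile using (counts)
  open UnimodalityCriterion
  open ExceptionalSpiders using (spider-unimodal)
  open DominatingSubsets
  open import Data.Nat.Base as ℕ using (ℕ; zero; suc; _≡ᵇ_)
  import Data.Nat.Properties as ℕₚ
  open import Data.Bool.Base using (Bool; true; false; _∧_; if_then_else_)
  open import Data.Bool.Properties using (T?)
  open import Data.Vec.Base using (Vec; []; _∷_)
  open import Data.List.Base using (List; []; _∷_; map; _++_; length; filter; upTo; applyUpTo)
  open import Data.List.Properties using (length-map; length-upTo)
  open import Data.List.Relation.Unary.All using (All; []; _∷_)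
  open import Data.Nat.ListAction using (sum)
  open import Data.Product.Base using (_,_)
  open import Data.Integer.Base using (ℤ; +_; _+_; _≤_)
  open import Data.Integer.Properties using (+-comm; pos-+; drop‿+≤+)
  import Data.Sum.Base
  import Data.Empty
  open import Function.Base using (_∘_; id)
  open import Relation.Binary.PropositionalEquality

  -- The generating function by size; a chosen vertex contributes a factor x.
  subsets : ∀ {n} → (Vec Bool n → Bool) → ℕ → ℤ
  subsets {zero}  p = if p [] then R₁.1# else R₁.0#
  subsets {suc n} p = subsets (p ∘ (false ∷_)) R₁.+ shift (subsets (p ∘ (true ∷_)))

  subsets-cong : ∀ {n} {p q : Vec Bool n → Bool} → (∀ U → p U ≡ q U) → subsets p R₁.≈ subsets q
  subsets-cong {zero}  eq k = cong (λ b → (if b then R₁.1# else R₁.0#) k) (eq [])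
  subsets-cong {suc n} eq = R₁.+-cong (subsets-cong (eq ∘ (false ∷_))) (R₁.*-congˡ {S₁.X} (subsets-cong (eq ∘ (true ∷_))))

  module _ {A : Set} where
    countIf : (A → Bool) → List A → ℕ
    countIf q xs = length (filter (λ x → T? (q x)) xs)

    countIf-++ : ∀ q xs ys → countIf q (xs ++ ys) ≡ countIf q xs ℕ.+ countIf q ys
    countIf-++ q []       ys = refl
    countIf-++ q (x ∷ xs) ys with q x
    ... | true  = cong suc (countIf-++ q xs ys)
    ... | false = countIf-++ q xs ys

    countIf-cong : ∀ {q r} → (∀ x → q x ≡ r x) → ∀ xs → countIf q xs ≡ countIf r xs
    countIf-cong eq []       = refl
    countIf-cong {q} {r} eq (x ∷ xs) with q x | r x | eq x
    ... | true  | .true  | refl = cong suc (countIf-cong eq xs)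
    ... | false | .false | refl = countIf-cong eq xs

    countIf-none : ∀ {q} → (∀ x → q x ≡ false) → ∀ xs → countIf q xs ≡ 0
    countIf-none eq []       = refl
    countIf-none {q} eq (x ∷ xs) with q x | eq x
    ... | .false | refl = countIf-none eq xs

  countIf-map : ∀ {A B : Set} (q : B → Bool) (f : A → B) xs → countIf q (map f xs) ≡ countIf (q ∘ f) xs
  countIf-map q f []       = refl
  countIf-map q f (x ∷ xs) with q (f x)
  ... | true  = cong suc (countIf-map q f xs)
  ... | false = countIf-map q f xs

  subsets-count : ∀ {n} (p : Vec Bool n → Bool) i → + countIf (λ U → p U ∧ (size U ≡ᵇ i)) (allSubsets n) ≡ subsets p i
  subsets-count {zero} p zero    with p []
  ... | true  = refl
  ... | false = refl
  subsets-count {zero} p (suc i) with p []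
  ... | true  = refl
  ... | false = refl
  subsets-count {suc n} p i = trans (cong +_ (countIf-++ (sized p i) (map (false ∷_) (allSubsets n)) (map (true ∷_) (allSubsets n))))
    (trans (pos-+ (countIf (sized p i) (map (false ∷_) (allSubsets n))) _)
      (cong₂ _+_
        (trans (cong +_ (countIf-map (sized p i) (false ∷_) (allSubsets n))) (subsets-count (p ∘ (false ∷_)) i))
        (trans (cong +_ (countIf-map (sized p i) (true ∷_) (allSubsets n))) (with-first i))))
    where
    sized : ∀ {m} → (Vec Bool m → Bool) → ℕ → Vec Bool m → Bool
    sized p i U = p U ∧ (size U ≡ᵇ i)
    with-first : ∀ i → + countIf (sized p i ∘ (true ∷_)) (allSubsets n) ≡ shift (subsets (p ∘ (true ∷_))) i
    with-first zero    = trans (cong +_ (countIf-none (λ U → ∧-false (p (true ∷ U))) (allSubsets n))) (sym (S₁.X-⊛-zero (subsets (p ∘ (true ∷_)))))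
      where
      ∧-false : ∀ b → b ∧ false ≡ false
      ∧-false true  = refl
      ∧-false false = refl
    with-first (suc i) = trans (subsets-count (p ∘ (true ∷_)) i) (sym (S₁.X-⊛-suc (subsets (p ∘ (true ∷_))) i))

  subsets-none : ∀ n → subsets {n} (λ _ → false) R₁.≈ R₁.0#
  subsets-none zero    = R₁.refl {R₁.0#}
  subsets-none (suc n) = R₁.trans (R₁.+-cong (subsets-none n) (R₁.trans (R₁.*-congˡ {S₁.X} (subsets-none n)) (R₁.zeroʳ S₁.X))) (R₁.+-identityˡ R₁.0#)

  subsets-split : ∀ l {m} (q : Vec Bool l → Bool) (r : Vec Bool m → Bool) →
    subsets {l ℕ.+ m} (λ U → q (front l U) ∧ r (back l U)) R₁.≈ subsets q R₁.* subsets r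
  subsets-split zero {m} q r with q []
  ... | true  = R₁.sym (R₁.*-identityˡ (subsets r))
  ... | false = R₁.trans (subsets-none m) (R₁.sym (R₁.zeroˡ (subsets r)))
  subsets-split (suc l) q r = R₁.trans
    (R₁.+-cong (subsets-split l (q ∘ (false ∷_)) r) (R₁.trans (R₁.*-congˡ {S₁.X} (subsets-split l (q ∘ (true ∷_)) r)) (R₁.sym (R₁.*-assoc S₁.X _ (subsets r)))))
    (R₁.sym (R₁.distribʳ (subsets r) (subsets (q ∘ (false ∷_))) (shift (subsets (q ∘ (true ∷_))))))

  open IntSolver ℤ⟦x⟧ ι₁

  -- Up to a shift of the index in `inside`, these are A, E and D. The mutual recursion removes the
  -- first vertex: after a chosen predecessor it may be left out freely, and two unchosen vertices
  -- in a row require the next one to be chosen.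
  inside : ∀ l → subsets {l} (pathOK true) R₁.≈ P₁.γ (2 ℕ.+ l) R₁.+ P₁.γ (1 ℕ.+ l)
  silent : ∀ l → subsets {l} (λ bs → pathOK false (false ∷ bs)) R₁.≈ P₁.legE l
  outside : ∀ l → subsets {suc l} (pathOK false) R₁.≈ P₁.legE l R₁.+ P₁.legO l
  inside zero          = R₁.sym (R₁.+-identityʳ R₁.1#)
  inside (suc zero)    = R₁.trans (R₁.+-comm R₁.1# (shift R₁.1#))
    (λ k → cong (λ c → c + R₁.1# k) (R₁.*-congˡ {S₁.X} {R₁.1#} {R₁.1# R₁.+ R₁.0# R₁.+ R₁.0#}
      (R₁.sym (R₁.trans (R₁.+-identityʳ (R₁.1# R₁.+ R₁.0#)) (R₁.+-identityʳ R₁.1#))) k))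
  inside (suc (suc l)) = R₁.trans (R₁.+-cong (outside l) (R₁.*-congˡ {S₁.X} (inside (suc l))))
    (solve 5 (λ x p q r s → x :* (r :+ s) :+ x :* (q :+ r) :+ x :* (p :+ q) := x :* (p :+ q :+ r) :+ x :* (q :+ r :+ s)) R₁.refl
      S₁.X (P₁.γ (3 ℕ.+ l)) (P₁.γ (2 ℕ.+ l)) (P₁.γ (1 ℕ.+ l)) (P₁.γ l))
  silent zero    = R₁.sym (R₁.trans (R₁.*-congˡ {S₁.X} (R₁.+-identityˡ R₁.0#)) (R₁.zeroʳ S₁.X))
  silent (suc l) = R₁.trans (R₁.+-cong (subsets-none l) (R₁.*-congˡ {S₁.X} (inside l))) (R₁.+-identityˡ _)
  outside l = R₁.+-cong (silent l) (R₁.*-congˡ {S₁.X} (inside l))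

  legs-inside : ∀ ns → subsets (legsOK true (map suc ns)) R₁.≈ F ns
  legs-inside []       = R₁.refl {R₁.1#}
  legs-inside (n ∷ ns) = R₁.trans (subsets-split (suc n) (pathOK true) (legsOK true (map suc ns))) (R₁.*-cong (inside (suc n)) (legs-inside ns))

  legs-outside : ∀ ns → subsets (legsOK false (map suc ns)) R₁.≈ G ns
  legs-outside []       = R₁.refl {R₁.1#}
  legs-outside (n ∷ ns) = R₁.trans (subsets-split (suc n) (pathOK false) (legsOK false (map suc ns)))
    (R₁.trans (R₁.*-cong (outside n) (legs-outside ns)) (R₁.*-comm (P₁.legE n R₁.+ P₁.legO n) (G ns)))

  legs-endpoint : ∀ ns → subsets (λ bs → endpoints (map suc ns) bs ∧ legsOK false (map suc ns) bs) R₁.≈ gap ns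
  legs-endpoint []       = R₁.refl {R₁.0#}
  -- In the first summand the endpoint of this leg is not chosen and another leg must provide one;
  -- in the second it is chosen and the other legs are free.
  legs-endpoint (n ∷ ns) = R₁.+-cong
    (R₁.trans (subsets-cong (λ U → rotate (endpoints (map suc ns) (back n U)) (pathOK false (false ∷ front n U)) (legsOK false (map suc ns) (back n U))))
      (R₁.trans (subsets-split n (λ bs → pathOK false (false ∷ bs)) (λ bs → endpoints (map suc ns) bs ∧ legsOK false (map suc ns) bs))
      (R₁.trans (R₁.*-cong (silent n) (legs-endpoint ns)) (R₁.*-comm (P₁.legE n) (gap ns)))))
    (R₁.trans (R₁.*-congˡ {S₁.X} (R₁.trans (subsets-split n (pathOK true) (legsOK false (map suc ns))) (R₁.*-cong (inside n) (legs-outside ns))))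
      (solve 3 (λ x a g → x :* (a :* g) := g :* (x :* a)) R₁.refl S₁.X (P₁.γ (2 ℕ.+ n) R₁.+ P₁.γ (1 ℕ.+ n)) (G ns)))
    where
    rotate : ∀ a b c → a ∧ (b ∧ c) ≡ b ∧ (a ∧ c)
    rotate true  b     c = refl
    rotate false true  c = refl
    rotate false false c = refl

  domCount-counts : ∀ ns i → + domCount (spider (map suc ns)) i ≡ counts ns i
  domCount-counts ns i = trans
    (cong +_ (countIf-cong (λ U → cong (_∧ (size U ≡ᵇ i)) (isDominating≡spiderOK (map suc ns) U)) (allSubsets (spiderSize (map suc ns)))))
    (trans (subsets-count (spiderOK (map suc ns)) i)
      (trans (cong₂ _+_ (legs-endpoint ns i) (R₁.*-congˡ {S₁.X} (legs-inside ns) i)) (+-comm (gap ns i) (shift (F ns) i))))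

  nth-map-upTo : ∀ (f : ℕ → ℕ) n i → i ℕ.< n → nth (map f (upTo n)) i ≡ f i
  nth-map-upTo f n = go id n
    where
    go : ∀ (g : ℕ → ℕ) n i → i ℕ.< n → nth (map f (applyUpTo g n)) i ≡ f (g i)
    go g (suc n) zero    _           = refl
    go g (suc n) (suc i) (ℕ.s≤s i<n) = go (g ∘ suc) n i i<n

  -- The list begins with index 1, so the peak moves down by one. It is capped at n, since a peak
  -- beyond the last entry would demand an increase to the default value 0 of `nth`.
  unimodal-list : ∀ (f : ℕ → ℕ) n → UnimodalUpTo (suc n) (λ i → + f i) → Unimodal (map (f ∘ suc) (upTo (suc n)))
  unimodal-list f n (k , up , down) = ℕ.pred k ℕ.⊓ n , rising , falling
    where
    entry : ∀ i → i ℕ.≤ n → nth (map (f ∘ suc) (upTo (suc n))) i ≡ f (suc i)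
    entry i i≤n = nth-map-upTo (f ∘ suc) (suc n) i (ℕ.s≤s i≤n)
    suc≤ : ∀ {k} i → suc i ℕ.≤ ℕ.pred k → suc i ℕ.< k
    suc≤ {suc k} i p = ℕ.s≤s p
    ≤suc : ∀ {k i} → ℕ.pred k ℕ.≤ i → k ℕ.≤ suc i
    ≤suc {zero}  p = ℕ.z≤n
    ≤suc {suc k} p = ℕ.s≤s p
    rising : ∀ i → suc i ℕ.≤ ℕ.pred k ℕ.⊓ n → _
    rising i p = subst₂ ℕ._≤_ (sym (entry i (ℕₚ.≤-trans (ℕₚ.n≤1+n i) 1+i≤n))) (sym (entry (suc i) 1+i≤n))
      (drop‿+≤+ (up (suc i) (suc≤ i (ℕₚ.≤-trans p (ℕₚ.m⊓n≤m (ℕ.pred k) n)))))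
      where
      1+i≤n : suc i ℕ.≤ n
      1+i≤n = ℕₚ.≤-trans p (ℕₚ.m⊓n≤n (ℕ.pred k) n)
    falling : ∀ i → ℕ.pred k ℕ.⊓ n ℕ.≤ i → suc i ℕ.< length (map (f ∘ suc) (upTo (suc n))) → _
    falling i p 1+i< = subst₂ ℕ._≤_ (sym (entry (suc i) (ℕ.s≤s⁻¹ 1+i<n))) (sym (entry i (ℕₚ.≤-trans (ℕₚ.n≤1+n i) (ℕ.s≤s⁻¹ 1+i<n))))
      (drop‿+≤+ (down (suc i) (≤suc below) 1+i<n))
      where
      1+i<n : suc i ℕ.< suc n
      1+i<n = subst (suc i ℕ.<_) (trans (length-map (f ∘ suc) (upTo (suc n))) (length-upTo (suc n))) 1+i<
      below : ℕ.pred k ℕ.≤ i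
      below with ℕₚ.⊓-sel (ℕ.pred k) n
      ... | Data.Sum.Base.inj₁ eq = subst (ℕ._≤ i) eq p
      ... | Data.Sum.Base.inj₂ eq = Data.Empty.⊥-elim (ℕₚ.<⇒≱ (ℕ.s≤s⁻¹ 1+i<n) (subst (ℕ._≤ i) eq p))

  suc-pred : ∀ ls → All (0 ℕ.<_) ls → map suc (map ℕ.pred ls) ≡ ls
  suc-pred []           []      = refl
  suc-pred (suc l ∷ ls) (_ ∷ p) = cong (suc l ∷_) (suc-pred ls p)

  spider-dom-unimodal : ∀ ls → All (0 ℕ.<_) ls → Unimodal (domCoeffs (spider ls))
  spider-dom-unimodal ls positive = subst (λ ls → Unimodal (domCoeffs (spider ls))) (suc-pred ls positive)
    (unimodal-list (domCount (spider (map suc ns))) (sum (map suc ns))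
      (UnimodalUpTo-resp (λ i → sym (domCount-counts ns i)) (spider-unimodal ns (suc (sum (map suc ns))))))
    where
    ns : List ℕ
    ns = map ℕ.pred ls

open import Defs
open import Data.Nat using (ℕ; _≤_; _<_)
open import Data.List using (List; length)
open import Data.List.Relation.Unary.All using (All)

theorem3p6 : (ls : List ℕ) → length ls ≤ 400 → All (0 <_) ls →
  Unimodal (domCoeffs (spider ls))
theorem3p6 ls _ = DominationCounts.spider-dom-unimodal ls
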